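{- Let $\rho_3=2\sqrt[3]{4}$. If $H$ is a connected $3$-uniform hypergraph with $\rho(H)<\rho_3$, then $H$ is isomorphic to one of the following hypergraphs: (1) $A^{(3)}_n$ for some $n\geq 1$; (2) $D^{(3)}_n$ for some $n\geq 3$; (3) ${D'}^{(3)}_n$ for some $n\geq 4$; (4) $B^{(3)}_n$ for some $n\geq 5$; (5) ${B'}^{(3)}_n$ for some $n\geq 6$; (6) $\bar B^{(3)}_n$ for some $n\geq 7$; (7) $BD^{(3)}_n$ for some $n\geq 5$; (8) one of the thirty-one exceptional hypergraphs $E^{(3)}_6$, $E^{(3)}_7$, $E^{(3)}_8$, $F^{(3)}_{2,3,3}$, $F^{(3)}_{2,2,k}$ ($2\leq k\leq 6$), $F^{(3)}_{1,3,k}$ ($3\leq k\leq 13$), $F^{(3)}_{1,4,k}$ ($4\leq k\leq 7$), $F^{(3)}_{1,5,5}$, $G^{(3)}_{1,1:k:1,3}$ ($0\leq k\leq 5$).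
   Context: An $r$-uniform hypergraph $H=(V,E)$ has a finite vertex set $V$ and edge set $E\subseteq\binom{V}{r}$. The degree of a vertex is the number of edges containing it. A walk is a sequence $v_0e_1v_1\cdots e_lv_l$ with $v_{i-1},v_i\in e_i$; $H$ is connected if any two vertices are joined by a walk. The spectral radius is $\rho(H)=\max_{x\in\mathbb{R}^{V}_{\geq 0},x\neq 0} \frac{r!\sum_{e\in E}\prod_{v\in e}x_v}{\sum_{v\in V}x_v^r}$. Hypergraphs are considered up to isomorphism. Special $3$-uniform hypergraphs. A path of length $k\geq1$ is a sequence of edges $e_1,\dots,e_k$ with $|e_i\cap e_{i+1}|=1$ and $e_i\cap e_j=\emptyset$ for $|i-j|\geq 2$. Attaching a pendant path of length $k\geq 1$ at a vertex $v$ means adding new edges $e_1,\dots,e_k$ forming a path of length $k$ with $v\in e_1$, $v\notin e_j$ for $j\geq2$, and all other vertices of the $e_i$ new; length $0$ means adding nothing. A pendant edge is a pendant path of length $1$. - $A^{(3)}_n$: a path of length $n$. - $E^{(3)}_{i,j,k}$: a vertex $v$ with pendant paths of lengths $i,j,k\geq1$ attached at $v$. Aliases: $E^{(3)}_6=E^{(3)}_{1,2,2}$, $E^{(3)}_7=E^{(3)}_{1,2,3}$, $E^{(3)}_8=E^{(3)}_{1,2,4}$, $D^{(3)}_n=E^{(3)}_{1,1,n-2}$. - $F^{(3)}_{i,j,k}$: an edge $\{a,b,c\}$ with pendant paths of lengths $i,j,k$ attached at $a,b,c$ respectively. Aliases: ${D'}^{(3)}_n=F^{(3)}_{1,1,n-3}$,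 $B^{(3)}_n=F^{(3)}_{1,2,n-4}$. - $G^{(3)}_{i,j:k:l,m}$ ($k\geq0$): a path with edges $e_0,\dots,e_{k+1}$; let $u_1,u_2$ be the two vertices of $e_0$ not in $e_1$ and $u_3,u_4$ the two vertices of $e_{k+1}$ not in $e_k$; attach pendant paths of lengths $i,j,l,m$ at $u_1,u_2,u_3,u_4$ respectively. Aliases: ${B'}^{(3)}_n=G^{(3)}_{1,1:(n-6):1,1}$, $\bar B^{(3)}_n=G^{(3)}_{1,1:(n-7):1,2}$. - $BD^{(3)}_n$ ($n\geq5$): a path $e_1,\dots,e_{n-2}$ with a pendant edge attached at the vertex of $e_1\cap e_2$ and a pendant edge attached at the unique vertex of $e_{n-3}$ lying in no other edge of the path. In every case the subscript $n$ is the number of edges.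
   Formalization: The formal statement additionally assumes that H has at least one edge: the single vertex with no edges is connected with spectral radius 0 but is not isomorphic to any hypergraph in the list (and with no vertices the spectral radius is undefined). -}

module Defs where

open import Data.Nat as ℕ using (ℕ; zero; suc; _+_; _∸_)
open import Data.Fin using (Fin; toℕ)
open import Data.Product using (_×_; _,_; Σ)
open import Data.Sum using (_⊎_)
open import Data.List using (List; []; _∷_; _++_; foldr; map; allFin)
open import Data.List.Relation.Unary.Any using (Any)
open import Data.List.Relation.Unary.All using (All)
open import Data.List.Relation.Unary.AllPairs using (AllPairs)
open import Data.Integer using (+_)
open import Data.Rational as ℚ using (ℚ; 0ℚ; _/_)
open import Relation.Nullary using (¬_)
open import Relation.Binary.PropositionalEquality using (_≡_; _≢_)
open import Relation.Binary.Construct.Closure.ReflexiveTransitive using (Star)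
open import Function.Bundles using (_↔_; Inverse)

Triple : Set → Set
Triple A = A × A × A

_∈₃_ : {A : Set} → A → Triple A → Set
a ∈₃ (x , y , z) = a ≡ x ⊎ a ≡ y ⊎ a ≡ z

Distinct₃ : {A : Set} → Triple A → Set
Distinct₃ (a , b , c) = a ≢ b × a ≢ c × b ≢ c

-- t has three distinct entries, all lying in e.  When e also has three
-- distinct entries this says exactly that t and e are the same 3-set.
SameSet : {A : Set} → Triple A → Triple A → Set
SameSet t@(a , b , c) e = Distinct₃ t × a ∈₃ e × b ∈₃ e × c ∈₃ e

record Hypergraph3 : Set where
  field
    n        : ℕ
    E        : List (Triple (Fin n))
    distinct : All Distinct₃ E
    noDup    : AllPairs (λ e e′ → ¬ SameSet e e′) E
open Hypergraph3 public

EdgeH : (H : Hypergraph3) → Fin (n H) → Fin (n H) → Fin (n H) → Set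
EdgeH H a b c = Any (SameSet (a , b , c)) (E H)

Adj : (H : Hypergraph3) → Fin (n H) → Fin (n H) → Set
Adj H u v = Any (λ e → u ∈₃ e × v ∈₃ e) (E H)

Connected : Hypergraph3 → Set
Connected H = ∀ u v → Star (Adj H) u v

-- Spectral radius (r = 3, r! = 6).
--   ρ(H) = max_{x ≥ 0, x ≠ 0} 6 Σ_{e} Π_{v∈e} x_v / Σ_v x_v³.

sumℚ : List ℚ → ℚ
sumℚ = foldr ℚ._+_ 0ℚ

edgeForm : (H : Hypergraph3) → (Fin (n H) → ℚ) → ℚ
edgeForm H x = sumℚ (map (λ { (a , b , c) → x a ℚ.* x b ℚ.* x c }) (E H))

cubeSum : (H : Hypergraph3) → (Fin (n H) → ℚ) → ℚ
cubeSum H x = sumℚ (map (λ v → x v ℚ.* x v ℚ.* x v) (allFin (n H)))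

-- ρ(H) ≤ q : for every nonnegative x, 6 Σ_e Π x ≤ q Σ_v x_v³
-- (for x = 0 both sides vanish, so x ≠ 0 need not be required)
SpectralRadius≤ : Hypergraph3 → ℚ → Set
SpectralRadius≤ H q =
  (x : Fin (n H) → ℚ) → (∀ v → 0ℚ ℚ.≤ x v) →
  ((+ 6) / 1) ℚ.* edgeForm H x ℚ.≤ q ℚ.* cubeSum H x

-- ρ(H) < ρ₃ = 2·∛4   (ρ₃³ = 32)
SpectralRadius<ρ₃ : Hypergraph3 → Set
SpectralRadius<ρ₃ H =
  Σ ℚ λ q → (q ℚ.* q ℚ.* q ℚ.< (+ 32) / 1) × SpectralRadius≤ H q

-- Concrete hypergraphs, presented by vertex labels 0 … nv-1 in ℕ.

record Presentation : Set where
  constructor pres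
  field
    nv : ℕ
    es : List (Triple ℕ)
open Presentation public

EdgeP : Presentation → ℕ → ℕ → ℕ → Set
EdgeP P a b c = Any (SameSet (a , b , c)) (es P)

_≅_ : Hypergraph3 → Presentation → Set
H ≅ P = Σ (Fin (n H) ↔ Fin (nv P)) λ f →
  let g = λ v → toℕ (Inverse.to f v) in
  ∀ a b c → (EdgeH H a b c → EdgeP P (g a) (g b) (g c))
          × (EdgeP P (g a) (g b) (g c) → EdgeH H a b c)

-- pendant path of length k at vertex v, new vertices s, s+1, …, s+2k-1:
-- edges {v,s,s+1}, {s+1,s+2,s+3}, {s+3,s+4,s+5}, …
pendant : ℕ → ℕ → ℕ → List (Triple ℕ)
pendant v s zero    = []
pendant v s (suc k) = (v , s , suc s) ∷ pendant (suc s) (suc (suc s)) k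

A : ℕ → Presentation
A k = pres (1 + 2 ℕ.* k) (pendant 0 1 k)

Ehg : ℕ → ℕ → ℕ → Presentation
Ehg i j k = pres (1 + 2 ℕ.* (i + j + k))
  (pendant 0 1 i ++ pendant 0 (1 + 2 ℕ.* i) j
                 ++ pendant 0 (1 + 2 ℕ.* (i + j)) k)

Fhg : ℕ → ℕ → ℕ → Presentation
Fhg i j k = pres (3 + 2 ℕ.* (i + j + k))
  ((0 , 1 , 2) ∷ pendant 0 3 i ++ pendant 1 (3 + 2 ℕ.* i) j
                              ++ pendant 2 (3 + 2 ℕ.* (i + j)) k)

-- G_{i,j:k:l,m} : path e₀ = {0,1,2}, e₁ = {2,3,4}, …, e_{k+1} = {2k+2,2k+3,2k+4};
-- u₁ = 0, u₂ = 1, u₃ = 2k+3, u₄ = 2k+4; pendant paths of lengths i, j, l, m.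
Ghg : ℕ → ℕ → ℕ → ℕ → ℕ → Presentation
Ghg i j k l m = pres (s + 2 ℕ.* (i + j + l + m))
  (pendant 0 1 (2 + k)
     ++ pendant 0 s i
     ++ pendant 1 (s + 2 ℕ.* i) j
     ++ pendant (3 + 2 ℕ.* k) (s + 2 ℕ.* (i + j)) l
     ++ pendant (4 + 2 ℕ.* k) (s + 2 ℕ.* (i + j + l)) m)
  where s = 5 + 2 ℕ.* k

-- BD_n (n ≥ 5): path e₁ … e_{n-2} with e_t = {2t-2, 2t-1, 2t}; pendant edge
-- at 2 (= e₁ ∩ e₂) and at 2n-7 (the vertex of e_{n-3} in no other path edge).
BD : ℕ → Presentation
BD k = pres (1 + 2 ℕ.* k)
  (pendant 0 1 (k ∸ 2)
     ++ (2 , 2 ℕ.* k ∸ 3 , 2 ℕ.* k ∸ 2)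
     ∷ (2 ℕ.* k ∸ 7 , 2 ℕ.* k ∸ 1 , 2 ℕ.* k) ∷ [])

D D′ B B′ B̄ : ℕ → Presentation
D  k = Ehg 1 1 (k ∸ 2)
D′ k = Fhg 1 1 (k ∸ 3)
B  k = Fhg 1 2 (k ∸ 4)
B′ k = Ghg 1 1 (k ∸ 6) 1 1
B̄  k = Ghg 1 1 (k ∸ 7) 1 2

E₆ E₇ E₈ : Presentation
E₆ = Ehg 1 2 2
E₇ = Ehg 1 2 3
E₈ = Ehg 1 2 4

-- Call nonnegative weights y on the vertices and c on the edges a certificate if
-- 4 cₑ³ ≤ the product of the y along e and Σ y ≤ 3 Σ c; testing the spectral radius on
-- (rational approximations of) the cube roots of y shows ρ(H) ≥ ρ₃.  A cycle has the
-- certificate c = 1, y = 2 at the joints and y = 1 elsewhere, so ρ(H) < ρ₃ forces H to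
-- be a hypertree.  On a rooted hypertree a certificate is propagated from the leaves: if arms
-- of shares w₁, w₂ hang at the two far vertices of an edge, this edge takes the share
-- 1 / (4 (1 - w₁) (1 - w₂)) of the weight at its near vertex, and a total share ≥ 1 at
-- the root is a certificate.  A pendant path of length k has share k / (2 k + 2), an edge
-- with two pendant edges counts as a path of length 8, and every branching vertex passes
-- on a share ≥ 1/2.  Computing shares at a vertex of degree 3, or else at an edge all of
-- whose vertices have degree 2, excludes all but the listed shapes; if neither exists, H
-- is a path.

module Submission where

open import Defs
open import Data.Nat
open import Data.Nat.Properties
open import Data.Nat.ListAction using (sum)
open import Data.Nat.Tactic.RingSolver using (solve-∀)
import Data.Integer as ℤ
import Data.Integer.Properties as ℤ
open import Data.Rational as ℚ using (ℚ; mkℚ; toℚᵘ)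
import Data.Rational.Properties as ℚ
open import Data.Rational.Unnormalised as ℚᵘ using (mkℚᵘ; *≡*)
import Data.Rational.Unnormalised.Properties as ℚᵘ
open import Data.Product using (_×_; _,_; Σ; ∃-syntax; proj₁; proj₂)
open import Data.Sum as Sum using (_⊎_; inj₁; inj₂)
open import Data.Empty using (⊥-elim)
open import Data.Fin using (Fin; zero; suc; toℕ; fromℕ<; punchOut)
import Data.Fin.Properties as Fin
open import Data.List using (List; []; _∷_; _++_; map; allFin; length; lookup; tabulate)
open import Data.List.Properties
  using (map-++; map-tabulate; tabulate-lookup; length-tabulate; length-++; ++-identityʳ)
open import Data.List.Relation.Unary.All as All using (All; []; _∷_)
import Data.List.Relation.Unary.All.Properties as All
open import Data.List.Relation.Unary.Any as Any using (here; there)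
import Data.List.Relation.Unary.Any.Properties as Any
open import Data.List.Relation.Unary.AllPairs using ([]; _∷_)
open import Data.List.Relation.Unary.Unique.Propositional using (Unique)
open import Data.List.Relation.Unary.Unique.Propositional.Properties using (allFin⁺)
open import Data.List.Relation.Binary.Pointwise using (Pointwise; []; _∷_; ++⁺)
open import Data.List.Membership.Propositional using (_∈_; _∉_; lose; find)
open import Data.List.Membership.Propositional.Properties
  using (∈-++⁺ˡ; ∈-++⁺ʳ; ∈-++⁻; ∈-allFin; ∈-lookup)
import Data.List.Membership.DecPropositional as DecMembership
open import Data.List.Relation.Binary.Permutation.Propositional
  using (_↭_; ↭-refl; ↭-sym; ↭-trans; prep; swap; ↭⇒↭ₛ)
open import Data.List.Relation.Binary.Permutation.Propositional.Properties
  using (++-commutativeMonoid; ∈-resp-↭; ++⁺ˡ; ++⁺ʳ; ↭-length; ++-comm)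
import Data.List.Relation.Binary.Permutation.Setoid.Properties as Permutation
import Algebra.Solver.CommutativeMonoid as CommutativeMonoidSolver
open import Relation.Nullary using (¬_; yes; no)
open import Relation.Binary.PropositionalEquality
open import Relation.Binary.Construct.Closure.ReflexiveTransitive using (Star; ε; _◅_)
open import Function using (_∘_; id)
open import Function.Bundles using (mk↔ₛ′)

-- Origin of the share formula: an edge takes the same amount c out of the weight of each of its
-- three vertices. If arms at the far vertices have used up the shares w₁ and w₂, then (1 - w₁) y₁ =
-- (1 - w₂) y₂ = c, the near vertex gives w y = c, and 4 c³ = y y₁ y₂ turns into 4 w (1 - w₁) (1 -
-- w₂) = 1. Only lower bounds on ρ(H) are needed: a shape is excluded by exhibiting weights, and no
-- spectral radius is ever computed. Cube roots are irrational, while ρ(H) < ρ₃ is witnessed by a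
-- rational bound. Hence all weights are natural numbers, and roots are rounded at a scale fine
-- enough for a strict inequality to absorb the error. Shares are kept as p / (p + g) with the
-- complement explicit, so that comparing them means a polynomial inequality over the naturals. A
-- share speaks of all multiples of a certificate, so that arms meeting at a vertex can be scaled to
-- agree there. The type of rooted hypertrees does not force branches to be disjoint; that is
-- carried by uniqueness of the edges and a count of the vertices.

-- Rounded cube roots and the room below 32.

cube : ℕ → ℕ
cube x = x * x * x

cube-mono-< : ∀ {x y} → x < y → cube x < cube y
cube-mono-< p = *-mono-< (*-mono-< p p) p

cube-cancel-≤ : ∀ {x y} → cube x ≤ cube y → x ≤ y
cube-cancel-≤ {x} {y} p with x ≤? y
... | yes q = q
... | no q = ⊥-elim (<⇒≱ (cube-mono-< (≰⇒> q)) p)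

≤-slack : ∀ {x y} d → y ≡ x + d → x ≤ y
≤-slack {x} d refl = m≤m+n x d

-- Rounded upwards, because products along edges must be bounded from below; minimality of the root
-- limits what the sum of cubes gains in return.
CubeRoot : ℕ → ℕ → Set
CubeRoot m x = m ≤ cube x × (x ≡ 0 ⊎ ∃[ y ] (x ≡ suc y × cube y < m))

cubeRoot : ∀ m → ∃[ x ] CubeRoot m x
cubeRoot zero = 0 , z≤n , inj₁ refl
cubeRoot (suc m) with cubeRoot m
... | x , lo , hi with suc m ≤? cube x
cubeRoot (suc m) | x , lo , inj₁ refl | yes ()
cubeRoot (suc m) | x , lo , inj₂ (y , e , h) | yes p = x , p , inj₂ (y , e , m≤n⇒m≤1+n h)
... | no p = suc x , ≤-trans (s≤s lo) (cube-mono-< (n<1+n x)) , inj₂ (x , refl , ≰⇒> p)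

-- For w ≥ 1 the step from w to w + 1 adds 3 w² + 3 w + 1 ≤ 7 w² to the cube, which is at most w³ /
-- (t + 1) once w ≥ 7 (t + 1). The scale `suc (7 * suc t)` makes the root that large whenever y is
-- positive.
approximate-cubeRoot : ∀ t y x → CubeRoot (cube (suc (7 * suc t)) * y) x →
                       suc t * cube x ≤ suc (suc t) * (cube (suc (7 * suc t)) * y)
approximate-cubeRoot t y x (lo , inj₁ refl) = subst (_≤ suc (suc t) * (cube (suc (7 * suc t)) * y)) (sym (*-zeroʳ (suc t))) z≤n
approximate-cubeRoot t zero x (lo , inj₂ (w , e , h)) =
  ⊥-elim (n≮0 (subst (cube w <_) (*-zeroʳ (cube (suc (7 * suc t)))) h))
approximate-cubeRoot t (suc y) x (lo , inj₂ (w , refl , h)) = begin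
  suc t * cube (suc w)                       ≡⟨ expand t w ⟩
  suc t * cube w + suc t * (3 * (w * w) + 3 * w + 1) ≤⟨ +-monoʳ-≤ (suc t * cube w) lower ⟩
  suc t * cube w + cube w                    ≡⟨ +-comm (suc t * cube w) (cube w) ⟩
  suc (suc t) * cube w                       ≤⟨ *-monoʳ-≤ (suc (suc t)) (<⇒≤ h) ⟩
  suc (suc t) * (cube (suc (7 * suc t)) * suc y) ∎
  where
  open ≤-Reasoning
  expand : ∀ t w → suc t * (suc w * suc w * suc w) ≡ suc t * (w * w * w) + suc t * (3 * (w * w) + 3 * w + 1)
  expand = solve-∀
  w≥ : 7 * suc t ≤ w
  w≥ = s≤s⁻¹ (cube-cancel-≤ (≤-trans (m≤m*n (cube (suc (7 * suc t))) (suc y)) lo))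
  1≤w : 1 ≤ w
  1≤w = ≤-trans (s≤s z≤n) w≥
  w≤w² : w ≤ w * w
  w≤w² = subst (_≤ w * w) (*-identityʳ w) (*-monoʳ-≤ w 1≤w)
  regroup : ∀ t s → suc t * (3 * s + 3 * s + s) ≡ s * (7 * suc t)
  regroup = solve-∀
  lower : suc t * (3 * (w * w) + 3 * w + 1) ≤ cube w
  lower = begin
    suc t * (3 * (w * w) + 3 * w + 1)
      ≤⟨ *-monoʳ-≤ (suc t) (+-mono-≤ (+-monoʳ-≤ (3 * (w * w)) (*-monoʳ-≤ 3 w≤w²)) (≤-trans 1≤w w≤w²)) ⟩
    suc t * (3 * (w * w) + 3 * (w * w) + w * w) ≡⟨ regroup t (w * w) ⟩
    w * w * (7 * suc t) ≤⟨ *-monoʳ-≤ (w * w) w≥ ⟩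
    w * w * w ∎

-- (a N + 1) / (2 b N) lies strictly between (a / b) / 2 and ∛4.
rational-gap : ∀ a b → cube a < 32 * cube b →
               let N = 3 * (a * a) + 3 * a + 1 in cube (suc (a * N)) ≤ 32 * cube (b * N)
rational-gap a b h = begin
  cube (suc (a * N))                      ≡⟨ expand a N ⟩
  cube a * cube N + (3 * (a * a) * (N * N) + 3 * a * N + 1) ≤⟨ +-monoʳ-≤ (cube a * cube N) small ⟩
  cube a * cube N + cube N                ≡⟨ +-comm (cube a * cube N) (cube N) ⟩
  suc (cube a) * cube N                   ≤⟨ *-monoˡ-≤ (cube N) h ⟩
  32 * cube b * cube N                    ≡⟨ collect b N ⟩
  32 * cube (b * N) ∎
  where
  open ≤-Reasoning
  N = 3 * (a * a) + 3 * a + 1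
  expand : ∀ a n → suc (a * n) * suc (a * n) * suc (a * n)
                   ≡ (a * a * a) * (n * n * n) + (3 * (a * a) * (n * n) + 3 * a * n + 1)
  expand = solve-∀
  collect : ∀ b n → 32 * (b * b * b) * (n * n * n) ≡ 32 * (b * n * (b * n) * (b * n))
  collect = solve-∀
  1≤N : 1 ≤ N
  1≤N = m≤n+m 1 (3 * (a * a) + 3 * a)
  N≤N² : N ≤ N * N
  N≤N² = subst (_≤ N * N) (*-identityʳ N) (*-monoʳ-≤ N 1≤N)
  factor : ∀ a m → 3 * (a * a) * m + 3 * a * m + m ≡ m * (3 * (a * a) + 3 * a + 1)
  factor = solve-∀
  small : 3 * (a * a) * (N * N) + 3 * a * N + 1 ≤ cube N
  small = begin
    3 * (a * a) * (N * N) + 3 * a * N + 1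
      ≤⟨ +-mono-≤ (+-monoʳ-≤ (3 * (a * a) * (N * N)) (*-monoʳ-≤ (3 * a) N≤N²)) (≤-trans 1≤N N≤N²) ⟩
    3 * (a * a) * (N * N) + 3 * a * (N * N) + N * N ≡⟨ factor a (N * N) ⟩
    N * N * N ∎

-- Finite sums and the bound forced by a certificate.

sumOver : ∀ {A : Set} → (A → ℕ) → List A → ℕ
sumOver f xs = sum (map f xs)

sumOver-mono-≤ : ∀ {A : Set} {f g : A → ℕ} → (∀ x → f x ≤ g x) → ∀ xs → sumOver f xs ≤ sumOver g xs
sumOver-mono-≤ h []       = z≤n
sumOver-mono-≤ h (x ∷ xs) = +-mono-≤ (h x) (sumOver-mono-≤ h xs)

sumOver-* : ∀ {A : Set} k (f : A → ℕ) xs → sumOver (λ x → k * f x) xs ≡ k * sumOver f xs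
sumOver-* k f []       = sym (*-zeroʳ k)
sumOver-* k f (x ∷ xs) = trans (cong (k * f x +_) (sumOver-* k f xs)) (sym (*-distribˡ-+ k (f x) (sumOver f xs)))

module _ {V I : Set} (p q r : I → V) (vs : List V) (is : List I) where

  private
    monomial : (V → ℕ) → I → ℕ
    monomial f i = f (p i) * f (q i) * f (r i)

  -- Rounding cube roots of a large multiple of Y costs only a factor close to 1 on
  -- the vertex side, which the strict inequality a³ < 32 b³ absorbs.
  lagrangian-bound : ∀ a b → cube a < 32 * cube b →
    (∀ (X : V → ℕ) → 6 * b * sumOver (monomial X) is ≤ a * sumOver (λ v → cube (X v)) vs) →
    ∀ (Y : V → ℕ) (C : I → ℕ) → (∀ i → 4 * cube (C i) ≤ monomial Y i) →
    0 < sumOver C is → ¬ (sumOver Y vs ≤ 3 * sumOver C is)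
  lagrangian-bound a b a<b hyp Y C edge pos tot = <-irrefl refl (begin-strict
      3 * (u * u + 2 * u) * (S³ * ΣC)        <⟨ *-monoˡ-< (S³ * ΣC) {{>-nonZero S³ΣC>0}} (*-monoʳ-< 3 (n<1+n (u * u + 2 * u))) ⟩
      3 * suc (u * u + 2 * u) * (S³ * ΣC)    ≡⟨ e₁ u (S³ * ΣC) ⟩
      3 * suc u * (suc u * (S³ * ΣC))        ≤⟨ *-monoʳ-≤ (3 * suc u) edges ⟩
      3 * suc u * (2 * (b * N) * ΣX)         ≡⟨ e₂ u b N ΣX ⟩
      N * suc u * (6 * b * ΣX)               ≤⟨ *-monoʳ-≤ (N * suc u) (hyp X) ⟩
      N * suc u * (a * ΣX³)                  ≡⟨ e₃ N (suc u) a ΣX³ ⟩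
      a * N * (suc u * ΣX³)                  ≤⟨ *-monoʳ-≤ (a * N) vertices ⟩
      a * N * (suc (suc u) * (S³ * ΣY))      ≤⟨ *-monoʳ-≤ (a * N) (*-monoʳ-≤ (suc (suc u)) (*-monoʳ-≤ S³ tot)) ⟩
      u * (suc (suc u) * (S³ * (3 * ΣC)))    ≡⟨ e₄ u S³ ΣC ⟩
      3 * (u * u + 2 * u) * (S³ * ΣC)        ∎)
    where
    open ≤-Reasoning
    N u S³ : ℕ
    N = 3 * (a * a) + 3 * a + 1
    -- By `rational-gap` the edge side gains the factor (u + 1) / u; the precision `u` for the roots
    -- costs the vertex side only (u + 2) / (u + 1). The contradiction is u (u + 2) < (u + 1)².
    u = a * N
    S³ = cube (suc (7 * suc u))
    X : V → ℕ
    X v = proj₁ (cubeRoot (S³ * Y v))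
    ΣC = sumOver C is
    ΣX = sumOver (monomial X) is
    ΣY = sumOver Y vs
    ΣX³ = sumOver (λ v → cube (X v)) vs
    S³ΣC>0 : 0 < S³ * ΣC
    S³ΣC>0 = *-mono-< {0} {S³} {0} {ΣC} (s≤s z≤n) pos
    e₁ : ∀ u z → 3 * suc (u * u + 2 * u) * z ≡ 3 * suc u * (suc u * z)
    e₁ = solve-∀
    e₂ : ∀ u b n x → 3 * suc u * (2 * (b * n) * x) ≡ n * suc u * (6 * b * x)
    e₂ = solve-∀
    e₃ : ∀ n u a x → n * u * (a * x) ≡ a * n * (u * x)
    e₃ = solve-∀
    e₄ : ∀ u s c → u * (suc (suc u) * (s * (3 * c))) ≡ 3 * (u * u + 2 * u) * (s * c)
    e₄ = solve-∀
    vertices : suc u * ΣX³ ≤ suc (suc u) * (S³ * ΣY)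
    vertices = begin
      suc u * ΣX³                                     ≡⟨ sumOver-* (suc u) (λ v → cube (X v)) vs ⟨
      sumOver (λ v → suc u * cube (X v)) vs           ≤⟨ sumOver-mono-≤ (λ v → approximate-cubeRoot u (Y v) (X v) (proj₂ (cubeRoot (S³ * Y v)))) vs ⟩
      sumOver (λ v → suc (suc u) * (S³ * Y v)) vs     ≡⟨ sumOver-* (suc (suc u)) (λ v → S³ * Y v) vs ⟩
      suc (suc u) * sumOver (λ v → S³ * Y v) vs       ≡⟨ cong (suc (suc u) *_) (sumOver-* S³ Y vs) ⟩
      suc (suc u) * (S³ * ΣY) ∎
    e₅ : ∀ u s c → u * (s * s * s * c) * (u * (s * s * s * c)) * (u * (s * s * s * c))
                   ≡ u * u * u * (s * s * s * (s * s * s) * (s * s * s)) * (c * c * c)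
    e₅ = solve-∀
    e₆ : ∀ w s c → 32 * (w * w * w) * (s * s * s) * (c * c * c) ≡ 8 * (w * w * w) * (s * s * s * (4 * (c * c * c)))
    e₆ = solve-∀
    e₇ : ∀ s x y z → s * s * s * (x * y * z) ≡ s * x * (s * y) * (s * z)
    e₇ = solve-∀
    e₈ : ∀ w x y z → 8 * (w * w * w) * (x * x * x * (y * y * y) * (z * z * z))
                     ≡ 2 * w * (x * y * z) * (2 * w * (x * y * z)) * (2 * w * (x * y * z))
    e₈ = solve-∀
    lo : ∀ v → S³ * Y v ≤ cube (X v)
    lo v = proj₁ (proj₂ (cubeRoot (S³ * Y v)))
    -- After cubing, the constant splits as 32 = 8 * 4: the 4 is covered by the edge condition on
    -- `C`, and the 8 comes out as the factor 2.
    edge-bound : ∀ i → suc u * (S³ * C i) ≤ 2 * (b * N) * monomial X i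
    edge-bound i = cube-cancel-≤ (begin
      cube (suc u * (S³ * C i))                        ≡⟨ e₅ (suc u) (suc (7 * suc u)) (C i) ⟩
      cube (suc u) * cube S³ * cube (C i)              ≤⟨ *-monoˡ-≤ (cube (C i)) (*-monoˡ-≤ (cube S³) (rational-gap a b a<b)) ⟩
      32 * cube (b * N) * cube S³ * cube (C i)         ≡⟨ e₆ (b * N) S³ (C i) ⟩
      8 * cube (b * N) * (cube S³ * (4 * cube (C i)))  ≤⟨ *-monoʳ-≤ (8 * cube (b * N)) (*-monoʳ-≤ (cube S³) (edge i)) ⟩
      8 * cube (b * N) * (cube S³ * monomial Y i)      ≡⟨ cong (8 * cube (b * N) *_) (e₇ S³ (Y (p i)) (Y (q i)) (Y (r i))) ⟩
      8 * cube (b * N) * (S³ * Y (p i) * (S³ * Y (q i)) * (S³ * Y (r i)))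
        ≤⟨ *-monoʳ-≤ (8 * cube (b * N)) (*-mono-≤ (*-mono-≤ (lo (p i)) (lo (q i))) (lo (r i))) ⟩
      8 * cube (b * N) * (cube (X (p i)) * cube (X (q i)) * cube (X (r i)))
        ≡⟨ e₈ (b * N) (X (p i)) (X (q i)) (X (r i)) ⟩
      cube (2 * (b * N) * monomial X i) ∎)
    edges : suc u * (S³ * ΣC) ≤ 2 * (b * N) * ΣX
    edges = begin
      suc u * (S³ * ΣC)                       ≡⟨ cong (suc u *_) (sumOver-* S³ C is) ⟨
      suc u * sumOver (λ i → S³ * C i) is     ≡⟨ sumOver-* (suc u) (λ i → S³ * C i) is ⟨
      sumOver (λ i → suc u * (S³ * C i)) is   ≤⟨ sumOver-mono-≤ edge-bound is ⟩
      sumOver (λ i → 2 * (b * N) * monomial X i) is ≡⟨ sumOver-* (2 * (b * N)) (monomial X) is ⟩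
      2 * (b * N) * ΣX ∎

-- From the rational bound on the spectral radius to natural numbers.

ι : ℕ → ℚ
ι k = ℤ.+ k ℚ./ 1

toℚᵘ-ι : ∀ k → toℚᵘ (ι k) ℚᵘ.≃ mkℚᵘ (ℤ.+ k) 0
toℚᵘ-ι k = ℚ.toℚᵘ-fromℚᵘ (mkℚᵘ (ℤ.+ k) 0)

ι-+ : ∀ j k → ι (j + k) ≡ ι j ℚ.+ ι k
ι-+ j k = ℚ.toℚᵘ-injective (begin
  toℚᵘ (ι (j + k))                  ≈⟨ toℚᵘ-ι (j + k) ⟩
  mkℚᵘ (ℤ.+ (j + k)) 0                ≈⟨ *≡* (cong (ℤ._* ℤ.+ 1) (sym (cong₂ ℤ._+_ (ℤ.*-identityʳ (ℤ.+ j)) (ℤ.*-identityʳ (ℤ.+ k))))) ⟩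
  mkℚᵘ (ℤ.+ j) 0 ℚᵘ.+ mkℚᵘ (ℤ.+ k) 0    ≈⟨ ℚᵘ.+-cong (toℚᵘ-ι j) (toℚᵘ-ι k) ⟨
  toℚᵘ (ι j) ℚᵘ.+ toℚᵘ (ι k)        ≈⟨ ℚ.toℚᵘ-homo-+ (ι j) (ι k) ⟨
  toℚᵘ (ι j ℚ.+ ι k)                ∎)
  where open ℚᵘ.≃-Reasoning

ι-* : ∀ j k → ι (j * k) ≡ ι j ℚ.* ι k
ι-* j k = ℚ.toℚᵘ-injective (begin
  toℚᵘ (ι (j * k))                  ≈⟨ toℚᵘ-ι (j * k) ⟩
  mkℚᵘ (ℤ.+ (j * k)) 0                ≈⟨ *≡* (cong (ℤ._* ℤ.+ 1) (ℤ.pos-* j k)) ⟩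
  mkℚᵘ (ℤ.+ j) 0 ℚᵘ.* mkℚᵘ (ℤ.+ k) 0    ≈⟨ ℚᵘ.*-cong (toℚᵘ-ι j) (toℚᵘ-ι k) ⟨
  toℚᵘ (ι j) ℚᵘ.* toℚᵘ (ι k)        ≈⟨ ℚ.toℚᵘ-homo-* (ι j) (ι k) ⟨
  toℚᵘ (ι j ℚ.* ι k)                ∎)
  where open ℚᵘ.≃-Reasoning

0≤ι : ∀ k → ℚ.0ℚ ℚ.≤ ι k
0≤ι k = ℚ.nonNegative⁻¹ (ι k) {{ℚ.normalize-nonNeg k 1}}

sumℚ-ι : ∀ {A : Set} {f : A → ℚ} {g : A → ℕ} → (∀ x → f x ≡ ι (g x)) → ∀ xs → sumℚ (map f xs) ≡ ι (sumOver g xs)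
sumℚ-ι h []       = refl
sumℚ-ι {g = g} h (x ∷ xs) = trans (cong₂ ℚ._+_ (h x) (sumℚ-ι h xs)) (sym (ι-+ (g x) (sumOver g xs)))

-- A negative q forces F = 0, so its numerator can be replaced by 0; otherwise numerator and
-- denominator of q serve as they are.
numerator-bound : ∀ q → q ℚ.* q ℚ.* q ℚ.< ι 32 → ∃[ a ] ∃[ b ]
  (cube a < 32 * cube b × (∀ F S → ι F ℚ.≤ q ℚ.* ι S → F * b ≤ a * S))
numerator-bound q@(mkℚ (ℤ.-[1+ m ]) d-1 _) lt = 0 , suc d-1 , s≤s z≤n , bound
  where
  bound : ∀ F S → ι F ℚ.≤ q ℚ.* ι S → F * suc d-1 ≤ 0
  bound F S le with ℚᵘ.drop-*≤* (ℚᵘ.≤-respˡ-≃ (toℚᵘ-ι F) (ℚᵘ.≤-respʳ-≃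
    (ℚᵘ.≃-trans (ℚ.toℚᵘ-homo-* q (ι S)) (ℚᵘ.*-congˡ {toℚᵘ q} (toℚᵘ-ι S))) (ℚ.toℚᵘ-mono-≤ le)))
  ... | z = ℤ.drop‿+≤+ (begin
    ℤ.+ (F * suc d-1)                 ≡⟨ cong (λ e → ℤ.+ (F * e)) (*-identityʳ (suc d-1)) ⟨
    ℤ.+ (F * (suc d-1 * 1))           ≡⟨ ℤ.pos-* F (suc d-1 * 1) ⟩
    ℤ.+ F ℤ.* ℤ.+ (suc d-1 * 1)         ≤⟨ z ⟩
    ℤ.-[1+ m ] ℤ.* ℤ.+ S ℤ.* ℤ.+ 1        ≡⟨ ℤ.*-identityʳ (ℤ.-[1+ m ] ℤ.* ℤ.+ S) ⟩
    ℤ.-[1+ m ] ℤ.* ℤ.+ S                ≤⟨ ℤ.*-monoʳ-≤-nonNeg (ℤ.+ S) { ℤ.-[1+ m ]} {ℤ.+ 0} ℤ.-≤+ ⟩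
    ℤ.+ 0 ℤ.* ℤ.+ S                     ≡⟨ ℤ.*-zeroˡ (ℤ.+ S) ⟩
    ℤ.+ 0                             ∎)
    where open ℤ.≤-Reasoning
numerator-bound q@(mkℚ (ℤ.+ a) d-1 _) lt = a , suc d-1 , small , bound
  where
  cube-eq : toℚᵘ (q ℚ.* q ℚ.* q) ℚᵘ.≃ toℚᵘ q ℚᵘ.* toℚᵘ q ℚᵘ.* toℚᵘ q
  cube-eq = ℚᵘ.≃-trans (ℚ.toℚᵘ-homo-* (q ℚ.* q) q) (ℚᵘ.*-congʳ {toℚᵘ q} (ℚ.toℚᵘ-homo-* q q))
  small : cube a < 32 * cube (suc d-1)
  small with ℚᵘ.drop-*<* (ℚᵘ.<-respˡ-≃ cube-eq (ℚᵘ.<-respʳ-≃ (toℚᵘ-ι 32) (ℚ.toℚᵘ-mono-< lt)))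
  ... | z = ℤ.drop‿+<+ (subst₂ ℤ._<_
    (trans (ℤ.*-identityʳ _) (trans (cong (ℤ._* ℤ.+ a) (sym (ℤ.pos-* a a))) (sym (ℤ.pos-* (a * a) a))))
    (sym (ℤ.pos-* 32 (cube (suc d-1)))) z)
  bound : ∀ F S → ι F ℚ.≤ q ℚ.* ι S → F * suc d-1 ≤ a * S
  bound F S le with ℚᵘ.drop-*≤* (ℚᵘ.≤-respˡ-≃ (toℚᵘ-ι F) (ℚᵘ.≤-respʳ-≃
    (ℚᵘ.≃-trans (ℚ.toℚᵘ-homo-* q (ι S)) (ℚᵘ.*-congˡ {toℚᵘ q} (toℚᵘ-ι S))) (ℚ.toℚᵘ-mono-≤ le)))
  ... | z = ℤ.drop‿+≤+ (subst₂ ℤ._≤_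
    (trans (sym (ℤ.pos-* F (suc d-1 * 1))) (cong (λ e → ℤ.+ (F * e)) (*-identityʳ (suc d-1))))
    (trans (ℤ.*-identityʳ _) (sym (ℤ.pos-* a S))) z)

-- Weight functions given by lists of keys and values.

sumOver-+ : ∀ {A : Set} (f g : A → ℕ) xs → sumOver (λ x → f x + g x) xs ≡ sumOver f xs + sumOver g xs
sumOver-+ f g []       = refl
sumOver-+ f g (x ∷ xs) = trans (cong (λ s → f x + g x + s) (sumOver-+ f g xs)) (interchange (f x) (g x) (sumOver f xs) (sumOver g xs))
  where
  interchange : ∀ a b c d → a + b + (c + d) ≡ a + c + (b + d)
  interchange = solve-∀

sumOver-tabulate : ∀ {A : Set} {k} (f : A → ℕ) (g : Fin k → A) → sumOver f (tabulate g) ≡ sumOver (f ∘ g) (allFin k)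
sumOver-tabulate f g = cong sum (trans (map-tabulate g f) (sym (map-tabulate (λ i → i) (f ∘ g))))

sumOver-lookup : ∀ {A : Set} (f : A → ℕ) xs → sumOver f xs ≡ sumOver (f ∘ lookup xs) (allFin (length xs))
sumOver-lookup f xs = trans (cong (sumOver f) (sym (tabulate-lookup xs))) (sumOver-tabulate f (lookup xs))

δ : ∀ {k} → Fin k → ℕ → Fin k → ℕ
δ zero    y zero    = y
δ zero    y (suc v) = 0
δ (suc u) y zero    = 0
δ (suc u) y (suc v) = δ u y v

δ-≡ : ∀ {k} (u : Fin k) y → δ u y u ≡ y
δ-≡ zero    y = refl
δ-≡ (suc u) y = δ-≡ u y

δ-≢ : ∀ {k} (u v : Fin k) y → u ≢ v → δ u y v ≡ 0
δ-≢ zero    zero    y h = ⊥-elim (h refl)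
δ-≢ zero    (suc v) y h = refl
δ-≢ (suc u) zero    y h = refl
δ-≢ (suc u) (suc v) y h = δ-≢ u v y (h ∘ cong suc)

sumOver-0 : ∀ {A : Set} (xs : List A) → sumOver (λ _ → 0) xs ≡ 0
sumOver-0 []       = refl
sumOver-0 (x ∷ xs) = sumOver-0 xs

sumOver-δ : ∀ {k} (u : Fin k) y → sumOver (δ u y) (allFin k) ≡ y
sumOver-δ {suc k} zero y = trans (cong (λ s → y + s) (trans (sumOver-tabulate (δ {suc k} zero y) suc) (sumOver-0 (allFin k)))) (+-identityʳ y)
sumOver-δ {suc k} (suc u) y = trans (sumOver-tabulate (δ (suc u) y) suc) (sumOver-δ u y)

-- A key may occur several times; its entries are added up.
total : ∀ {k} → List (Fin k × ℕ) → Fin k → ℕ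
total []             v = 0
total ((u , y) ∷ xs) v = δ u y v + total xs v

sumOver-total : ∀ {k} (xs : List (Fin k × ℕ)) → sumOver (total xs) (allFin k) ≡ sumOver proj₂ xs
sumOver-total {k} []             = sumOver-0 (allFin k)
sumOver-total {k} ((u , y) ∷ xs) =
  trans (sumOver-+ (δ u y) (total xs) (allFin k)) (cong₂ _+_ (sumOver-δ u y) (sumOver-total xs))

total-≥ : ∀ {k} {v : Fin k} {y xs} → (v , y) ∈ xs → y ≤ total xs v
total-≥ {v = v} {y} {_ ∷ xs} (here refl) = subst (_≤ δ v y v + total xs v) (δ-≡ v y) (m≤m+n (δ v y v) (total xs v))
total-≥ {v = v} {y} {(u , z) ∷ xs} (there p) = ≤-trans (total-≥ p) (m≤n+m (total xs v) (δ u z v))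

total-absent : ∀ {k} {v : Fin k} {xs} → All (v ≢_) (map proj₁ xs) → total xs v ≡ 0
total-absent {xs = []} h = refl
total-absent {v = v} {xs = (u , y) ∷ xs} (p ∷ h) = cong₂ _+_ (δ-≢ u v y (p ∘ sym)) (total-absent h)

total-unique : ∀ {k} (Q : Fin k → ℕ → Set) → (∀ v → Q v 0) → ∀ {xs} → Unique (map proj₁ xs) →
               All (λ x → Q (proj₁ x) (proj₂ x)) xs → ∀ v → Q v (total xs v)
total-unique Q z {[]} un ok v = z v
total-unique Q z {(u , y) ∷ xs} (u∉ ∷ un) (q ∷ ok) v with u Fin.≟ v
... | yes refl = subst (Q u) (sym (trans (cong₂ _+_ (δ-≡ u y) (total-absent u∉)) (+-identityʳ y))) q
... | no  u≢v  = subst (Q v) (cong (_+ total xs v) (sym (δ-≢ u v y u≢v))) (total-unique Q z un ok v)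

-- Triples as sets, and certificates on a hypergraph.

swap₁₂ swap₂₃ : {A : Set} → Triple A → Triple A
swap₁₂ (a , b , c) = b , a , c
swap₂₃ (a , b , c) = a , c , b

-- Of the ways to send three entries into `e`, only the six injective ones respect distinctness, and
-- these are generated by the two adjacent transpositions.
SameSet-elim : ∀ {A : Set} (P : Triple A → Set) → (∀ {t} → P t → P (swap₁₂ t)) → (∀ {t} → P t → P (swap₂₃ t)) →
               ∀ {t e} → SameSet t e → P t → P e
SameSet-elim P s₁ s₂ ((p , _ , _) , inj₁ refl , inj₁ refl , _) _ = ⊥-elim (p refl)
SameSet-elim P s₁ s₂ ((_ , p , _) , inj₁ refl , inj₂ (inj₁ refl) , inj₁ refl) _ = ⊥-elim (p refl)
SameSet-elim P s₁ s₂ ((_ , _ , p) , inj₁ refl , inj₂ (inj₁ refl) , inj₂ (inj₁ refl)) _ = ⊥-elim (p refl)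
SameSet-elim P s₁ s₂ (_ , inj₁ refl , inj₂ (inj₁ refl) , inj₂ (inj₂ refl)) h = h
SameSet-elim P s₁ s₂ ((_ , p , _) , inj₁ refl , inj₂ (inj₂ refl) , inj₁ refl) _ = ⊥-elim (p refl)
SameSet-elim P s₁ s₂ (_ , inj₁ refl , inj₂ (inj₂ refl) , inj₂ (inj₁ refl)) h = s₂ h
SameSet-elim P s₁ s₂ ((_ , _ , p) , inj₁ refl , inj₂ (inj₂ refl) , inj₂ (inj₂ refl)) _ = ⊥-elim (p refl)
SameSet-elim P s₁ s₂ ((_ , _ , p) , inj₂ (inj₁ refl) , inj₁ refl , inj₁ refl) _ = ⊥-elim (p refl)
SameSet-elim P s₁ s₂ ((_ , p , _) , inj₂ (inj₁ refl) , inj₁ refl , inj₂ (inj₁ refl)) _ = ⊥-elim (p refl)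
SameSet-elim P s₁ s₂ (_ , inj₂ (inj₁ refl) , inj₁ refl , inj₂ (inj₂ refl)) h = s₁ h
SameSet-elim P s₁ s₂ ((p , _ , _) , inj₂ (inj₁ refl) , inj₂ (inj₁ refl) , _) _ = ⊥-elim (p refl)
SameSet-elim P s₁ s₂ (_ , inj₂ (inj₁ refl) , inj₂ (inj₂ refl) , inj₁ refl) h = s₁ (s₂ h)
SameSet-elim P s₁ s₂ ((_ , p , _) , inj₂ (inj₁ refl) , inj₂ (inj₂ refl) , inj₂ (inj₁ refl)) _ = ⊥-elim (p refl)
SameSet-elim P s₁ s₂ ((_ , _ , p) , inj₂ (inj₁ refl) , inj₂ (inj₂ refl) , inj₂ (inj₂ refl)) _ = ⊥-elim (p refl)
SameSet-elim P s₁ s₂ ((_ , _ , p) , inj₂ (inj₂ refl) , inj₁ refl , inj₁ refl) _ = ⊥-elim (p refl)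
SameSet-elim P s₁ s₂ (_ , inj₂ (inj₂ refl) , inj₁ refl , inj₂ (inj₁ refl)) h = s₂ (s₁ h)
SameSet-elim P s₁ s₂ ((_ , p , _) , inj₂ (inj₂ refl) , inj₁ refl , inj₂ (inj₂ refl)) _ = ⊥-elim (p refl)
SameSet-elim P s₁ s₂ (_ , inj₂ (inj₂ refl) , inj₂ (inj₁ refl) , inj₁ refl) h = s₁ (s₂ (s₁ h))
SameSet-elim P s₁ s₂ ((_ , _ , p) , inj₂ (inj₂ refl) , inj₂ (inj₁ refl) , inj₂ (inj₁ refl)) _ = ⊥-elim (p refl)
SameSet-elim P s₁ s₂ ((_ , p , _) , inj₂ (inj₂ refl) , inj₂ (inj₁ refl) , inj₂ (inj₂ refl)) _ = ⊥-elim (p refl)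
SameSet-elim P s₁ s₂ ((p , _ , _) , inj₂ (inj₂ refl) , inj₂ (inj₂ refl) , _) _ = ⊥-elim (p refl)

module Hyperedges (H : Hypergraph3) where

  V I : Set
  V = Fin (n H)
  I = Fin (length (E H))

  edge : I → Triple V
  edge = lookup (E H)

  Inc : I → V → V → V → Set
  Inc i a b c = SameSet (a , b , c) (edge i)

module Certificate (H : Hypergraph3) (small : SpectralRadius<ρ₃ H) where

  open Hyperedges H

  Supports : List (V × ℕ) → I → ℕ → Set
  Supports ys i c = ∃[ a ] ∃[ b ] ∃[ d ] ∃[ y₁ ] ∃[ y₂ ] ∃[ y₃ ]
    (SameSet (a , b , d) (edge i) × (a , y₁) ∈ ys × (b , y₂) ∈ ys × (d , y₃) ∈ ys × 4 * cube c ≤ y₁ * (y₂ * y₃))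

  product : (V → ℕ) → Triple V → ℕ
  product f (a , b , c) = f a * f b * f c

  product-SameSet : ∀ f {t e} → SameSet t e → product f t ≡ product f e
  product-SameSet f {t} same = SameSet-elim (λ e → product f t ≡ product f e)
    (λ { {a , b , c} h → trans h (*-swap₁₂ (f a) (f b) (f c)) })
    (λ { {a , b , c} h → trans h (*-swap₂₃ (f a) (f b) (f c)) }) same refl
    where
    *-swap₁₂ : ∀ x y z → x * y * z ≡ y * x * z
    *-swap₁₂ = solve-∀
    *-swap₂₃ : ∀ x y z → x * y * z ≡ x * z * y
    *-swap₂₃ = solve-∀

  edgeForm-ι : ∀ X → edgeForm H (ι ∘ X) ≡ ι (sumOver (λ i → product X (edge i)) (allFin (length (E H))))
  edgeForm-ι X = trans
    (sumℚ-ι {g = product X} (λ { (a , b , c) → sym (trans (ι-* (X a * X b) (X c)) (cong (ℚ._* ι (X c)) (ι-* (X a) (X b)))) }) (E H))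
    (cong ι (sumOver-lookup (product X) (E H)))

  cubeSum-ι : ∀ X → cubeSum H (ι ∘ X) ≡ ι (sumOver (λ v → cube (X v)) (allFin (n H)))
  cubeSum-ι X = sumℚ-ι (λ v → sym (trans (ι-* (X v * X v) (X v)) (cong (ℚ._* ι (X v)) (ι-* (X v) (X v))))) (allFin (n H))

  -- The two lists are treated differently when keys repeat: adding up vertex entries only raises
  -- products, whereas 4 c³ is not additive in c, so the edge keys have to be distinct.
  no-certificate : ∀ ys cs → Unique (map proj₁ cs) → All (λ x → Supports ys (proj₁ x) (proj₂ x)) cs →
                   0 < sumOver proj₂ cs → ¬ (sumOver proj₂ ys ≤ 3 * sumOver proj₂ cs)
  no-certificate ys cs un ok pos le =
    lagrangian-bound (proj₁ ∘ edge) (proj₁ ∘ proj₂ ∘ edge) (proj₂ ∘ proj₂ ∘ edge) (allFin (n H)) (allFin (length (E H)))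
      a b a<b hyp (total ys) (total cs) edges
      (subst (0 <_) (sym (sumOver-total cs)) pos)
      (subst₂ (λ s t → s ≤ 3 * t) (sym (sumOver-total ys)) (sym (sumOver-total cs)) le)
    where
    q = proj₁ small
    bound = numerator-bound q (proj₁ (proj₂ small))
    a = proj₁ bound
    b = proj₁ (proj₂ bound)
    a<b = proj₁ (proj₂ (proj₂ bound))
    cross = proj₂ (proj₂ (proj₂ bound))
    rad = proj₂ (proj₂ small)
    hyp : ∀ X → 6 * b * sumOver (λ i → product X (edge i)) (allFin (length (E H))) ≤ a * sumOver (λ v → cube (X v)) (allFin (n H))
    hyp X = subst (_≤ a * S) (shuffle F b) (cross (6 * F) S (subst₂ ℚ._≤_
      (trans (cong (ι 6 ℚ.*_) (edgeForm-ι X)) (sym (ι-* 6 F))) (cong (q ℚ.*_) (cubeSum-ι X))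
      (rad (ι ∘ X) (λ v → 0≤ι (X v)))))
      where
      F = sumOver (λ i → product X (edge i)) (allFin (length (E H)))
      S = sumOver (λ v → cube (X v)) (allFin (n H))
      shuffle : ∀ s b → 6 * s * b ≡ 6 * b * s
      shuffle = solve-∀
    edges : ∀ i → 4 * cube (total cs i) ≤ product (total ys) (edge i)
    edges = total-unique (λ i c → 4 * cube c ≤ product (total ys) (edge i)) (λ _ → z≤n) un
      (All.map (λ { {i , c} (u , v , w , y₁ , y₂ , y₃ , same , m₁ , m₂ , m₃ , h) →
        subst (4 * cube c ≤_) (product-SameSet (total ys) same)
          (≤-trans h (subst (_≤ total ys u * total ys v * total ys w) (*-assoc y₁ y₂ y₃)
            (*-mono-≤ (*-mono-≤ (total-≥ m₁) (total-≥ m₂)) (total-≥ m₃)))) }) ok)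

-- Rooted hypertrees and the calculus of shares.

sumOver-++ : ∀ {A : Set} (f : A → ℕ) xs ys → sumOver f (xs ++ ys) ≡ sumOver f xs + sumOver f ys
sumOver-++ f []       ys = refl
sumOver-++ f (x ∷ xs) ys = trans (cong (f x +_) (sumOver-++ f xs ys)) (sym (+-assoc (f x) _ _))

0<* : ∀ {x y} → 0 < x → 0 < y → 0 < x * y
0<* {suc x} {suc y} _ _ = s≤s z≤n

module Trees (H : Hypergraph3) where

  open Hyperedges H public

  -- A hypertree rooted at v, as the list of edges at v, each carrying the
  -- hypertrees hanging at its other two vertices.
  data Arms (v : V) : Set where
    []  : Arms v
    arm : ∀ i a b → Inc i v a b → Arms a → Arms b → Arms v → Arms v

  edges : ∀ {v} → Arms v → List I
  edges []                  = []
  edges (arm i a b p X Y R) = i ∷ edges X ++ (edges Y ++ edges R)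

  -- Val y t s c: vertex weights (y at the root, s in total elsewhere) and edge
  -- weights (c in total) with 4 cₑ³ ≤ the product of the weights along e.
  data Val : ∀ {v} → ℕ → Arms v → ℕ → ℕ → Set where
    []  : ∀ {v y} → Val {v} y [] 0 0
    arm : ∀ {v y i a b p X Y R s₁ s₂ s₃ t₁ t₂ t₃} c y₁ y₂ → 4 * cube c ≤ y * (y₁ * y₂) →
          Val y₁ X s₁ t₁ → Val y₂ Y s₂ t₂ → Val y R s₃ t₃ →
          Val {v} y (arm i a b p X Y R) (y₁ + s₁ + (y₂ + s₂ + s₃)) (c + (t₁ + (t₂ + t₃)))

  entries : ∀ {v y t s c} → Val {v} y t s c → List (V × ℕ)
  entries [] = []
  entries (arm {a = a} {b} c y₁ y₂ _ X Y R) = ((a , y₁) ∷ entries X) ++ (((b , y₂) ∷ entries Y) ++ entries R)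

  charges : ∀ {v y t s c} → Val {v} y t s c → List (I × ℕ)
  charges [] = []
  charges (arm {i = i} c _ _ _ X Y R) = (i , c) ∷ charges X ++ (charges Y ++ charges R)

  entries-total : ∀ {v y t s c} (x : Val {v} y t s c) → sumOver proj₂ (entries x) ≡ s
  entries-total [] = refl
  entries-total (arm {a = a} {b} c y₁ y₂ _ X Y R) =
    trans (sumOver-++ proj₂ ((a , y₁) ∷ entries X) _)
      (cong₂ _+_ (cong (y₁ +_) (entries-total X))
        (trans (sumOver-++ proj₂ ((b , y₂) ∷ entries Y) _) (cong₂ _+_ (cong (y₂ +_) (entries-total Y)) (entries-total R))))

  charges-total : ∀ {v y t s c} (x : Val {v} y t s c) → sumOver proj₂ (charges x) ≡ c
  charges-total [] = refl
  charges-total (arm c y₁ y₂ _ X Y R) =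
    cong (c +_) (trans (sumOver-++ proj₂ (charges X) _)
      (cong₂ _+_ (charges-total X) (trans (sumOver-++ proj₂ (charges Y) _) (cong₂ _+_ (charges-total Y) (charges-total R)))))

  charges-edges : ∀ {v y t s c} (x : Val {v} y t s c) → map proj₁ (charges x) ≡ edges t
  charges-edges [] = refl
  charges-edges (arm {i = i} c y₁ y₂ _ X Y R) =
    cong (i ∷_) (trans (map-++ proj₁ (charges X) _)
      (cong₂ _++_ (charges-edges X) (trans (map-++ proj₁ (charges Y) _) (cong₂ _++_ (charges-edges Y) (charges-edges R)))))

  -- Wt t p g: the edges of t at the root carry at least the share p / (p + g) of
  -- the root weight; share 1 makes the spectral radius at least ρ₃.
  Wt : ∀ {v} → Arms v → ℕ → ℕ → Set
  Wt t p g = ∃[ k ] (0 < k × (∀ m → ∃[ s ] ∃[ c ] (Val (k * (p + g) * m) t s c × s + k * p * m ≤ 3 * c)))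

  wt-mono : ∀ {v} {t : Arms v} {p g} p′ g′ → 0 < p + g → p′ * (p + g) ≤ p * (p′ + g′) → Wt t p g → Wt t p′ g′
  wt-mono {t = t} {p} {g} p′ g′ pos le (k , k>0 , f) = k * (p + g) , 0<* k>0 pos , λ m → go m (f ((p′ + g′) * m))
    where
    e₁ : ∀ k p m q → k * p * (q * m) ≡ k * p * q * m
    e₁ = solve-∀
    e₂ : ∀ k d q m → k * d * q * m ≡ k * m * (q * d)
    e₂ = solve-∀
    e₃ : ∀ k p q m → k * m * (p * q) ≡ k * p * (q * m)
    e₃ = solve-∀
    go : ∀ m → _ → _
    go m (s , c , x , h) = s , c , subst (λ y → Val y t s c) (e₁ k (p + g) m (p′ + g′)) x , (begin
      s + k * (p + g) * p′ * m        ≡⟨ cong (s +_) (e₂ k (p + g) p′ m) ⟩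
      s + k * m * (p′ * (p + g))      ≤⟨ +-monoʳ-≤ s (*-monoʳ-≤ (k * m) le) ⟩
      s + k * m * (p * (p′ + g′))     ≡⟨ cong (s +_) (e₃ k p (p′ + g′) m) ⟩
      s + k * p * ((p′ + g′) * m)     ≤⟨ h ⟩
      3 * c                           ∎)
      where open ≤-Reasoning

  -- The factors `β` and `α` scale the certificates of X and Y so that the weight left unpaid at
  -- either far vertex is the same number `c`. Charging `c` to the new edge pays 3 c: both
  -- remainders, and `c` more at the root. The edge condition then holds with equality, and the
  -- hypothesis says that `c` covers the claimed share.
  wt-arm : ∀ {v i a b e} {X : Arms a} {Y : Arms b} {p₁ g₁ p₂ g₂} p g → 0 < g₁ → 0 < g₂ →
           p * (4 * (g₁ * g₂)) ≤ (p + g) * ((p₁ + g₁) * (p₂ + g₂)) →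
           Wt X p₁ g₁ → Wt Y p₂ g₂ → Wt {v} (arm i a b e X Y []) p g
  wt-arm {X = X} {Y} {p₁} {g₁} {p₂} {g₂} p g g₁>0 g₂>0 le (k₁ , k₁>0 , f₁) (k₂ , k₂>0 , f₂) =
    4 * (α * β * (g₁ * g₂)) , 0<* {4} (s≤s z≤n) (0<* (0<* (0<* k₁>0 g₁>0) (0<* k₂>0 g₂>0)) (0<* g₁>0 g₂>0)) , λ m →
      go m (f₁ (β * Δ m)) (f₂ (α * Δ m))
    where
    α = k₁ * g₁
    β = k₂ * g₂
    d₁ = p₁ + g₁
    d₂ = p₂ + g₂
    Δ : ℕ → ℕ
    Δ m = d₁ * d₂ * ((p + g) * m)
    e₁ : ∀ k₁ k₂ g₁ g₂ d₁ d₂ d m →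
      4 * (k₁ * g₁ * (k₂ * g₂) * (d₁ * d₂ * (d * m)) * (k₁ * g₁ * (k₂ * g₂) * (d₁ * d₂ * (d * m))) * (k₁ * g₁ * (k₂ * g₂) * (d₁ * d₂ * (d * m)))) ≡
      4 * (k₁ * g₁ * (k₂ * g₂) * (g₁ * g₂)) * d * m * (k₁ * d₁ * (k₂ * g₂ * (d₁ * d₂ * (d * m))) * (k₂ * d₂ * (k₁ * g₁ * (d₁ * d₂ * (d * m)))))
    e₁ = solve-∀
    e₂ : ∀ x g₁g₂ p m → 4 * (x * g₁g₂) * p * m ≡ x * m * (p * (4 * g₁g₂))
    e₂ = solve-∀
    e₃ : ∀ x d d₁₂ m → x * m * (d * d₁₂) ≡ x * (d₁₂ * (d * m))
    e₃ = solve-∀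
    e₄ : ∀ k p g b Δ → k * (p + g) * (b * Δ) ≡ k * p * (b * Δ) + k * g * b * Δ
    e₄ = solve-∀
    e₅ : ∀ k p g b Δ → k * (p + g) * (b * Δ) ≡ k * p * (b * Δ) + b * (k * g) * Δ
    e₅ = solve-∀
    e₆ : ∀ y₁ s₁ y₂ s₂ c → y₁ + c + s₁ + (y₂ + c + s₂ + 0) + c ≡ s₁ + y₁ + (s₂ + y₂) + 3 * c
    e₆ = solve-∀
    e₇ : ∀ c t₁ t₂ → 3 * t₁ + 3 * t₂ + 3 * c ≡ 3 * (c + (t₁ + (t₂ + 0)))
    e₇ = solve-∀
    go : ∀ m → _ → _ → _
    go m (s₁ , t₁ , x₁ , h₁) (s₂ , t₂ , x₂ , h₂) =
      _ , _ , arm c (k₁ * d₁ * (β * Δ m)) (k₂ * d₂ * (α * Δ m)) (≤-reflexive (e₁ k₁ k₂ g₁ g₂ d₁ d₂ (p + g) m)) x₁ x₂ [] , (begin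
        k₁ * d₁ * (β * Δ m) + s₁ + (k₂ * d₂ * (α * Δ m) + s₂ + 0) + 4 * (α * β * (g₁ * g₂)) * p * m
          ≤⟨ +-monoʳ-≤ (k₁ * d₁ * (β * Δ m) + s₁ + (k₂ * d₂ * (α * Δ m) + s₂ + 0)) root ⟩
        k₁ * d₁ * (β * Δ m) + s₁ + (k₂ * d₂ * (α * Δ m) + s₂ + 0) + c
          ≡⟨ cong₂ (λ y z → y + s₁ + (z + s₂ + 0) + c) (e₄ k₁ p₁ g₁ β (Δ m)) (e₅ k₂ p₂ g₂ α (Δ m)) ⟩
        k₁ * p₁ * (β * Δ m) + c + s₁ + (k₂ * p₂ * (α * Δ m) + c + s₂ + 0) + c
          ≡⟨ e₆ (k₁ * p₁ * (β * Δ m)) s₁ (k₂ * p₂ * (α * Δ m)) s₂ c ⟩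
        s₁ + k₁ * p₁ * (β * Δ m) + (s₂ + k₂ * p₂ * (α * Δ m)) + 3 * c
          ≤⟨ +-monoˡ-≤ (3 * c) (+-mono-≤ h₁ h₂) ⟩
        3 * t₁ + 3 * t₂ + 3 * c ≡⟨ e₇ c t₁ t₂ ⟩
        3 * (c + (t₁ + (t₂ + 0))) ∎)
      where
      open ≤-Reasoning
      c = α * β * Δ m
      root : 4 * (α * β * (g₁ * g₂)) * p * m ≤ c
      root = begin
        4 * (α * β * (g₁ * g₂)) * p * m        ≡⟨ e₂ (α * β) (g₁ * g₂) p m ⟩
        α * β * m * (p * (4 * (g₁ * g₂)))      ≤⟨ *-monoʳ-≤ (α * β * m) le ⟩
        α * β * m * ((p + g) * (d₁ * d₂))      ≡⟨ e₃ (α * β) (p + g) (d₁ * d₂) m ⟩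
        α * β * Δ m                            ∎

  -- Shares at a common root add: each certificate is multiplied by the scale and denominator of the
  -- other, which gives both the same root weight, and the hypothesis is p / (p + g) ≤ w₁ + w₂ with
  -- denominators cleared.
  wt-sum : ∀ {v i a b e} {X : Arms a} {Y : Arms b} {R : Arms v} {p₁ g₁ p₂ g₂} p g → 0 < p₁ + g₁ → 0 < p₂ + g₂ →
           p * ((p₁ + g₁) * (p₂ + g₂)) ≤ (p + g) * (p₁ * (p₂ + g₂) + p₂ * (p₁ + g₁)) →
           Wt (arm i a b e X Y []) p₁ g₁ → Wt R p₂ g₂ → Wt (arm i a b e X Y R) p g
  wt-sum {i = i} {a} {b} {e} {X} {Y} {R} {p₁} {g₁} {p₂} {g₂} p g d₁>0 d₂>0 le (k₁ , k₁>0 , f₁) (k₂ , k₂>0 , f₂) =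
    k₁ * d₁ * (k₂ * d₂) , 0<* (0<* k₁>0 d₁>0) (0<* k₂>0 d₂>0) , λ m →
      go m (f₁ (k₂ * d₂ * ((p + g) * m))) (f₂ (k₁ * d₁ * ((p + g) * m)))
    where
    d₁ = p₁ + g₁
    d₂ = p₂ + g₂
    e₁ : ∀ x y d m → x * (y * (d * m)) ≡ x * y * d * m
    e₁ = solve-∀
    e₂ : ∀ x y d m → y * (x * (d * m)) ≡ x * y * d * m
    e₂ = solve-∀
    e₃ : ∀ k₁ d₁ k₂ d₂ p m → k₁ * d₁ * (k₂ * d₂) * p * m ≡ k₁ * k₂ * m * (p * (d₁ * d₂))
    e₃ = solve-∀
    e₄ : ∀ k₁ d₁ k₂ d₂ p₁ p₂ d m → k₁ * k₂ * m * (d * (p₁ * d₂ + p₂ * d₁))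
         ≡ k₁ * p₁ * (k₂ * d₂ * (d * m)) + k₂ * p₂ * (k₁ * d₁ * (d * m))
    e₄ = solve-∀
    e₅ : ∀ s₁ s₂ s₃ x y → s₁ + (s₂ + s₃) + (x + y) ≡ s₁ + (s₂ + 0) + x + (s₃ + y)
    e₅ = solve-∀
    e₆ : ∀ c t₁ t₂ t₃ → 3 * (c + (t₁ + (t₂ + 0))) + 3 * t₃ ≡ 3 * (c + (t₁ + (t₂ + t₃)))
    e₆ = solve-∀
    go : ∀ m → ∃[ s ] ∃[ c ] (Val (k₁ * d₁ * (k₂ * d₂ * ((p + g) * m))) (arm i a b e X Y []) s c
                              × s + k₁ * p₁ * (k₂ * d₂ * ((p + g) * m)) ≤ 3 * c) →
         ∃[ s ] ∃[ c ] (Val (k₂ * d₂ * (k₁ * d₁ * ((p + g) * m))) R s c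
                              × s + k₂ * p₂ * (k₁ * d₁ * ((p + g) * m)) ≤ 3 * c) →
         ∃[ s ] ∃[ c ] (Val (k₁ * d₁ * (k₂ * d₂) * (p + g) * m) (arm i a b e X Y R) s c
                              × s + k₁ * d₁ * (k₂ * d₂) * p * m ≤ 3 * c)
    go m (_ , _ , arm {s₁ = s₁} {s₂} {t₁ = t₁} {t₂} c y₁ y₂ ok x₁ x₂ [] , h₁) (s₃ , t₃ , x₃ , h₂) =
      _ , _ , arm c y₁ y₂ (subst (λ y → 4 * cube c ≤ y * (y₁ * y₂)) (e₁ (k₁ * d₁) (k₂ * d₂) (p + g) m) ok) x₁ x₂
                (subst (λ y → Val y R s₃ t₃) (e₂ (k₁ * d₁) (k₂ * d₂) (p + g) m) x₃) , (begin
        y₁ + s₁ + (y₂ + s₂ + s₃) + k₁ * d₁ * (k₂ * d₂) * p * m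
          ≡⟨ cong (y₁ + s₁ + (y₂ + s₂ + s₃) +_) (e₃ k₁ d₁ k₂ d₂ p m) ⟩
        y₁ + s₁ + (y₂ + s₂ + s₃) + k₁ * k₂ * m * (p * (d₁ * d₂))
          ≤⟨ +-monoʳ-≤ (y₁ + s₁ + (y₂ + s₂ + s₃)) (*-monoʳ-≤ (k₁ * k₂ * m) le) ⟩
        y₁ + s₁ + (y₂ + s₂ + s₃) + k₁ * k₂ * m * ((p + g) * (p₁ * d₂ + p₂ * d₁))
          ≡⟨ cong (y₁ + s₁ + (y₂ + s₂ + s₃) +_) (e₄ k₁ d₁ k₂ d₂ p₁ p₂ (p + g) m) ⟩
        y₁ + s₁ + (y₂ + s₂ + s₃) + (z₁ + z₂)
          ≡⟨ e₅ (y₁ + s₁) (y₂ + s₂) s₃ z₁ z₂ ⟩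
        y₁ + s₁ + (y₂ + s₂ + 0) + z₁ + (s₃ + z₂)
          ≤⟨ +-mono-≤ h₁ h₂ ⟩
        3 * (c + (t₁ + (t₂ + 0))) + 3 * t₃ ≡⟨ e₆ c t₁ t₂ t₃ ⟩
        3 * (c + (t₁ + (t₂ + t₃))) ∎)
      where
      open ≤-Reasoning
      z₁ = k₁ * p₁ * (k₂ * d₂ * ((p + g) * m))
      z₂ = k₂ * p₂ * (k₁ * d₁ * ((p + g) * m))

  -- With g = 0 the share is 1, so the root weight would be paid in full. This is the form in which
  -- ρ(H) < ρ₃ enters the case analysis.
  Light : ∀ {v} → Arms v → Set
  Light t = ∀ {p} → 0 < p → ¬ Wt t p 0

  module _ (small : SpectralRadius<ρ₃ H) where

    open Certificate H small using (Supports; no-certificate)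

    supports : ∀ {v y t s c ys} (x : Val {v} y t s c) → (v , y) ∈ ys → (∀ {z} → z ∈ entries x → z ∈ ys) →
               All (λ z → Supports ys (proj₁ z) (proj₂ z)) (charges x)
    supports [] root sub = []
    supports {v} {y} (arm {a = a} {b} {p} c y₁ y₂ ok X Y R) root sub =
      (v , a , b , y , y₁ , y₂ , p , root , sub (here refl) , sub b∈ , ok)
      ∷ All.++⁺ (supports X (sub (here refl)) (sub ∘ there ∘ ∈-++⁺ˡ))
          (All.++⁺ (supports Y (sub b∈) (sub ∘ ∈-++⁺ʳ ((a , y₁) ∷ entries X) ∘ there ∘ ∈-++⁺ˡ))
                   (supports R root (sub ∘ ∈-++⁺ʳ ((a , y₁) ∷ entries X) ∘ ∈-++⁺ʳ ((b , y₂) ∷ entries Y))))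
      where
      b∈ = ∈-++⁺ʳ ((a , y₁) ∷ entries X) (here refl)

    unique-light : ∀ {v} {t : Arms v} → Unique (edges t) → Light t
    unique-light {v} {t} un {p} p>0 (k , k>0 , f) with f 1
    ... | s , c , x , h = no-certificate ((v , y) ∷ entries x) (charges x)
        (subst Unique (sym (charges-edges x)) un)
        (supports x (here refl) there)
        (subst (0 <_) (sym (charges-total x)) c>0)
        (subst₂ (λ l r → y + l ≤ 3 * r) (sym (entries-total x)) (sym (charges-total x))
          (subst (_≤ 3 * c) (e k p s) h))
      where
      y = k * (p + 0) * 1
      e : ∀ k p s → s + k * p * 1 ≡ k * (p + 0) * 1 + s
      e = solve-∀
      c>0 : 0 < c
      c>0 = *-cancelˡ-< 3 0 c (<-≤-trans (0<* (0<* k>0 p>0) (s≤s z≤n)) (≤-trans (m≤n+m (k * p * 1) s) h))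

-- Completing edges, and lists without repetition.

SameSet-∈ : ∀ {A : Set} {t e : Triple A} {x} → SameSet t e → x ∈₃ e → x ∈₃ t
SameSet-∈ {t = t} {x = x} same = SameSet-elim (λ e → x ∈₃ e → x ∈₃ t)
  (λ { h (inj₁ p) → h (inj₂ (inj₁ p)) ; h (inj₂ (inj₁ p)) → h (inj₁ p) ; h (inj₂ (inj₂ p)) → h (inj₂ (inj₂ p)) })
  (λ { h (inj₁ p) → h (inj₁ p) ; h (inj₂ (inj₁ p)) → h (inj₂ (inj₂ p)) ; h (inj₂ (inj₂ p)) → h (inj₂ (inj₁ p)) })
  same (λ p → p)

SameSet-swap₁₂ : ∀ {A : Set} {t e : Triple A} → SameSet t e → SameSet (swap₁₂ t) e
SameSet-swap₁₂ ((p , q , r) , a , b , c) = (p ∘ sym , r , q) , b , a , c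

SameSet-swap₂₃ : ∀ {A : Set} {t e : Triple A} → SameSet t e → SameSet (swap₂₃ t) e
SameSet-swap₂₃ ((p , q , r) , a , b , c) = (q , p , r ∘ sym) , a , c , b

complete : ∀ {A : Set} {e : Triple A} {x} → Distinct₃ e → x ∈₃ e → ∃[ y ] ∃[ z ] SameSet (x , y , z) e
complete {e = x , y , z} d (inj₁ refl) = y , z , d , inj₁ refl , inj₂ (inj₁ refl) , inj₂ (inj₂ refl)
complete {e = x , y , z} (p , q , r) (inj₂ (inj₁ refl)) = x , z , (p ∘ sym , r , q) , inj₂ (inj₁ refl) , inj₁ refl , inj₂ (inj₂ refl)
complete {e = x , y , z} (p , q , r) (inj₂ (inj₂ refl)) = x , y , (q ∘ sym , r ∘ sym , p) , inj₂ (inj₂ refl) , inj₁ refl , inj₂ (inj₁ refl)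

complete₂ : ∀ {A : Set} {e : Triple A} {x y} → Distinct₃ e → x ∈₃ e → y ∈₃ e → x ≢ y → ∃[ z ] SameSet (x , y , z) e
complete₂ d p q x≢y with complete d p
... | a , b , same with SameSet-∈ same q
...   | inj₁ refl        = ⊥-elim (x≢y refl)
...   | inj₂ (inj₁ refl) = b , same
...   | inj₂ (inj₂ refl) = a , SameSet-swap₂₃ same

Unique-disjoint : ∀ {A : Set} {x : A} {xs ys} → Unique (xs ++ ys) → x ∈ xs → x ∉ ys
Unique-disjoint {xs = z ∷ xs} (z∉ ∷ un) (here refl) q = All.lookup z∉ (∈-++⁺ʳ xs q) refl
Unique-disjoint {xs = z ∷ xs} (z∉ ∷ un) (there p) q = Unique-disjoint un p q

extract : ∀ {A : Set} {x : A} {xs} → x ∈ xs → ∃[ ys ] (xs ↭ x ∷ ys)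
extract {xs = x ∷ xs} (here refl) = xs , ↭-refl
extract {x = x} {xs = y ∷ xs} (there p) with extract p
... | ys , h = y ∷ ys , ↭-trans (prep y h) (swap y x ↭-refl)

Unique-resp-↭ : ∀ {A : Set} {xs ys : List A} → xs ↭ ys → Unique xs → Unique ys
Unique-resp-↭ {A} h = Permutation.Unique-resp-↭ (setoid A) (↭⇒↭ₛ h)

-- Moving the root of a hypertree.

module Rerooting (H : Hypergraph3) where

  open Trees H public

  verts : ∀ {v} → Arms v → List V
  verts []                  = []
  verts (arm i a b p X Y R) = (a ∷ verts X) ++ ((b ∷ verts Y) ++ verts R)

  size : ∀ {v} → Arms v → ℕ
  size t = length (edges t)

  infixr 5 _⊕_
  _⊕_ : ∀ {v} → Arms v → Arms v → Arms v
  []                ⊕ u = u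
  arm i a b p X Y R ⊕ u = arm i a b p X Y (R ⊕ u)

  module SI = CommutativeMonoidSolver (++-commutativeMonoid {A = I})
  module SV = CommutativeMonoidSolver (++-commutativeMonoid {A = V})

  edges-⊕ : ∀ {v} (t u : Arms v) → edges (t ⊕ u) ↭ edges t ++ edges u
  edges-⊕ [] u = ↭-refl
  edges-⊕ (arm i a b p X Y R) u = ↭-trans (prep i (++⁺ˡ (edges X) (++⁺ˡ (edges Y) (edges-⊕ R u))))
    (solve 5 (λ i x y r u → i :+ (x :+ (y :+ (r :+ u))) ⊜ (i :+ (x :+ (y :+ r))) :+ u) ↭-refl
      (i ∷ []) (edges X) (edges Y) (edges R) (edges u))
    where open SI renaming (_⊕_ to _:+_)

  verts-⊕ : ∀ {v} (t u : Arms v) → verts (t ⊕ u) ↭ verts t ++ verts u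
  verts-⊕ [] u = ↭-refl
  verts-⊕ (arm i a b p X Y R) u = ↭-trans (++⁺ˡ (a ∷ verts X) (++⁺ˡ (b ∷ verts Y) (verts-⊕ R u)))
    (solve 4 (λ x y r u → x :+ (y :+ (r :+ u)) ⊜ (x :+ (y :+ r)) :+ u) ↭-refl
      (a ∷ verts X) (b ∷ verts Y) (verts R) (verts u))
    where open SV renaming (_⊕_ to _:+_)

  length-verts : ∀ {v} (t : Arms v) → length (verts t) ≡ 2 * size t
  length-verts [] = refl
  length-verts (arm i a b p X Y R) =
    trans (length-++ (a ∷ verts X)) (trans (cong (suc (length (verts X)) +_) (length-++ (b ∷ verts Y)))
      (trans (cong₂ (λ x y → suc x + y) (length-verts X) (cong₂ (λ x y → suc x + y) (length-verts Y) (length-verts R)))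
        (trans (arith (size X) (size Y) (size R)) (cong (2 *_) (cong suc (sym
          (trans (length-++ (edges X)) (cong (size X +_) (length-++ (edges Y))))))))))
    where
    arith : ∀ x y r → suc (2 * x) + (suc (2 * y) + 2 * r) ≡ 2 * suc (x + (y + r))
    arith = solve-∀

  private
    Rerooted : ∀ {v} → Arms v → Arms v → V → Set
    Rerooted {v} t u w = Σ (Arms w) λ t′ → edges t′ ↭ edges t ++ edges u × w ∷ verts t′ ↭ v ∷ verts t ++ verts u

  -- Walks down t; everything met outside the current subtree is hung at its root in u.
  reroot : ∀ {v} (t u : Arms v) {w} → w ∈ verts t → Rerooted t u w
  reroot {v} (arm i a b p X Y R) u w∈ with ∈-++⁻ (a ∷ verts X) w∈
  ... | inj₁ (here refl) = arm i v b (SameSet-swap₁₂ p) (R ⊕ u) Y X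
    , ↭-trans (prep i (++⁺ʳ (edges Y ++ edges X) (edges-⊕ R u)))
        (SI.solve 5 (λ i x y r u → i SI.⊕ ((r SI.⊕ u) SI.⊕ (y SI.⊕ x)) SI.⊜ (i SI.⊕ (x SI.⊕ (y SI.⊕ r))) SI.⊕ u) ↭-refl
          (i ∷ []) (edges X) (edges Y) (edges R) (edges u))
    , ↭-trans (prep a (prep v (++⁺ʳ ((b ∷ verts Y) ++ verts X) (verts-⊕ R u))))
        (SV.solve 7 (λ v a b x y r u → a SV.⊕ (v SV.⊕ ((r SV.⊕ u) SV.⊕ ((b SV.⊕ y) SV.⊕ x))) SV.⊜ v SV.⊕ (((a SV.⊕ x) SV.⊕ ((b SV.⊕ y) SV.⊕ r)) SV.⊕ u)) ↭-refl
          (v ∷ []) (a ∷ []) (b ∷ []) (verts X) (verts Y) (verts R) (verts u))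
  ... | inj₁ (there w∈X) with reroot X (arm i v b (SameSet-swap₁₂ p) (R ⊕ u) Y []) w∈X
  ...   | t′ , h₁ , h₂ = t′
    , ↭-trans h₁ (↭-trans (++⁺ˡ (edges X) (prep i (++⁺ʳ (edges Y ++ []) (edges-⊕ R u))))
        (SI.solve 5 (λ i x y r u → x SI.⊕ (i SI.⊕ ((r SI.⊕ u) SI.⊕ (y SI.⊕ SI.id))) SI.⊜ (i SI.⊕ (x SI.⊕ (y SI.⊕ r))) SI.⊕ u) ↭-refl
          (i ∷ []) (edges X) (edges Y) (edges R) (edges u)))
    , ↭-trans h₂ (↭-trans (prep a (++⁺ˡ (verts X) (prep v (++⁺ʳ ((b ∷ verts Y) ++ []) (verts-⊕ R u)))))
        (SV.solve 7 (λ v a b x y r u → a SV.⊕ (x SV.⊕ (v SV.⊕ ((r SV.⊕ u) SV.⊕ ((b SV.⊕ y) SV.⊕ SV.id)))) SV.⊜ v SV.⊕ (((a SV.⊕ x) SV.⊕ ((b SV.⊕ y) SV.⊕ r)) SV.⊕ u)) ↭-refl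
          (v ∷ []) (a ∷ []) (b ∷ []) (verts X) (verts Y) (verts R) (verts u)))
  reroot {v} (arm i a b p X Y R) u w∈ | inj₂ w∈YR with ∈-++⁻ (b ∷ verts Y) w∈YR
  ... | inj₁ (here refl) = arm i v a (SameSet-swap₁₂ (SameSet-swap₂₃ p)) (R ⊕ u) X Y
    , ↭-trans (prep i (++⁺ʳ (edges X ++ edges Y) (edges-⊕ R u)))
        (SI.solve 5 (λ i x y r u → i SI.⊕ ((r SI.⊕ u) SI.⊕ (x SI.⊕ y)) SI.⊜ (i SI.⊕ (x SI.⊕ (y SI.⊕ r))) SI.⊕ u) ↭-refl
          (i ∷ []) (edges X) (edges Y) (edges R) (edges u))
    , ↭-trans (prep b (prep v (++⁺ʳ ((a ∷ verts X) ++ verts Y) (verts-⊕ R u))))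
        (SV.solve 7 (λ v a b x y r u → b SV.⊕ (v SV.⊕ ((r SV.⊕ u) SV.⊕ ((a SV.⊕ x) SV.⊕ y))) SV.⊜ v SV.⊕ (((a SV.⊕ x) SV.⊕ ((b SV.⊕ y) SV.⊕ r)) SV.⊕ u)) ↭-refl
          (v ∷ []) (a ∷ []) (b ∷ []) (verts X) (verts Y) (verts R) (verts u))
  ... | inj₁ (there w∈Y) with reroot Y (arm i v a (SameSet-swap₁₂ (SameSet-swap₂₃ p)) (R ⊕ u) X []) w∈Y
  ...   | t′ , h₁ , h₂ = t′
    , ↭-trans h₁ (↭-trans (++⁺ˡ (edges Y) (prep i (++⁺ʳ (edges X ++ []) (edges-⊕ R u))))
        (SI.solve 5 (λ i x y r u → y SI.⊕ (i SI.⊕ ((r SI.⊕ u) SI.⊕ (x SI.⊕ SI.id))) SI.⊜ (i SI.⊕ (x SI.⊕ (y SI.⊕ r))) SI.⊕ u) ↭-refl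
          (i ∷ []) (edges X) (edges Y) (edges R) (edges u)))
    , ↭-trans h₂ (↭-trans (prep b (++⁺ˡ (verts Y) (prep v (++⁺ʳ ((a ∷ verts X) ++ []) (verts-⊕ R u)))))
        (SV.solve 7 (λ v a b x y r u → b SV.⊕ (y SV.⊕ (v SV.⊕ ((r SV.⊕ u) SV.⊕ ((a SV.⊕ x) SV.⊕ SV.id)))) SV.⊜ v SV.⊕ (((a SV.⊕ x) SV.⊕ ((b SV.⊕ y) SV.⊕ r)) SV.⊕ u)) ↭-refl
          (v ∷ []) (a ∷ []) (b ∷ []) (verts X) (verts Y) (verts R) (verts u)))
  reroot {v} (arm i a b p X Y R) u w∈ | inj₂ w∈YR | inj₂ w∈R with reroot R (arm i a b p X Y u) w∈R
  ... | t′ , h₁ , h₂ = t′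
    , ↭-trans h₁
        (SI.solve 5 (λ i x y r u → r SI.⊕ (i SI.⊕ (x SI.⊕ (y SI.⊕ u))) SI.⊜ (i SI.⊕ (x SI.⊕ (y SI.⊕ r))) SI.⊕ u) ↭-refl
          (i ∷ []) (edges X) (edges Y) (edges R) (edges u))
    , ↭-trans h₂
        (SV.solve 5 (λ v x y r u → v SV.⊕ (r SV.⊕ (x SV.⊕ (y SV.⊕ u))) SV.⊜ v SV.⊕ ((x SV.⊕ (y SV.⊕ r)) SV.⊕ u)) ↭-refl
          (v ∷ []) (a ∷ verts X) (b ∷ verts Y) (verts R) (verts u))

  rerootAt : ∀ {v} (t : Arms v) {w} → w ∈ v ∷ verts t →
             Σ (Arms w) λ t′ → edges t′ ↭ edges t × w ∷ verts t′ ↭ v ∷ verts t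
  rerootAt t (here refl) = t , ↭-refl , ↭-refl
  rerootAt {v} t (there w∈) with reroot t [] w∈
  ... | t′ , h₁ , h₂ = t′ , subst (edges t′ ↭_) (++-identityʳ (edges t)) h₁ ,
                       subst (λ xs → _ ∷ verts t′ ↭ v ∷ xs) (++-identityʳ (verts t)) h₂

  edge-verts : ∀ {v} (t : Arms v) {i x} → i ∈ edges t → x ∈₃ edge i → x ∈ v ∷ verts t
  edge-verts (arm i a b p X Y R) (here refl) x∈ with SameSet-∈ p x∈
  ... | inj₁ refl        = here refl
  ... | inj₂ (inj₁ refl) = there (here refl)
  ... | inj₂ (inj₂ refl) = there (∈-++⁺ʳ (a ∷ verts X) (here refl))
  edge-verts (arm i a b p X Y R) (there i∈) x∈ with ∈-++⁻ (edges X) i∈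
  ... | inj₁ i∈X = there (∈-++⁺ˡ (edge-verts X i∈X x∈))
  ... | inj₂ i∈YR with ∈-++⁻ (edges Y) i∈YR
  ...   | inj₁ i∈Y = there (∈-++⁺ʳ (a ∷ verts X) (∈-++⁺ˡ (edge-verts Y i∈Y x∈)))
  ...   | inj₂ i∈R with edge-verts R i∈R x∈
  ...     | here refl = here refl
  ...     | there x∈R = there (∈-++⁺ʳ (a ∷ verts X) (∈-++⁺ʳ (b ∷ verts Y) x∈R))

-- Absence of cycles and the spanning hypertree.

some-entry : ∀ {A : Set} (es : List (Triple A)) → es ≢ [] → A
some-entry []             h = ⊥-elim (h refl)
some-entry ((a , _) ∷ es) h = a

module Spanning (H : Hypergraph3) (small : SpectralRadius<ρ₃ H) where

  open Rerooting H public
  open Certificate H small using (no-certificate)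
  open DecMembership (Fin._≟_ {length (E H)}) using (_∈?_)

  edge-distinct : ∀ i → Distinct₃ (edge i)
  edge-distinct i = All.lookup (distinct H) (∈-lookup i)

  -- An edge of charge 0 asks for no weight, so a certificate may be confined to part of a tree.
  zero-val : ∀ {v y} (t : Arms v) → Val y t 0 0
  zero-val []                  = []
  zero-val (arm i a b p X Y R) = arm 0 0 0 z≤n (zero-val X) (zero-val Y) (zero-val R)

  -- Weight 2 on the joints and 1 on the other vertices of the path from the root to u.
  path-val : ∀ {v} (t : Arms v) {u} → u ∈ verts t →
             ∃[ c ] Σ (Val 2 t (3 * c) c) λ x → (u , 2) ∈ entries x
  path-val (arm i a b p X Y R) {u} u∈ with ∈-++⁻ (a ∷ verts X) u∈
  ... | inj₁ (here refl) = 1 , arm 1 2 1 ≤-refl (zero-val X) (zero-val Y) (zero-val R) , here refl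
  ... | inj₁ (there u∈X) with path-val X u∈X
  ...   | c , x , m = suc c , subst₂ (λ s c → Σ (Val 2 (arm i a b p X Y R) s c) λ x → (u , 2) ∈ entries x) (e₁ c) (e₂ c)
          (arm 1 2 1 ≤-refl x (zero-val Y) (zero-val R) , there (∈-++⁺ˡ m))
    where
    e₁ : ∀ c → 2 + 3 * c + (1 + 0 + 0) ≡ 3 * suc c
    e₁ = solve-∀
    e₂ : ∀ c → 1 + (c + (0 + 0)) ≡ suc c
    e₂ = solve-∀
  path-val (arm i a b p X Y R) {u} u∈ | inj₂ u∈YR with ∈-++⁻ (b ∷ verts Y) u∈YR
  ... | inj₁ (here refl) = 1 , arm 1 1 2 ≤-refl (zero-val X) (zero-val Y) (zero-val R) ,
                           ∈-++⁺ʳ ((a , 1) ∷ entries (zero-val X)) (here refl)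
  ... | inj₁ (there u∈Y) with path-val Y u∈Y
  ...   | c , x , m = suc c , subst₂ (λ s c → Σ (Val 2 (arm i a b p X Y R) s c) λ x → (u , 2) ∈ entries x) (e₁ c) (e₂ c)
          (arm 1 1 2 ≤-refl (zero-val X) x (zero-val R) , ∈-++⁺ʳ ((a , 1) ∷ entries (zero-val X)) (there (∈-++⁺ˡ m)))
    where
    e₁ : ∀ c → 1 + 0 + (2 + 3 * c + 0) ≡ 3 * suc c
    e₁ = solve-∀
    e₂ : ∀ c → 1 + (0 + (c + 0)) ≡ suc c
    e₂ = solve-∀
  path-val (arm i a b p X Y R) u∈ | inj₂ u∈YR | inj₂ u∈R with path-val R u∈R
  ... | c , x , m = c , arm 0 0 0 z≤n (zero-val X) (zero-val Y) x ,
                    ∈-++⁺ʳ ((a , 0) ∷ entries (zero-val X)) (∈-++⁺ʳ ((b , 0) ∷ entries (zero-val Y)) m)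

  -- The edge `i` would close the path from the root to `u`. Each path edge accounts for a joint of
  -- weight 2 and a middle vertex of weight 1; the root with 2 and `z` with 1 match the charge of
  -- `i`, so the budget 3 (c + 1) is met exactly. Two edges with two common vertices are the cycle
  -- of length 2.
  no-cycle-at-root : ∀ {v} (t : Arms v) {i u z} → Unique (edges t) → i ∉ edges t → Inc i v u z → u ∉ verts t
  no-cycle-at-root {v} t {i} {u} {z} un i∉ p u∈ with path-val t u∈
  ... | c , x , m = no-certificate ((v , 2) ∷ (z , 1) ∷ entries x) ((i , 1) ∷ charges x)
    (subst Unique (cong (i ∷_) (sym (charges-edges x))) (All.¬Any⇒All¬ (edges t) i∉ ∷ un))
    ((v , u , z , 2 , 2 , 1 , p , here refl , there (there m) , there (here refl) , ≤-refl)
      ∷ supports small x (here refl) (there ∘ there))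
    (s≤s z≤n)
    (≤-reflexive (trans (cong (3 +_) (entries-total x)) (trans (e c) (cong (λ s → 3 * suc s) (sym (charges-total x))))))
    where
    e : ∀ c → 3 + 3 * c ≡ 3 * suc c
    e = solve-∀

  no-cycle : ∀ {v} (t : Arms v) {i u w} → Unique (edges t) → i ∉ edges t → u ≢ w → u ∈₃ edge i → w ∈₃ edge i →
             u ∈ v ∷ verts t → w ∉ v ∷ verts t
  no-cycle t {i} un i∉ u≢w u∈i w∈i u∈ w∈ with rerootAt t u∈ | complete₂ (edge-distinct i) u∈i w∈i u≢w
  ... | t′ , h₁ , h₂ | z , p with ∈-resp-↭ (↭-sym h₂) w∈
  ...   | here refl = u≢w refl
  ...   | there w∈′ = no-cycle-at-root t′ (Unique-resp-↭ (↭-sym h₁) un) (i∉ ∘ ∈-resp-↭ h₁) p w∈′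

  -- Distinctness of the tree's vertices is recorded through the count alone; `labelling-≅` later
  -- recovers a bijection from it.
  Spans : ∀ {v} → Arms v → Set
  Spans t = Unique (edges t) × (∀ i → i ∈ edges t) × n H ≡ 1 + 2 * size t

  Spans-resp-↭ : ∀ {v w} {t : Arms v} {t′ : Arms w} → edges t ↭ edges t′ → Spans t → Spans t′
  Spans-resp-↭ h (un , cov , len) = Unique-resp-↭ h un , (λ i → ∈-resp-↭ h (cov i)) ,
                                    trans len (cong (λ k → 1 + 2 * k) (↭-length h))

  private
    crossing : ∀ {v x} (t : Arms v) out → v ∷ verts t ++ out ↭ allFin (n H) → Star (Adj H) v x → x ∈ out →
               ∃[ i ] ∃[ u ] ∃[ w ] (u ∈₃ edge i × w ∈₃ edge i × u ∈ v ∷ verts t × w ∈ out)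
    crossing {v} t out h walk x∈ = go walk (here refl)
      where
      disjoint : ∀ {z} → z ∈ v ∷ verts t → z ∉ out
      disjoint = Unique-disjoint (Unique-resp-↭ (↭-sym h) (allFin⁺ (n H)))
      go : ∀ {u} → Star (Adj H) u _ → u ∈ v ∷ verts t → _
      go ε u∈ = ⊥-elim (disjoint u∈ x∈)
      go {u} (_◅_ {j = w} adj walk′) u∈ with ∈-++⁻ (v ∷ verts t) (∈-resp-↭ (↭-sym h) (∈-allFin w))
      ... | inj₁ w∈ = go walk′ w∈
      ... | inj₂ w∈ = Any.index adj , u , w , proj₁ (Any.lookup-index adj) , proj₂ (Any.lookup-index adj) , u∈ , w∈

    -- The permutation keeps reached and unreached vertices apart. An edge leaving the tree meets it
    -- in one vertex, as a second would close a cycle, so rerooting there attaches it with two new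
    -- vertices. Once nothing is left outside, an edge missing from the tree would again close a
    -- cycle.
    grow : Connected H → ∀ fuel {v} (t : Arms v) out → length out ≤ fuel → Unique (edges t) →
           v ∷ verts t ++ out ↭ allFin (n H) → ∃[ w ] Σ (Arms w) Spans
    grow conn fuel {v} t [] len un h = v , t , un , covers , sizes
      where
      inside : ∀ x → x ∈ v ∷ verts t
      inside x with ∈-++⁻ (v ∷ verts t) (∈-resp-↭ (↭-sym h) (∈-allFin x))
      ... | inj₁ x∈ = x∈
      covers : ∀ i → i ∈ edges t
      covers i with i ∈? edges t
      ... | yes i∈ = i∈
      ... | no  i∉ with edge-distinct i
      ...   | x≢y , _ = ⊥-elim (no-cycle t un i∉ x≢y (inj₁ refl) (inj₂ (inj₁ refl)) (inside _) (inside _))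
      sizes : n H ≡ 1 + 2 * size t
      sizes = trans (sym (length-tabulate (λ i → i))) (trans (sym (↭-length h))
                (cong suc (trans (cong length (++-identityʳ (verts t))) (length-verts t))))
    grow conn (suc fuel) {v} t (x ∷ out) (s≤s len) un h with crossing t (x ∷ out) h (conn v x) (here refl)
    ... | i , u , w , u∈i , w∈i , u∈ , w∈ with complete₂ (edge-distinct i) u∈i w∈i u≢w
      where
      u≢w : u ≢ w
      u≢w refl = Unique-disjoint (Unique-resp-↭ (↭-sym h) (allFin⁺ (n H))) u∈ w∈
    ...   | z , p with ∈-++⁻ (v ∷ verts t) (∈-resp-↭ (↭-sym h) (∈-allFin z))
    ...     | inj₁ z∈ = ⊥-elim (no-cycle t un i∉ (proj₁ (proj₂ (proj₁ p))) u∈i (proj₂ (proj₂ (proj₂ p))) u∈ z∈)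
      where
      i∉ : i ∉ edges t
      i∉ i∈ = Unique-disjoint (Unique-resp-↭ (↭-sym h) (allFin⁺ (n H))) (edge-verts t i∈ w∈i) w∈
    ...     | inj₂ z∈ with extract w∈
    ...       | out₁ , h₁ with ∈-resp-↭ h₁ z∈
    ...         | here refl = ⊥-elim (proj₂ (proj₂ (proj₁ p)) refl)
    ...         | there z∈₁ with extract z∈₁ | rerootAt t u∈
    ...           | out₂ , h₂ | t′ , h₃ , h₄ =
      grow conn fuel (arm i w z p [] [] t′) out₂ len′
        (All.¬Any⇒All¬ (edges t′) (i∉ ∘ ∈-resp-↭ h₃) ∷ Unique-resp-↭ (↭-sym h₃) un)
        (↭-trans (SV.solve 5 (λ u w z t o → u SV.⊕ (w SV.⊕ (z SV.⊕ (t SV.⊕ o))) SV.⊜ (u SV.⊕ t) SV.⊕ (w SV.⊕ (z SV.⊕ o))) ↭-refl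
                    (u ∷ []) (w ∷ []) (z ∷ []) (verts t′) out₂)
          (↭-trans (++⁺ʳ (w ∷ z ∷ out₂) h₄)
            (↭-trans (++⁺ˡ (v ∷ verts t) (↭-sym (↭-trans h₁ (prep w h₂)))) h)))
      where
      i∉ : i ∉ edges t
      i∉ i∈ = Unique-disjoint (Unique-resp-↭ (↭-sym h) (allFin⁺ (n H))) (edge-verts t i∈ w∈i) w∈
      len′ : length out₂ ≤ fuel
      len′ = ≤-trans (n≤1+n (length out₂)) (subst (_≤ fuel) (suc-injective (↭-length (↭-trans h₁ (prep w h₂)))) len)

  spanning-tree : E H ≢ [] → Connected H → ∃[ w ] Σ (Arms w) Spans
  spanning-tree E≢[] conn with extract (∈-allFin (some-entry (E H) E≢[]))
  ... | out , h = grow conn (length out) [] out ≤-refl [] (↭-sym h)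

-- Vertex layouts and isomorphism with a presentation.

injective⇒surjective : ∀ {m k} (f : Fin m → Fin k) → (∀ {x y} → f x ≡ f y → x ≡ y) → k ≤ m → ∀ y → ∃[ x ] f x ≡ y
injective⇒surjective {m} {k} f inj k≤m y with Fin.any? (λ x → f x Fin.≟ y)
... | yes found = found
injective⇒surjective {m} {suc k} f inj k≤m y | no missed =
  ⊥-elim (<⇒≱ k≤m (Fin.injective⇒≤ {f = λ x → punchOut (λ e → missed (x , sym e))}
    (λ {x} {x′} e → inj (Fin.punchOut-injective (λ e → missed (x , sym e)) (λ e → missed (x′ , sym e)) e))))

-- A relation rather than a lookup, so that positions are plain naturals, directly comparable with
-- the labels of a presentation.
data At {A : Set} : List A → ℕ → A → Set where
  here  : ∀ {x xs} → At (x ∷ xs) 0 x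
  there : ∀ {x y xs p} → At xs p x → At (y ∷ xs) (suc p) x

at-functional : ∀ {A : Set} {xs : List A} {p x y} → At xs p x → At xs p y → x ≡ y
at-functional here      here      = refl
at-functional (there h) (there k) = at-functional h k

at-bound : ∀ {A : Set} {xs : List A} {p x} → At xs p x → p < length xs
at-bound here      = s≤s z≤n
at-bound (there h) = s≤s (at-bound h)

data Slice {A : Set} (xs : List A) : ℕ → List A → Set where
  []  : ∀ {s} → Slice xs s []
  _∷_ : ∀ {s y ys} → At xs s y → Slice xs (suc s) ys → Slice xs s (y ∷ ys)

slice-there : ∀ {A : Set} {xs : List A} {x s ys} → Slice xs s ys → Slice (x ∷ xs) (suc s) ys
slice-there []      = []
slice-there (h ∷ k) = there h ∷ slice-there k

slice-refl : ∀ {A : Set} (xs : List A) → Slice xs 0 xs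
slice-refl []       = []
slice-refl (x ∷ xs) = here ∷ slice-there (slice-refl xs)

slice-split : ∀ {A : Set} {xs : List A} {s} ys {zs} → Slice xs s (ys ++ zs) →
              Slice xs s ys × Slice xs (s + length ys) zs
slice-split {xs = xs} {s} [] {zs} h = [] , subst (λ k → Slice xs k zs) (sym (+-identityʳ s)) h
slice-split {xs = xs} {s} (y ∷ ys) {zs} (a ∷ h) with slice-split ys h
... | h₁ , h₂ = a ∷ h₁ , subst (λ k → Slice xs k zs) (sym (+-suc s (length ys))) h₂

-- With consecutive labels each edge advances by two, so the joint after `j` edges is 2 j + s. This
-- allows the last edges of a spine to be treated separately.
pendant-split : ∀ s j m → pendant s (suc s) (j + m) ≡ pendant s (suc s) j ++ pendant (2 * j + s) (suc (2 * j + s)) m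
pendant-split s zero    m = refl
pendant-split s (suc j) m = cong ((s , suc s , suc (suc s)) ∷_)
  (trans (pendant-split (suc (suc s)) j m)
    (cong (λ k → pendant (suc (suc s)) (suc (suc (suc s))) j ++ pendant k (suc k) m) (e s j)))
  where
  e : ∀ s j → 2 * j + suc (suc s) ≡ 2 * suc j + s
  e = solve-∀

module Layout (H : Hypergraph3) where

  open Rerooting H

  -- In `step i a b` the free vertex `a` precedes the next joint `b`, the order in which `pendant`
  -- numbers them.
  data Seg : V → V → ℕ → Set where
    end  : ∀ {v} → Seg v v 0
    step : ∀ {v x k} i a b → Inc i v a b → Seg b x k → Seg v x (suc k)

  segV : ∀ {v x k} → Seg v x k → List V
  segV end              = []
  segV (step i a b _ s) = a ∷ b ∷ segV s

  segE : ∀ {v x k} → Seg v x k → List I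
  segE end              = []
  segE (step i a b _ s) = i ∷ segE s

  length-segV : ∀ {v x k} (s : Seg v x k) → length (segV s) ≡ 2 * k
  length-segV end = refl
  length-segV {k = suc k} (step i a b _ s) = trans (cong (2 +_) (length-segV s)) (e k)
    where
    e : ∀ k → 2 + 2 * k ≡ 2 * suc k
    e = solve-∀

  -- Reversal with an accumulator, which also joins two paths that start at a common vertex.
  reverse-onto : ∀ {v x y j m} (s : Seg v x j) (t : Seg v y m) →
    Σ (Seg x y (j + m)) λ r → ∀ {i} → i ∈ segE s ⊎ i ∈ segE t → i ∈ segE r
  reverse-onto end t = t , λ { (inj₂ h) → h }
  reverse-onto {x = x} {y} {suc j} {m} (step i a b p s) t with reverse-onto s (step i a _ (SameSet-swap₁₂ (SameSet-swap₂₃ (SameSet-swap₁₂ p))) t)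
  ... | r , sub = subst (λ k → Σ (Seg x y k) λ r → ∀ {i′} → i′ ∈ i ∷ segE s ⊎ i′ ∈ segE t → i′ ∈ segE r) (+-suc j m)
    (r , λ { (inj₁ (here e)) → sub (inj₂ (here e)) ; (inj₁ (there h)) → sub (inj₁ h) ; (inj₂ h) → sub (inj₂ (there h)) })

  Match : List V → Triple ℕ → I → Set
  Match M (p , q , r) i = ∃[ a ] ∃[ b ] ∃[ c ] (At M p a × At M q b × At M r c × Inc i a b c)

  match-seg : ∀ {M v x k p s} (t : Seg v x k) → At M p v → Slice M s (segV t) →
              Pointwise (Match M) (pendant p s k) (segE t)
  match-seg end _ _ = []
  match-seg (step i a b e t) h (ha ∷ hb ∷ ht) = (_ , a , b , h , ha , hb , e) ∷ match-seg t hb ht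

  at-end : ∀ {M v x k s} (t : Seg v x k) → At M s v → Slice M (suc s) (segV t) → At M (2 * k + s) x
  at-end end h _ = h
  at-end {M} {x = x} {suc k} {s} (step i a b e t) h (ha ∷ hb ∷ ht) = subst (λ p → At M p x) (arith k s) (at-end t hb ht)
    where
    arith : ∀ k s → 2 * k + suc (suc s) ≡ 2 * suc k + s
    arith = solve-∀

  match-edge : ∀ {M es is i} → Pointwise (Match M) es is → i ∈ is → ∃[ e ] (e ∈ es × Match M e i)
  match-edge (h ∷ hs) (here refl) = _ , here refl , h
  match-edge (h ∷ hs) (there m) with match-edge hs m
  ... | e , e∈ , h′ = e , there e∈ , h′

  match-triple : ∀ {M es is e} → Pointwise (Match M) es is → e ∈ es → ∃[ i ] Match M e i
  match-triple (h ∷ hs) (here refl) = _ , h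
  match-triple (h ∷ hs) (there m)   = match-triple hs m

  -- A position holds only one vertex, so `f` is injective; equal cardinalities make it bijective,
  -- and then each label occurs at exactly its own position.
  labelling-≅ : ∀ (M : List V) (P : Presentation) {is} (f : V → Fin (nv P)) → (∀ v → At M (toℕ (f v)) v) →
                length M ≡ nv P → n H ≡ nv P → Pointwise (Match M) (es P) is → (∀ i → i ∈ is) → H ≅ P
  labelling-≅ M P f f-at len size match all-edges =
    mk↔ₛ′ f g (λ y → proj₂ (surj y)) (λ x → f-injective (proj₂ (surj (f x)))) , λ a b c → forward , backward
    where
    f-injective : ∀ {x y} → f x ≡ f y → x ≡ y
    f-injective {x} {y} e = at-functional (f-at x) (subst (λ p → At M (toℕ p) y) (sym e) (f-at y))
    surj : ∀ y → ∃[ x ] f x ≡ y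
    surj = injective⇒surjective f f-injective (≤-reflexive (sym size))
    g : Fin (nv P) → V
    g y = proj₁ (surj y)
    at-unique : ∀ {p v} → At M p v → toℕ (f v) ≡ p
    at-unique {p} {v} h with surj (fromℕ< (subst (p <_) len (at-bound h)))
    ... | w , e = trans (cong (toℕ ∘ f) (at-functional h (subst (λ q → At M q w) toℕfw (f-at w)))) toℕfw
      where
      toℕfw : toℕ (f w) ≡ p
      toℕfw = trans (cong toℕ e) (Fin.toℕ-fromℕ< _)
    distinct-f : ∀ {a b c} → Distinct₃ (a , b , c) → Distinct₃ (toℕ (f a) , toℕ (f b) , toℕ (f c))
    distinct-f (x , y , z) = x ∘ inj , y ∘ inj , z ∘ inj
      where
      inj : ∀ {x y} → toℕ (f x) ≡ toℕ (f y) → x ≡ y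
      inj e = f-injective (Fin.toℕ-injective e)
    forward : ∀ {a b c} → EdgeH H a b c → EdgeP P (toℕ (f a)) (toℕ (f b)) (toℕ (f c))
    forward {a} {b} {c} h with match-edge match (all-edges (Any.index h))
    ... | (p , q , r) , e∈ , a′ , b′ , c′ , ha , hb , hc , inc with Any.lookup-index h
    ...   | d , a∈ , b∈ , c∈ = lose e∈ (distinct-f d , to a∈ , to b∈ , to c∈)
      where
      to : ∀ {x} → x ∈₃ edge (Any.index h) → toℕ (f x) ∈₃ (p , q , r)
      to x∈ with SameSet-∈ inc x∈
      ... | inj₁ refl        = inj₁ (at-unique ha)
      ... | inj₂ (inj₁ refl) = inj₂ (inj₁ (at-unique hb))
      ... | inj₂ (inj₂ refl) = inj₂ (inj₂ (at-unique hc))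
    backward : ∀ {a b c} → EdgeP P (toℕ (f a)) (toℕ (f b)) (toℕ (f c)) → EdgeH H a b c
    backward {a} {b} {c} h with find h
    ... | (p , q , r) , e∈ , (x , y , z) , a∈ , b∈ , c∈ with match-triple match e∈
    ...   | i , a′ , b′ , c′ , ha , hb , hc , _ , a′∈ , b′∈ , c′∈ =
      lose (∈-lookup {xs = E H} i) ((x ∘ cong (toℕ ∘ f) , y ∘ cong (toℕ ∘ f) , z ∘ cong (toℕ ∘ f)) , from a∈ , from b∈ , from c∈)
      where
      from : ∀ {x} → toℕ (f x) ∈₃ (p , q , r) → x ∈₃ edge i
      from {x} (inj₁ e)        rewrite at-functional (subst (λ k → At M k x) e (f-at x)) ha = a′∈
      from {x} (inj₂ (inj₁ e)) rewrite at-functional (subst (λ k → At M k x) e (f-at x)) hb = b′∈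
      from {x} (inj₂ (inj₂ e)) rewrite at-functional (subst (λ k → At M k x) e (f-at x)) hc = c′∈

  -- A vertex lies in some edge, and that edge is matched, so the vertex occurs in `M`; its position
  -- serves as its label.
  layout-≅ : (∀ v → ∃[ i ] (v ∈₃ edge i)) → ∀ (M : List V) (P : Presentation) {is} → length M ≡ nv P → n H ≡ nv P →
             Pointwise (Match M) (es P) is → (∀ i → i ∈ is) → H ≅ P
  layout-≅ covered M P len size match all-edges = labelling-≅ M P f f-at len size match all-edges
    where
    position : ∀ v → ∃[ p ] At M p v
    position v with covered v
    ... | i , v∈ with match-edge match (all-edges i)
    ...   | _ , _ , a , b , c , ha , hb , hc , inc with SameSet-∈ inc v∈
    ...     | inj₁ refl        = _ , ha
    ...     | inj₂ (inj₁ refl) = _ , hb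
    ...     | inj₂ (inj₂ refl) = _ , hc
    f : V → Fin (nv P)
    f v = fromℕ< (subst (proj₁ (position v) <_) len (at-bound (proj₂ (position v))))
    f-at : ∀ v → At M (toℕ (f v)) v
    f-at v = subst (λ p → At M p v) (sym (Fin.toℕ-fromℕ< _)) (proj₂ (position v))

-- Recognising the families A, E, F, G and BD.

module Families (H : Hypergraph3) (covered : ∀ v → ∃[ i ] (v ∈₃ lookup (E H) i)) where

  open Rerooting H
  open Layout H

  private
    at : ∀ {M p q} {x : V} → p ≡ q → At M p x → At M q x
    at {M} {x = x} e = subst (λ k → At M k x) e

    slice : ∀ {M p q} {xs : List V} → p ≡ q → Slice M p xs → Slice M q xs
    slice {M} {xs = xs} e = subst (λ k → Slice M k xs) e

    next : ∀ {M s v x k} (p : Seg v x k) {zs} → Slice M s (segV p ++ zs) → Slice M (s + 2 * k) zs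
    next {M} {s} p {zs} h = slice (cong (s +_) (length-segV p)) (proj₂ (slice-split (segV p) h))

    this : ∀ {M s v x k} (p : Seg v x k) {zs} → Slice M s (segV p ++ zs) → Slice M s (segV p)
    this p h = proj₁ (slice-split (segV p) h)

    length-seg++ : ∀ {v x k} (p : Seg v x k) zs → length (segV p ++ zs) ≡ 2 * k + length zs
    length-seg++ p zs = trans (length-++ (segV p)) (cong (_+ length zs) (length-segV p))

  ≅-A : ∀ {v x k} (p : Seg v x k) → n H ≡ 1 + 2 * k → (∀ i → i ∈ segE p) → H ≅ A k
  ≅-A {v} {k = k} p size cov = layout-≅ covered (v ∷ segV p) (A k) (cong suc (length-segV p)) size
    (match-seg p here (slice-there (slice-refl (segV p)))) cov

  ≅-E : ∀ {v x y z i j k} (p : Seg v x i) (q : Seg v y j) (r : Seg v z k) → n H ≡ 1 + 2 * (i + j + k) →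
        (∀ h → h ∈ segE p ⊎ h ∈ segE q ⊎ h ∈ segE r) → H ≅ Ehg i j k
  ≅-E {v} {i = i} {j} {k} p q r size cov = layout-≅ covered M (Ehg i j k) len size
    (++⁺ (match-seg p here (this p s₁)) (++⁺ (match-seg q here (this q s₂)) (match-seg r here s₃))) cov′
    where
    M = v ∷ segV p ++ (segV q ++ segV r)
    s₁ : Slice M 1 (segV p ++ (segV q ++ segV r))
    s₁ = slice-there (slice-refl _)
    s₂ : Slice M (1 + 2 * i) (segV q ++ segV r)
    s₂ = next p s₁
    s₃ : Slice M (1 + 2 * (i + j)) (segV r)
    s₃ = slice (e i j) (next q s₂)
      where
      e : ∀ i j → 1 + 2 * i + 2 * j ≡ 1 + 2 * (i + j)
      e = solve-∀
    len : length M ≡ 1 + 2 * (i + j + k)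
    len = cong suc (trans (length-seg++ p _) (trans (cong (2 * i +_) (trans (length-seg++ q _) (cong (2 * j +_) (length-segV r)))) (e i j k)))
      where
      e : ∀ i j k → 2 * i + (2 * j + 2 * k) ≡ 2 * (i + j + k)
      e = solve-∀
    cov′ : ∀ h → h ∈ segE p ++ (segE q ++ segE r)
    cov′ h with cov h
    ... | inj₁ m        = ∈-++⁺ˡ m
    ... | inj₂ (inj₁ m) = ∈-++⁺ʳ (segE p) (∈-++⁺ˡ m)
    ... | inj₂ (inj₂ m) = ∈-++⁺ʳ (segE p) (∈-++⁺ʳ (segE q) m)

  ≅-F : ∀ {a b c x y z i j k e} → Inc e a b c → (p : Seg a x i) (q : Seg b y j) (r : Seg c z k) →
        n H ≡ 1 + 2 * (1 + (i + j + k)) → (∀ h → h ≡ e ⊎ h ∈ segE p ⊎ h ∈ segE q ⊎ h ∈ segE r) → H ≅ Fhg i j k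
  ≅-F {a} {b} {c} {i = i} {j} {k} {e} inc p q r size cov = layout-≅ covered M (Fhg i j k) len (trans size (nvs i j k))
    ((a , b , c , here , there here , there (there here) , inc) ∷
      ++⁺ (match-seg p here (this p s₁)) (++⁺ (match-seg q (there here) (this q s₂)) (match-seg r (there (there here)) s₃))) cov′
    where
    M = a ∷ b ∷ c ∷ segV p ++ (segV q ++ segV r)
    nvs : ∀ i j k → 1 + 2 * (1 + (i + j + k)) ≡ 3 + 2 * (i + j + k)
    nvs = solve-∀
    s₁ : Slice M 3 (segV p ++ (segV q ++ segV r))
    s₁ = slice-there (slice-there (slice-there (slice-refl _)))
    s₂ : Slice M (3 + 2 * i) (segV q ++ segV r)
    s₂ = next p s₁
    s₃ : Slice M (3 + 2 * (i + j)) (segV r)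
    s₃ = slice (e₁ i j) (next q s₂)
      where
      e₁ : ∀ i j → 3 + 2 * i + 2 * j ≡ 3 + 2 * (i + j)
      e₁ = solve-∀
    len : length M ≡ 3 + 2 * (i + j + k)
    len = cong (3 +_) (trans (length-seg++ p _) (trans (cong (2 * i +_) (trans (length-seg++ q _) (cong (2 * j +_) (length-segV r)))) (e₁ i j k)))
      where
      e₁ : ∀ i j k → 2 * i + (2 * j + 2 * k) ≡ 2 * (i + j + k)
      e₁ = solve-∀
    cov′ : ∀ h → h ∈ e ∷ segE p ++ (segE q ++ segE r)
    cov′ h with cov h
    ... | inj₁ refl            = here refl
    ... | inj₂ (inj₁ m)        = there (∈-++⁺ˡ m)
    ... | inj₂ (inj₂ (inj₁ m)) = there (∈-++⁺ʳ (segE p) (∈-++⁺ˡ m))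
    ... | inj₂ (inj₂ (inj₂ m)) = there (∈-++⁺ʳ (segE p) (∈-++⁺ʳ (segE q) m))

  ≅-G : ∀ {a b c d y z e₀ e₁ v₁ v₂ v₃ v₄ i j k l m} → Inc e₀ a b c → (s : Seg c d k) → Inc e₁ d y z →
        (p : Seg a v₁ i) (q : Seg b v₂ j) (r : Seg y v₃ l) (t : Seg z v₄ m) →
        n H ≡ 1 + 2 * (2 + k + (i + j + l + m)) →
        (∀ h → h ≡ e₀ ⊎ h ∈ segE s ⊎ h ≡ e₁ ⊎ h ∈ segE p ⊎ h ∈ segE q ⊎ h ∈ segE r ⊎ h ∈ segE t) →
        H ≅ Ghg i j k l m
  ≅-G {a} {b} {c} {d} {y} {z} {e₀} {e₁} {i = i} {j} {k} {l} {m} inc₀ s inc₁ p q r t size cov =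
    layout-≅ covered M (Ghg i j k l m) len (trans size (nvs i j k l m))
      (++⁺ (subst (λ xs → Pointwise (Match M) ((0 , 1 , 2) ∷ xs) (e₀ ∷ segE s ++ e₁ ∷ [])) spine
        ((a , b , c , here , there here , there (there here) , inc₀) ∷
          ++⁺ (match-seg s (there (there here)) (this s s₀))
             ((d , y , z , at-end s (there (there here)) (this s s₀) , proj₁ yz , proj₁ (proj₂ yz) , inc₁) ∷ [])))
        (++⁺ (match-seg p here (this p s₁))
          (++⁺ (match-seg q (there here) (this q s₂))
            (++⁺ (match-seg r (at (ey k) (proj₁ yz)) (this r s₃))
              (match-seg t (at (ez k) (proj₁ (proj₂ yz))) s₄))))) cov′
    where
    tail = segV p ++ (segV q ++ (segV r ++ segV t))
    M = a ∷ b ∷ c ∷ segV s ++ y ∷ z ∷ tail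
    nvs : ∀ i j k l m → 1 + 2 * (2 + k + (i + j + l + m)) ≡ 5 + 2 * k + 2 * (i + j + l + m)
    nvs = solve-∀
    ey : ∀ k → suc (2 * k + 2) ≡ 3 + 2 * k
    ey = solve-∀
    ez : ∀ k → suc (suc (2 * k + 2)) ≡ 4 + 2 * k
    ez = solve-∀
    -- The last spine edge stands apart because arms are attached at both of its far vertices;
    -- `pendant-split` makes it the end of a single path again.
    spine : pendant 2 3 k ++ (2 * k + 2 , suc (2 * k + 2) , suc (suc (2 * k + 2))) ∷ [] ≡ pendant 2 3 (suc k)
    spine = trans (sym (pendant-split 2 k 1)) (cong (pendant 2 3) (+-comm k 1))
    s₀ : Slice M 3 (segV s ++ y ∷ z ∷ tail)
    s₀ = slice-there (slice-there (slice-there (slice-refl _)))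
    split-yz : ∀ {o} → Slice M o (y ∷ z ∷ tail) → At M o y × At M (suc o) z × Slice M (suc (suc o)) tail
    split-yz (h ∷ h′ ∷ h″) = h , h′ , h″
    yz : At M (suc (2 * k + 2)) y × At M (suc (suc (2 * k + 2))) z × Slice M (suc (suc (suc (2 * k + 2)))) tail
    yz = split-yz (slice (sym (ey k)) (next s s₀))
    s₁ : Slice M (5 + 2 * k) tail
    s₁ = slice (cong suc (ez k)) (proj₂ (proj₂ yz))
    s₂ : Slice M (5 + 2 * k + 2 * i) (segV q ++ (segV r ++ segV t))
    s₂ = next p s₁
    s₃ : Slice M (5 + 2 * k + 2 * (i + j)) (segV r ++ segV t)
    s₃ = slice (f₁ k i j) (next q s₂)
      where
      f₁ : ∀ k i j → 5 + 2 * k + 2 * i + 2 * j ≡ 5 + 2 * k + 2 * (i + j)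
      f₁ = solve-∀
    s₄ : Slice M (5 + 2 * k + 2 * (i + j + l)) (segV t)
    s₄ = slice (f₁ k i j l) (next r s₃)
      where
      f₁ : ∀ k i j l → 5 + 2 * k + 2 * (i + j) + 2 * l ≡ 5 + 2 * k + 2 * (i + j + l)
      f₁ = solve-∀
    len : length M ≡ 5 + 2 * k + 2 * (i + j + l + m)
    len = trans (cong (3 +_) (trans (length-seg++ s _) (cong (λ o → 2 * k + (2 + o)) (trans (length-seg++ p _) (cong (2 * i +_)
      (trans (length-seg++ q _) (cong (2 * j +_) (trans (length-seg++ r _) (cong (2 * l +_) (length-segV t)))))))))) (f₁ i j k l m)
      where
      f₁ : ∀ i j k l m → 3 + (2 * k + (2 + (2 * i + (2 * j + (2 * l + 2 * m))))) ≡ 5 + 2 * k + 2 * (i + j + l + m)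
      f₁ = solve-∀
    cov′ : ∀ h → h ∈ (e₀ ∷ segE s ++ e₁ ∷ []) ++ (segE p ++ (segE q ++ (segE r ++ segE t)))
    cov′ h with cov h
    ... | inj₁ refl                                 = here refl
    ... | inj₂ (inj₁ o)                             = there (∈-++⁺ˡ (∈-++⁺ˡ o))
    ... | inj₂ (inj₂ (inj₁ refl))                   = there (∈-++⁺ˡ (∈-++⁺ʳ (segE s) (here refl)))
    ... | inj₂ (inj₂ (inj₂ (inj₁ o)))               = ∈-++⁺ʳ (e₀ ∷ segE s ++ e₁ ∷ []) (∈-++⁺ˡ o)
    ... | inj₂ (inj₂ (inj₂ (inj₂ (inj₁ o))))        = ∈-++⁺ʳ (e₀ ∷ segE s ++ e₁ ∷ []) (∈-++⁺ʳ (segE p) (∈-++⁺ˡ o))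
    ... | inj₂ (inj₂ (inj₂ (inj₂ (inj₂ (inj₁ o))))) = ∈-++⁺ʳ (e₀ ∷ segE s ++ e₁ ∷ []) (∈-++⁺ʳ (segE p) (∈-++⁺ʳ (segE q) (∈-++⁺ˡ o)))
    ... | inj₂ (inj₂ (inj₂ (inj₂ (inj₂ (inj₂ o))))) = ∈-++⁺ʳ (e₀ ∷ segE s ++ e₁ ∷ []) (∈-++⁺ʳ (segE p) (∈-++⁺ʳ (segE q) (∈-++⁺ʳ (segE r) o)))

  -- For n = 5 + j the path of BD consists of `e₀`, `s`, `e₁`, `e₂`. The pendant edge `e₃` sits at
  -- its first joint, and `e₄` at the free vertex of its last edge but one.
  ≅-BD : ∀ {a b v d y z e₀ e₁ e₂ e₃ e₄ c₁ c₂ c₃ c₄ c₅ c₆ j} → Inc e₀ a b v → (s : Seg v d j) → Inc e₁ d y z →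
         Inc e₂ z c₁ c₂ → Inc e₃ v c₃ c₄ → Inc e₄ y c₅ c₆ → n H ≡ 1 + 2 * (5 + j) →
         (∀ h → h ≡ e₀ ⊎ h ∈ segE s ⊎ h ≡ e₁ ⊎ h ≡ e₂ ⊎ h ≡ e₃ ⊎ h ≡ e₄) → H ≅ BD (5 + j)
  ≅-BD {a} {b} {v} {d} {y} {z} {e₀} {e₁} {e₂} {e₃} {e₄} {c₁} {c₂} {c₃} {c₄} {c₅} {c₆} {j} inc₀ s inc₁ inc₂ inc₃ inc₄ size cov =
    layout-≅ covered M (BD (5 + j)) len size
      (++⁺ (subst (λ xs → Pointwise (Match M) ((0 , 1 , 2) ∷ xs) (e₀ ∷ segE s ++ e₁ ∷ e₂ ∷ [])) spine
        ((a , b , v , here , there here , there (there here) , inc₀) ∷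
          ++⁺ (match-seg s (there (there here)) (this s s₀))
            ((d , y , z , at-end s (there (there here)) (this s s₀) , ay , az , inc₁) ∷ (z , c₁ , c₂ , az , a₁ , a₂ , inc₂) ∷ [])))
        ((v , c₃ , c₄ , there (there here) , at (cong (_∸ 3) (f j)) a₃ , at (cong (_∸ 2) (f j)) a₄ , inc₃) ∷
         (y , c₅ , c₆ , at (cong (_∸ 7) (f j)) ay , at (cong (_∸ 1) (f j)) a₅ , at (f j) a₆ , inc₄) ∷ [])) cov′
    where
    tail = y ∷ z ∷ c₁ ∷ c₂ ∷ c₃ ∷ c₄ ∷ c₅ ∷ c₆ ∷ []
    M = a ∷ b ∷ v ∷ segV s ++ tail
    -- Exposing eight successors lets the truncated subtractions in the labels of `BD` compute.
    f : ∀ j → 8 + (2 * j + 2) ≡ 2 * (5 + j)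
    f = solve-∀
    spine : pendant 2 3 j ++ (2 * j + 2 , suc (2 * j + 2) , suc (suc (2 * j + 2)))
              ∷ (suc (suc (2 * j + 2)) , suc (suc (suc (2 * j + 2))) , suc (suc (suc (suc (2 * j + 2))))) ∷ [] ≡ pendant 2 3 (2 + j)
    spine = trans (sym (pendant-split 2 j 2)) (cong (pendant 2 3) (+-comm j 2))
    s₀ : Slice M 3 (segV s ++ tail)
    s₀ = slice-there (slice-there (slice-there (slice-refl _)))
    s₁ : Slice M (suc (2 * j + 2)) tail
    s₁ = slice (e j) (next s s₀)
      where
      e : ∀ k → 3 + 2 * k ≡ suc (2 * k + 2)
      e = solve-∀
    ats : ∀ {o} → Slice M o tail → At M o y × At M (1 + o) z × At M (2 + o) c₁ × At M (3 + o) c₂ ×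
          At M (4 + o) c₃ × At M (5 + o) c₄ × At M (6 + o) c₅ × At M (7 + o) c₆
    ats (h₁ ∷ h₂ ∷ h₃ ∷ h₄ ∷ h₅ ∷ h₆ ∷ h₇ ∷ h₈ ∷ []) = h₁ , h₂ , h₃ , h₄ , h₅ , h₆ , h₇ , h₈
    as = ats s₁
    ay = proj₁ as
    az = proj₁ (proj₂ as)
    a₁ = proj₁ (proj₂ (proj₂ as))
    a₂ = proj₁ (proj₂ (proj₂ (proj₂ as)))
    a₃ = proj₁ (proj₂ (proj₂ (proj₂ (proj₂ as))))
    a₄ = proj₁ (proj₂ (proj₂ (proj₂ (proj₂ (proj₂ as)))))
    a₅ = proj₁ (proj₂ (proj₂ (proj₂ (proj₂ (proj₂ (proj₂ as))))))
    a₆ = proj₂ (proj₂ (proj₂ (proj₂ (proj₂ (proj₂ (proj₂ as))))))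
    len : length M ≡ 1 + 2 * (5 + j)
    len = trans (cong (3 +_) (length-seg++ s tail)) (e j)
      where
      e : ∀ j → 3 + (2 * j + 8) ≡ 1 + 2 * (5 + j)
      e = solve-∀
    cov′ : ∀ h → h ∈ (e₀ ∷ segE s ++ e₁ ∷ e₂ ∷ []) ++ (e₃ ∷ e₄ ∷ [])
    cov′ h with cov h
    ... | inj₁ refl                                 = here refl
    ... | inj₂ (inj₁ o)                             = there (∈-++⁺ˡ (∈-++⁺ˡ o))
    ... | inj₂ (inj₂ (inj₁ refl))                   = there (∈-++⁺ˡ (∈-++⁺ʳ (segE s) (here refl)))
    ... | inj₂ (inj₂ (inj₂ (inj₁ refl)))            = there (∈-++⁺ˡ (∈-++⁺ʳ (segE s) (there (here refl))))
    ... | inj₂ (inj₂ (inj₂ (inj₂ (inj₁ refl))))     = ∈-++⁺ʳ (e₀ ∷ segE s ++ e₁ ∷ e₂ ∷ []) (here refl)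
    ... | inj₂ (inj₂ (inj₂ (inj₂ (inj₂ refl))))     = ∈-++⁺ʳ (e₀ ∷ segE s ++ e₁ ∷ e₂ ∷ []) (there (here refl))

-- Shapes of arms and lower bounds for their shares.

module Shapes (H : Hypergraph3) (small : SpectralRadius<ρ₃ H) where

  open Spanning H small public
  open Layout H public

  data NonEmpty {v} : Arms v → Set where
    nonEmpty : ∀ {i a b e X Y R} → NonEmpty (arm i a b e X Y R)

  data Single {v} : Arms v → Set where
    single : ∀ {i a b e} → Single (arm i a b e [] [] [])

  -- At most one edge leads down from each vertex. Where an edge also leads up, this means degree at
  -- most 2.
  data Thin : ∀ {v} → Arms v → Set where
    []   : ∀ {v} → Thin {v} []
    thin : ∀ {v i a b e X Y} → Thin X → Thin Y → Thin {v} (arm i a b e X Y [])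

  data Run : ∀ {v x} → Arms v → Arms x → ℕ → Set where
    here  : ∀ {v} {t : Arms v} → Run t t 0
    left  : ∀ {v x i a b e X j} {t : Arms x} → Run X t j → Run {v} (arm i a b e X [] []) t (suc j)
    right : ∀ {v x i a b e Y j} {t : Arms x} → Run Y t j → Run {v} (arm i a b e [] Y []) t (suc j)

  -- Three ways for a run to stop: at a leaf, at an edge that continues at both far vertices, or at
  -- a vertex from which at least two edges lead on.
  data Shape {v} (t : Arms v) : Set where
    path : ∀ {x j} → Run t ([] {x}) j → Shape t
    fork : ∀ {x j i y z e Y Z} → Run t (arm {x} i y z e Y Z []) j → NonEmpty Y → NonEmpty Z → Shape t
    bush : ∀ {x j i y z e Y Z R} → Run t (arm {x} i y z e Y Z R) j → NonEmpty R → Shape t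

  shape : ∀ {v} (t : Arms v) → Shape t
  shape [] = path here
  shape (arm i a b e X Y R@(arm _ _ _ _ _ _ _)) = bush here nonEmpty
  shape (arm i a b e X@(arm _ _ _ _ _ _ _) Y@(arm _ _ _ _ _ _ _) []) = fork here nonEmpty nonEmpty
  shape (arm i a b e [] Y []) with shape Y
  ... | path r     = path (right r)
  ... | fork r p q = fork (right r) p q
  ... | bush r p   = bush (right r) p
  shape (arm i a b e X@(arm _ _ _ _ _ _ _) [] []) with shape X
  ... | path r     = path (left r)
  ... | fork r p q = fork (left r) p q
  ... | bush r p   = bush (left r) p

  run-seg : ∀ {v x j} {t : Arms v} {t′ : Arms x} → Run t t′ j → Seg v x j
  run-seg here = end
  run-seg (left  {i = i} {a} {b} {e} r) = step i b a (SameSet-swap₂₃ e) (run-seg r)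
  run-seg (right {i = i} {a} {b} {e} r) = step i a b e (run-seg r)

  run-edges : ∀ {v x j i} {t : Arms v} {t′ : Arms x} (r : Run t t′ j) → i ∈ edges t → i ∈ segE (run-seg r) ⊎ i ∈ edges t′
  run-edges here h = inj₂ h
  run-edges (left r) (here e) = inj₁ (here e)
  run-edges (left {X = X} r) (there h) with run-edges r (subst (_ ∈_) (++-identityʳ (edges X)) h)
  ... | inj₁ m = inj₁ (there m)
  ... | inj₂ m = inj₂ m
  run-edges (right r) (here e) = inj₁ (here e)
  run-edges (right {Y = Y} r) (there h) with run-edges r (subst (_ ∈_) (++-identityʳ (edges Y)) h)
  ... | inj₁ m = inj₁ (there m)
  ... | inj₂ m = inj₂ m

  run-size : ∀ {v x j} {t : Arms v} {t′ : Arms x} → Run t t′ j → size t ≡ j + size t′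
  run-size here = refl
  run-size (left  {X = X} r) = cong suc (trans (cong length (++-identityʳ (edges X))) (run-size r))
  run-size (right {Y = Y} r) = cong suc (trans (cong length (++-identityʳ (edges Y))) (run-size r))

  run-thin : ∀ {v x j} {t : Arms v} {t′ : Arms x} → Run t t′ j → Thin t → Thin t′
  run-thin here t = t
  run-thin (left r)  (thin p q) = run-thin r p
  run-thin (right r) (thin p q) = run-thin r q

  run-nonEmpty : ∀ {v x j} {t : Arms v} → Run t ([] {x}) j → NonEmpty t → 0 < j
  run-nonEmpty (left r)  _ = s≤s z≤n
  run-nonEmpty (right r) _ = s≤s z≤n

  -- Moves the root to the far end of the run; the run and `u` together become one arm there.
  run-reroot : ∀ {v x j} {t : Arms v} {t′ : Arms x} → Run t t′ j → (u : Arms v) → Thin u → NonEmpty u →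
               Σ (Arms x) λ u′ → Thin u′ × NonEmpty u′ × edges t′ ++ edges u′ ↭ edges t ++ edges u
  run-reroot here u p q = u , p , q , ↭-refl
  run-reroot {v} (left {i = i} {a} {b} {e} {X} r) u p q
    with run-reroot r (arm i v b (SameSet-swap₁₂ e) u [] []) (thin p []) nonEmpty
  ... | u′ , p′ , q′ , h = u′ , p′ , q′ , ↭-trans h
    (SI.solve 3 (λ i x u → x SI.⊕ (i SI.⊕ (u SI.⊕ SI.id)) SI.⊜ (i SI.⊕ (x SI.⊕ SI.id)) SI.⊕ u) ↭-refl (i ∷ []) (edges X) (edges u))
  run-reroot {v} (right {i = i} {a} {b} {e} {Y} r) u p q
    with run-reroot r (arm i v a (SameSet-swap₁₂ (SameSet-swap₂₃ e)) u [] []) (thin p []) nonEmpty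
  ... | u′ , p′ , q′ , h = u′ , p′ , q′ , ↭-trans h
    (SI.solve 3 (λ i y u → y SI.⊕ (i SI.⊕ (u SI.⊕ SI.id)) SI.⊜ (i SI.⊕ (y SI.⊕ SI.id)) SI.⊕ u) ↭-refl (i ∷ []) (edges Y) (edges u))

  wt-0 : ∀ {v} (t : Arms v) g → Wt t 0 g
  wt-0 t g = 1 , s≤s z≤n , λ m → 0 , 0 , zero-val t , z≤n

  wt-left : ∀ {v i a b e p g} {X : Arms a} p′ g′ → 0 < g → p′ * (4 * g) ≤ (p′ + g′) * (p + g) →
            Wt X p g → Wt {v} (arm i a b e X [] []) p′ g′
  wt-left {p = p} {g} p′ g′ g>0 h w = wt-arm p′ g′ g>0 (s≤s {n = 0} z≤n)
    (subst₂ (λ x y → p′ * (4 * x) ≤ (p′ + g′) * y) (sym (*-identityʳ g)) (sym (*-identityʳ (p + g))) h) w (wt-0 [] 1)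

  wt-right : ∀ {v i a b e p g} {Y : Arms b} p′ g′ → 0 < g → p′ * (4 * g) ≤ (p′ + g′) * (p + g) →
             Wt Y p g → Wt {v} (arm i a b e [] Y []) p′ g′
  wt-right {p = p} {g} p′ g′ g>0 h w = wt-arm p′ g′ (s≤s {n = 0} z≤n) g>0
    (subst₂ (λ x y → p′ * (4 * x) ≤ (p′ + g′) * y) (sym (+-identityʳ g)) (sym (+-identityʳ (p + g))) h) (wt-0 [] 1) w

  -- The shares k / (2 k + 2) form an orbit of w ↦ 1 / (4 (1 - w)) increasing to the
  -- fixed point 1/2; their complements (k + 2) / (2 k + 2) form one decreasing from above.
  run-below : ∀ {v x j} {t : Arms v} {t′ : Arms x} k → Run t t′ j → Wt t′ k (2 + k) → Wt t (j + k) (2 + (j + k))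
  run-below k here w = w
  run-below {j = suc j} k (left r) w = wt-left _ _ (s≤s z≤n) (≤-reflexive (e (j + k))) (run-below k r w)
    where
    e : ∀ m → suc m * (4 * (2 + m)) ≡ (suc m + (2 + suc m)) * (m + (2 + m))
    e = solve-∀
  run-below {j = suc j} k (right r) w = wt-right _ _ (s≤s z≤n) (≤-reflexive (e (j + k))) (run-below k r w)
    where
    e : ∀ m → suc m * (4 * (2 + m)) ≡ (suc m + (2 + suc m)) * (m + (2 + m))
    e = solve-∀

  run-above : ∀ {v x j} {t : Arms v} {t′ : Arms x} k → Run t t′ j →
              Wt t′ (2 + (j + k)) (j + k) → Wt t (2 + k) k
  run-above k here w = w
  run-above {j = suc j} {t′ = t′} k (left r) w = wt-left (2 + k) k (s≤s z≤n) (≤-reflexive (e k))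
    (run-above (suc k) r (subst (λ m → Wt t′ (2 + m) m) (sym (+-suc j k)) w))
    where
    e : ∀ k → (2 + k) * (4 * suc k) ≡ (2 + k + k) * (2 + suc k + suc k)
    e = solve-∀
  run-above {j = suc j} {t′ = t′} k (right r) w = wt-right (2 + k) k (s≤s z≤n) (≤-reflexive (e k))
    (run-above (suc k) r (subst (λ m → Wt t′ (2 + m) m) (sym (+-suc j k)) w))
    where
    e : ∀ k → (2 + k) * (4 * suc k) ≡ (2 + k + k) * (2 + suc k + suc k)
    e = solve-∀

  run-half : ∀ {v x j} {t : Arms v} {t′ : Arms x} → Run t t′ j → Wt t′ 1 1 → Wt t 1 1
  run-half here w = w
  run-half (left r)  w = wt-left 1 1 (s≤s z≤n) ≤-refl (run-half r w)
  run-half (right r) w = wt-right 1 1 (s≤s z≤n) ≤-refl (run-half r w)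

  wt-path : ∀ {v x j} {t : Arms v} → Run t ([] {x}) j → Wt t j (2 + j)
  wt-path {j = j} {t} r = subst (λ k → Wt t k (2 + k)) (+-identityʳ j) (run-below 0 r (wt-0 [] 2))

  wt-prefix : ∀ {v i a b e p g} {X : Arms a} {Y : Arms b} {R : Arms v} → 0 < p →
              Wt (arm i a b e X Y []) p g → Wt (arm i a b e X Y R) p g
  wt-prefix {p = p} {g} {R = R} p>0 w = wt-sum p g (≤-trans p>0 (m≤m+n p g)) (s≤s {n = 0} z≤n)
    (≤-reflexive (arith p g)) w (wt-0 R 1)
    where
    arith : ∀ p g → p * ((p + g) * 1) ≡ (p + g) * (p * 1 + 0)
    arith = solve-∀

  -- A lone edge has share 1 / 4, and anything hanging from it or beside it only helps.
  wt-quarter : ∀ {v} {t : Arms v} → NonEmpty t → Wt t 1 3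
  wt-quarter (nonEmpty {X = X} {Y}) = wt-prefix (s≤s z≤n) (wt-arm 1 3 (s≤s {n = 0} z≤n) (s≤s {n = 0} z≤n) ≤-refl (wt-0 X 1) (wt-0 Y 1))

  -- Two edges at a vertex give 1/4 + 1/4, and 1/2 is the fixed point that a run passes on
  -- unchanged.
  wt-bush : ∀ {v i a b e} {X : Arms a} {Y : Arms b} {R : Arms v} → NonEmpty R → Wt (arm i a b e X Y R) 1 1
  wt-bush p = wt-sum 1 1 (s≤s z≤n) (s≤s z≤n) ≤-refl (wt-quarter nonEmpty) (wt-quarter p)

  -- The next share after 1/4 is 1/3, that of a path of two edges: 1 / (4 * 3/4).
  single? : ∀ {v} {t : Arms v} → NonEmpty t → Single t ⊎ Wt t 1 2
  single? (nonEmpty {X = []} {[]} {[]}) = inj₁ single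
  single? (nonEmpty {R = arm _ _ _ _ _ _ _}) = inj₂ (wt-mono 1 2 (s≤s z≤n) (s≤s (s≤s z≤n)) (wt-bush nonEmpty))
  single? (nonEmpty {X = arm _ _ _ _ _ _ _} {Y} {[]}) =
    inj₂ (wt-arm 1 2 (s≤s z≤n) (s≤s {n = 0} z≤n) ≤-refl (wt-quarter nonEmpty) (wt-0 Y 1))
  single? (nonEmpty {X = []} {arm _ _ _ _ _ _ _} {[]}) =
    inj₂ (wt-arm 1 2 (s≤s {n = 0} z≤n) (s≤s z≤n) ≤-refl (wt-0 [] 1) (wt-quarter nonEmpty))

  -- An edge with two pendant edges acts like a pendant path of length 8.
  wt-fork : ∀ {x i y z e} {Y : Arms y} {Z : Arms z} → NonEmpty Y → NonEmpty Z → Wt (arm {x} i y z e Y Z []) 8 10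
  wt-fork p q = wt-arm 8 10 (s≤s z≤n) (s≤s z≤n) ≤-refl (wt-quarter p) (wt-quarter q)

  -- The share starts at 8/18 = 4/9 at the fork and only grows along the run, so 4/9 is a bound
  -- independent of `j`.
  wt-forked : ∀ {v x j i y z e Y Z} {t : Arms v} → Run t (arm {x} i y z e Y Z []) j → NonEmpty Y → NonEmpty Z → Wt t 4 5
  wt-forked {j = j} r p q = wt-mono {p = j + 8} 4 5 (≤-trans (s≤s z≤n) (m≤n+m (2 + (j + 8)) (j + 8))) (≤-slack j (arith j))
    (run-below 8 r (wt-fork p q))
    where
    arith : ∀ j → (j + 8) * 9 ≡ 4 * (j + 8 + (2 + (j + 8))) + j
    arith = solve-∀

  Three : Set
  Three = ∃[ v ] Σ I λ i₁ → Σ V λ a₁ → Σ V λ b₁ → Σ (Inc i₁ v a₁ b₁) λ e₁ → Σ (Arms a₁) λ X₁ → Σ (Arms b₁) λ Y₁ →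
    Σ I λ i₂ → Σ V λ a₂ → Σ V λ b₂ → Σ (Inc i₂ v a₂ b₂) λ e₂ → Σ (Arms a₂) λ X₂ → Σ (Arms b₂) λ Y₂ →
    Σ (Arms v) λ R → NonEmpty R × Spans (arm i₁ a₁ b₁ e₁ X₁ Y₁ (arm i₂ a₂ b₂ e₂ X₂ Y₂ R))

  both : ∀ {P Q R T : Set} → (P → Q → R) → P ⊎ T → Q ⊎ T → R ⊎ T
  both f (inj₁ p) (inj₁ q) = inj₁ (f p q)
  both f (inj₂ t) _        = inj₂ t
  both f _        (inj₂ t) = inj₂ t

  -- Here `u` is what lies on the other side of the root. Since it is nonempty, two arms of `t` at
  -- the root already make degree 3. For the recursion the root moves to a child, and all that is
  -- not below that child joins `u`.
  thin-or-three : ∀ {v} (u : Arms v) → NonEmpty u → (t : Arms v) → Spans (t ⊕ u) → Thin t ⊎ Three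
  thin-or-three u p [] sp = inj₁ []
  thin-or-three {v} u p (arm i a b e X Y []) sp = both thin
    (thin-or-three (arm i v b (SameSet-swap₁₂ e) u Y []) nonEmpty X
      (Spans-resp-↭ {t = arm i a b e X Y u} {t′ = X ⊕ arm i v b (SameSet-swap₁₂ e) u Y []} (↭-sym (↭-trans (edges-⊕ X _)
        (SI.solve 4 (λ i x y u → x SI.⊕ (i SI.⊕ (u SI.⊕ (y SI.⊕ SI.id))) SI.⊜ i SI.⊕ (x SI.⊕ (y SI.⊕ u))) ↭-refl
          (i ∷ []) (edges X) (edges Y) (edges u)))) sp))
    (thin-or-three (arm i v a (SameSet-swap₁₂ (SameSet-swap₂₃ e)) u X []) nonEmpty Y
      (Spans-resp-↭ {t = arm i a b e X Y u} {t′ = Y ⊕ arm i v a (SameSet-swap₁₂ (SameSet-swap₂₃ e)) u X []} (↭-sym (↭-trans (edges-⊕ Y _)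
        (SI.solve 4 (λ i x y u → y SI.⊕ (i SI.⊕ (u SI.⊕ (x SI.⊕ SI.id))) SI.⊜ i SI.⊕ (x SI.⊕ (y SI.⊕ u))) ↭-refl
          (i ∷ []) (edges X) (edges Y) (edges u)))) sp))
  thin-or-three u p (arm i a b e X Y (arm i′ a′ b′ e′ X′ Y′ R)) sp =
    inj₂ (_ , i , a , b , e , X , Y , i′ , a′ , b′ , e′ , X′ , Y′ , R ⊕ u , ⊕-nonEmpty R p , sp)
    where
    ⊕-nonEmpty : ∀ {v} (R : Arms v) {u} → NonEmpty u → NonEmpty (R ⊕ u)
    ⊕-nonEmpty []                  p = p
    ⊕-nonEmpty (arm _ _ _ _ _ _ _) p = nonEmpty

-- The arithmetic that bounds the path lengths.

Listed : Hypergraph3 → Set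
Listed H =
    (∃[ k ] (1 ≤ k × H ≅ A k))
  ⊎ (∃[ k ] (3 ≤ k × H ≅ D k))
  ⊎ (∃[ k ] (4 ≤ k × H ≅ D′ k))
  ⊎ (∃[ k ] (5 ≤ k × H ≅ B k))
  ⊎ (∃[ k ] (6 ≤ k × H ≅ B′ k))
  ⊎ (∃[ k ] (7 ≤ k × H ≅ B̄ k))
  ⊎ (∃[ k ] (5 ≤ k × H ≅ BD k))
  ⊎ H ≅ E₆ ⊎ H ≅ E₇ ⊎ H ≅ E₈
  ⊎ H ≅ Fhg 2 3 3
  ⊎ (∃[ k ] (2 ≤ k × k ≤ 6 × H ≅ Fhg 2 2 k))
  ⊎ (∃[ k ] (3 ≤ k × k ≤ 13 × H ≅ Fhg 1 3 k))
  ⊎ (∃[ k ] (4 ≤ k × k ≤ 7 × H ≅ Fhg 1 4 k))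
  ⊎ H ≅ Fhg 1 5 5
  ⊎ (∃[ k ] (k ≤ 5 × H ≅ Ghg 1 1 k 1 3))

below : ∀ m k → k < m ⊎ ∃[ c ] k ≡ m + c
below m k with k <? m
... | yes h = inj₁ h
... | no  h = inj₂ (k ∸ m , sym (m+[n∸m]≡n (≮⇒≥ h)))

≤⇒+ : ∀ {m k} → m ≤ k → ∃[ c ] k ≡ m + c
≤⇒+ {m} {k} h = k ∸ m , sym (m+[n∸m]≡n h)

-- Three paths of lengths i, j, k at a vertex, resp. at the three vertices of an
-- edge, reach spectral radius ρ₃ exactly under these inequalities.
VertexHeavy EdgeHeavy : ℕ → ℕ → ℕ → Set
VertexHeavy i j k = (i + (2 + i)) * ((j + (2 + j)) * (k + (2 + k))) ≤
  i * ((j + (2 + j)) * (k + (2 + k))) + (j * ((i + (2 + i)) * (k + (2 + k))) + k * ((i + (2 + i)) * (j + (2 + j))))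
EdgeHeavy i j k = 4 * ((2 + i) * ((2 + j) * (2 + k))) ≤ (i + (2 + i)) * ((j + (2 + j)) * (k + (2 + k)))

-- A path of length q and a pendant edge on one side, two pendant edges on the other.
ForkHeavy : ℕ → ℕ → Set
ForkHeavy k q = (10 + k) * (4 * (3 * (2 + q))) ≤ (18 + (k + k)) * (4 * (q + (2 + q)))

module _ {H : Hypergraph3} where

  private
    -- The triples (1,2,5), (1,3,3), (2,2,2) are the arm lengths of the extended Dynkin diagrams of
    -- types E₈, E₇, E₆. There the shares sum to exactly 1, which is why the slack has no constant
    -- term; its other coefficients are nonnegative.
    v125 : ∀ c → VertexHeavy 1 2 (5 + c)
    v125 c = ≤-slack (4 * c) (e c)
      where
      e : ∀ c → 1 * (6 * (5 + c + (2 + (5 + c)))) + (2 * (4 * (5 + c + (2 + (5 + c)))) + (5 + c) * (4 * 6))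
          ≡ 4 * (6 * (5 + c + (2 + (5 + c)))) + 4 * c
      e = solve-∀
    v133 : ∀ b c → VertexHeavy 1 (3 + b) (3 + c)
    v133 b c = ≤-slack (4 * b * c + 8 * b + 8 * c) (e b c)
      where
      e : ∀ b c → 1 * ((3 + b + (2 + (3 + b))) * (3 + c + (2 + (3 + c)))) + ((3 + b) * (4 * (3 + c + (2 + (3 + c)))) + (3 + c) * (4 * (3 + b + (2 + (3 + b)))))
          ≡ 4 * ((3 + b + (2 + (3 + b))) * (3 + c + (2 + (3 + c)))) + (4 * b * c + 8 * b + 8 * c)
      e = solve-∀
    v222 : ∀ a b c → VertexHeavy (2 + a) (2 + b) (2 + c)
    v222 a b c = ≤-slack (4 * a * b * c + 8 * a * b + 8 * a * c + 8 * b * c + 12 * a + 12 * b + 12 * c) (e a b c)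
      where
      e : ∀ a b c → (2 + a) * ((2 + b + (2 + (2 + b))) * (2 + c + (2 + (2 + c)))) + ((2 + b) * ((2 + a + (2 + (2 + a))) * (2 + c + (2 + (2 + c)))) + (2 + c) * ((2 + a + (2 + (2 + a))) * (2 + b + (2 + (2 + b)))))
          ≡ (2 + a + (2 + (2 + a))) * ((2 + b + (2 + (2 + b))) * (2 + c + (2 + (2 + c)))) + (4 * a * b * c + 8 * a * b + 8 * a * c + 8 * b * c + 12 * a + 12 * b + 12 * c)
      e = solve-∀

  -- Lengths (1,1,k) are never excluded: 1/4 + 1/4 leaves 1/2, the limit that the share of a path
  -- does not reach.
  listed-E : ∀ i j k → 1 ≤ i → i ≤ j → j ≤ k → ¬ VertexHeavy i j k → H ≅ Ehg i j k → Listed H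
  listed-E 1 1 k _ _ 1≤k light iso = inj₂ (inj₁ (2 + k , s≤s (s≤s 1≤k) , iso))
  listed-E 1 2 1 _ _ (s≤s ()) light iso
  listed-E 1 2 2 _ _ _ light iso = inj₂ (inj₂ (inj₂ (inj₂ (inj₂ (inj₂ (inj₂ (inj₁ iso)))))))
  listed-E 1 2 3 _ _ _ light iso = inj₂ (inj₂ (inj₂ (inj₂ (inj₂ (inj₂ (inj₂ (inj₂ (inj₁ iso))))))))
  listed-E 1 2 4 _ _ _ light iso = inj₂ (inj₂ (inj₂ (inj₂ (inj₂ (inj₂ (inj₂ (inj₂ (inj₂ (inj₁ iso)))))))))
  listed-E 1 2 (suc (suc (suc (suc (suc c))))) _ _ _ light iso = ⊥-elim (light (v125 c))
  listed-E 1 (suc (suc (suc b))) (suc (suc (suc c))) _ _ _ light iso = ⊥-elim (light (v133 b c))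
  listed-E 1 (suc (suc (suc b))) 2 _ _ (s≤s (s≤s ())) light iso
  listed-E 1 (suc (suc (suc b))) 1 _ _ (s≤s ()) light iso
  listed-E (suc (suc a)) (suc (suc b)) (suc (suc c)) _ _ _ light iso = ⊥-elim (light (v222 a b c))
  listed-E (suc (suc a)) (suc (suc b)) 1 _ _ (s≤s ()) light iso
  listed-E (suc (suc a)) 1 k _ (s≤s ()) _ light iso

  private
    -- Equality holds at (1,3,14), (1,4,8), (1,5,6), (2,2,7) and (2,3,4), whose slacks vanish there;
    -- these set the largest listed third lengths 13, 7, 5, 6 and 3. The remaining starting triples
    -- (1,6,6), (2,4,4), (3,3,3), (2,2,8) lie strictly beyond.
    f13 : ∀ c → EdgeHeavy 1 3 (14 + c)
    f13 c = ≤-slack (4 * c) (e c)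
      where
      e : ∀ c → 4 * (8 * (14 + c + (2 + (14 + c)))) ≡ 4 * (3 * (5 * (2 + (14 + c)))) + 4 * c
      e = solve-∀
    f14 : ∀ b c → EdgeHeavy 1 (4 + b) (8 + c)
    f14 b c = ≤-slack (4 * b * c + 24 * b + 8 * c) (e b c)
      where
      e : ∀ b c → 4 * ((4 + b + (2 + (4 + b))) * (8 + c + (2 + (8 + c)))) ≡ 4 * (3 * ((2 + (4 + b)) * (2 + (8 + c)))) + (4 * b * c + 24 * b + 8 * c)
      e = solve-∀
    f15 : ∀ c → EdgeHeavy 1 5 (6 + c)
    f15 c = ≤-slack (12 * c) (e c)
      where
      e : ∀ c → 4 * (12 * (6 + c + (2 + (6 + c)))) ≡ 4 * (3 * (7 * (2 + (6 + c)))) + 12 * c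
      e = solve-∀
    f16 : ∀ b c → EdgeHeavy 1 (6 + b) (6 + c)
    f16 b c = ≤-slack (4 * b * c + 16 * b + 16 * c + 16) (e b c)
      where
      e : ∀ b c → 4 * ((6 + b + (2 + (6 + b))) * (6 + c + (2 + (6 + c)))) ≡ 4 * (3 * ((2 + (6 + b)) * (2 + (6 + c)))) + (4 * b * c + 16 * b + 16 * c + 16)
      e = solve-∀
    f22 : ∀ c → EdgeHeavy 2 2 (7 + c)
    f22 c = ≤-slack (8 * c) (e c)
      where
      e : ∀ c → 6 * (6 * (7 + c + (2 + (7 + c)))) ≡ 4 * (4 * (4 * (2 + (7 + c)))) + 8 * c
      e = solve-∀
    f23 : ∀ c → EdgeHeavy 2 3 (4 + c)
    f23 c = ≤-slack (16 * c) (e c)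
      where
      e : ∀ c → 6 * (8 * (4 + c + (2 + (4 + c)))) ≡ 4 * (4 * (5 * (2 + (4 + c)))) + 16 * c
      e = solve-∀
    f24 : ∀ b c → EdgeHeavy 2 (4 + b) (4 + c)
    f24 b c = ≤-slack (8 * b * c + 24 * b + 24 * c + 24) (e b c)
      where
      e : ∀ b c → 6 * ((4 + b + (2 + (4 + b))) * (4 + c + (2 + (4 + c)))) ≡ 4 * (4 * ((2 + (4 + b)) * (2 + (4 + c)))) + (8 * b * c + 24 * b + 24 * c + 24)
      e = solve-∀
    f33 : ∀ a b c → EdgeHeavy (3 + a) (3 + b) (3 + c)
    f33 a b c = ≤-slack (4 * a * b * c + 12 * a * b + 12 * a * c + 12 * b * c + 28 * a + 28 * b + 28 * c + 12) (e a b c)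
      where
      e : ∀ a b c → (3 + a + (2 + (3 + a))) * ((3 + b + (2 + (3 + b))) * (3 + c + (2 + (3 + c))))
          ≡ 4 * ((2 + (3 + a)) * ((2 + (3 + b)) * (2 + (3 + c)))) + (4 * a * b * c + 12 * a * b + 12 * a * c + 12 * b * c + 28 * a + 28 * b + 28 * c + 12)
      e = solve-∀
    f228 : ∀ a b c → EdgeHeavy (2 + a) (2 + b) (8 + c)
    f228 a b c = ≤-slack (4 * a * b * c + 32 * a * b + 8 * a * c + 8 * b * c + 56 * a + 56 * b + 8 * c + 8) (e a b c)
      where
      e : ∀ a b c → (2 + a + (2 + (2 + a))) * ((2 + b + (2 + (2 + b))) * (8 + c + (2 + (8 + c))))
          ≡ 4 * ((2 + (2 + a)) * ((2 + (2 + b)) * (2 + (8 + c)))) + (4 * a * b * c + 32 * a * b + 8 * a * c + 8 * b * c + 56 * a + 56 * b + 8 * c + 8)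
      e = solve-∀
    g3 : ∀ c → ForkHeavy (6 + c) 3
    g3 c = ≤-slack (4 * c) (e c)
      where
      e : ∀ c → (18 + (6 + c + (6 + c))) * 32 ≡ (10 + (6 + c)) * 60 + 4 * c
      e = solve-∀
    g4 : ∀ k b → ForkHeavy k (4 + b)
    g4 k b = ≤-slack (4 * b * k + 24 * b + 8 * k) (e k b)
      where
      e : ∀ k b → (18 + (k + k)) * (4 * (4 + b + (2 + (4 + b)))) ≡ (10 + k) * (4 * (3 * (2 + (4 + b)))) + (4 * b * k + 24 * b + 8 * k)
      e = solve-∀

  -- As k grows, 4 times the product of the complements tends to 4 * 3/4 * 2/3 * 1/2 = 1 for
  -- (1,2,k), so that family is infinite. For (1,3,k) the limit is 15/16, and k is bounded.
  listed-F : ∀ i j k → 1 ≤ i → i ≤ j → j ≤ k → ¬ EdgeHeavy i j k → H ≅ Fhg i j k → Listed H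
  listed-F 1 1 k _ _ 1≤k light iso = inj₂ (inj₂ (inj₁ (3 + k , s≤s (s≤s (s≤s 1≤k)) , iso)))
  listed-F 1 2 k _ _ 2≤k light iso = inj₂ (inj₂ (inj₂ (inj₁ (4 + k , s≤s (s≤s (s≤s (≤-trans 2≤k (n≤1+n k)))) , iso))))
  listed-F 1 3 k _ _ 3≤k light iso with below 14 k
  ... | inj₁ k<14       = inj₂ (inj₂ (inj₂ (inj₂ (inj₂ (inj₂ (inj₂ (inj₂ (inj₂ (inj₂ (inj₂ (inj₂ (inj₁ (k , 3≤k , s≤s⁻¹ k<14 , iso)))))))))))))
  ... | inj₂ (c , refl) = ⊥-elim (light (f13 c))
  listed-F 1 4 k _ _ 4≤k light iso with below 8 k
  ... | inj₁ k<8        = inj₂ (inj₂ (inj₂ (inj₂ (inj₂ (inj₂ (inj₂ (inj₂ (inj₂ (inj₂ (inj₂ (inj₂ (inj₂ (inj₁ (k , 4≤k , s≤s⁻¹ k<8 , iso))))))))))))))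
  ... | inj₂ (c , refl) = ⊥-elim (light (f14 0 c))
  listed-F 1 5 k _ _ 5≤k light iso with below 6 k
  ... | inj₁ k<6        = inj₂ (inj₂ (inj₂ (inj₂ (inj₂ (inj₂ (inj₂ (inj₂ (inj₂ (inj₂ (inj₂ (inj₂ (inj₂ (inj₂ (inj₁ (subst (λ k → H ≅ Fhg 1 5 k) (≤-antisym (s≤s⁻¹ k<6) 5≤k) iso)))))))))))))))
  ... | inj₂ (c , refl) = ⊥-elim (light (f15 c))
  listed-F 1 (suc (suc (suc (suc (suc (suc b)))))) k _ _ j≤k light iso with ≤⇒+ j≤k
  ... | c , refl = ⊥-elim (light (f16 b (b + c)))
  listed-F 2 2 k _ _ 2≤k light iso with below 7 k
  ... | inj₁ k<7        = inj₂ (inj₂ (inj₂ (inj₂ (inj₂ (inj₂ (inj₂ (inj₂ (inj₂ (inj₂ (inj₂ (inj₁ (k , 2≤k , s≤s⁻¹ k<7 , iso))))))))))))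
  ... | inj₂ (c , refl) = ⊥-elim (light (f22 c))
  listed-F 2 3 k _ _ 3≤k light iso with below 4 k
  ... | inj₁ k<4        = inj₂ (inj₂ (inj₂ (inj₂ (inj₂ (inj₂ (inj₂ (inj₂ (inj₂ (inj₂ (inj₁ (subst (λ k → H ≅ Fhg 2 3 k) (≤-antisym (s≤s⁻¹ k<4) 3≤k) iso)))))))))))
  ... | inj₂ (c , refl) = ⊥-elim (light (f23 c))
  listed-F 2 (suc (suc (suc (suc b)))) k _ _ j≤k light iso with ≤⇒+ j≤k
  ... | c , refl = ⊥-elim (light (f24 b (b + c)))
  listed-F 2 1 k _ (s≤s ()) _ light iso
  listed-F (suc (suc (suc a))) j k _ i≤j j≤k light iso with ≤⇒+ i≤j | ≤⇒+ (≤-trans i≤j j≤k)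
  ... | b , refl | c , refl = ⊥-elim (light (f33 a (a + b) (a + c)))

  private
    listed-G13 : ∀ k → (∀ c → k ≢ 6 + c) → H ≅ Ghg 1 1 k 1 3 → Listed H
    listed-G13 k h iso with below 6 k
    ... | inj₁ k<6 = inj₂ (inj₂ (inj₂ (inj₂ (inj₂ (inj₂ (inj₂ (inj₂ (inj₂ (inj₂ (inj₂ (inj₂ (inj₂ (inj₂ (inj₂ (k , s≤s⁻¹ k<6 , iso)))))))))))))))
    ... | inj₂ (c , e) = ⊥-elim (h c e)

    listed-G11 : ∀ k → H ≅ Ghg 1 1 k 1 1 → Listed H
    listed-G11 k iso = inj₂ (inj₂ (inj₂ (inj₂ (inj₁ (6 + k , m≤m+n 6 k , iso)))))

    listed-G12 : ∀ k → H ≅ Ghg 1 1 k 1 2 → Listed H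
    listed-G12 k iso = inj₂ (inj₂ (inj₂ (inj₂ (inj₂ (inj₁ (7 + k , m≤m+n 7 k , iso))))))

  -- The end with two pendant edges weighs like a path of length 8 + k, so the bounds for F apply;
  -- the threshold 14 of `f13` becomes k = 6.
  listed-G : ∀ k i j → 1 ≤ i → i ≤ j → ¬ EdgeHeavy i j (8 + k) → H ≅ Ghg 1 1 k i j → Listed H
  listed-G k 1 1 _ _ light iso = listed-G11 k iso
  listed-G k 1 2 _ _ light iso = listed-G12 k iso
  listed-G k 1 3 _ _ light iso = listed-G13 k (λ { c refl → light (f13 c) }) iso
  listed-G k 1 (suc (suc (suc (suc b)))) _ _ light iso = ⊥-elim (light (f14 b k))
  listed-G k (suc (suc a)) (suc (suc b)) _ _ light iso = ⊥-elim (light (f228 a b k))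
  listed-G k (suc (suc a)) 1 _ (s≤s ()) light iso

  listed-fork : ∀ k q → 1 ≤ q → ¬ ForkHeavy k q → H ≅ Ghg 1 1 k 1 q → Listed H
  listed-fork k 1 _ light iso = listed-G11 k iso
  listed-fork k 2 _ light iso = listed-G12 k iso
  listed-fork k 3 _ light iso = listed-G13 k (λ { c refl → light (g3 c) }) iso
  listed-fork k (suc (suc (suc (suc b)))) _ light iso = ⊥-elim (light (g4 k b))

sort₃ : ∀ {G : Set} (P : ℕ → ℕ → ℕ → Set) → (∀ {i j k} → P i j k → P j i k) → (∀ {i j k} → P i j k → P i k j) →
        (∀ {i j k} → i ≤ j → j ≤ k → P i j k → G) → ∀ {i j k} → P i j k → G
sort₃ P s t f {i} {j} {k} h with ≤-total i j | ≤-total j k | ≤-total i k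
... | inj₁ i≤j | inj₁ j≤k | _        = f i≤j j≤k h
... | inj₁ i≤j | inj₂ k≤j | inj₁ i≤k = f i≤k k≤j (t h)
... | inj₁ i≤j | inj₂ k≤j | inj₂ k≤i = f k≤i i≤j (s (t h))
... | inj₂ j≤i | _        | inj₁ i≤k = f j≤i i≤k (s h)
... | inj₂ j≤i | inj₁ j≤k | inj₂ k≤i = f j≤k k≤i (t (s h))
... | inj₂ j≤i | inj₂ k≤j | inj₂ k≤i = f k≤j j≤i (s (t (s h)))

-- Classification around a branching vertex or edge.

module Classification (H : Hypergraph3) (small : SpectralRadius<ρ₃ H)
                      (covered : ∀ v → ∃[ i ] (v ∈₃ lookup (E H) i)) where

  open Shapes H small public
  open Families H covered

  -- t is a path of k edges from v to x followed by an edge i = {x, y, z} with P and Q hanging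
  -- at y and z.  The last four arguments bound the share of t from below, the last two
  -- of them whatever P and Q are.
  data Fork {v} (t : Arms v) : Set where
    fork-at : ∀ {x y z} {P : Arms y} {Q : Arms z} k (s : Seg v x k) i → Inc i x y z → NonEmpty P → NonEmpty Q →
      (Thin t → Thin P × Thin Q) →
      (∀ {h} → h ∈ edges t → h ∈ segE s ⊎ h ≡ i ⊎ h ∈ edges P ⊎ h ∈ edges Q) →
      size t ≡ k + (1 + (size P + size Q)) →
      (∀ {p₁ g₁ p₂ g₂} → 0 < g₁ → 0 < g₂ → 4 * (g₁ * g₂) ≤ 2 * ((p₁ + g₁) * (p₂ + g₂)) →
        Wt P p₁ g₁ → Wt Q p₂ g₂ → Wt t 1 1) →
      (∀ {p₁ g₁ p₂ g₂} → 0 < g₁ → 0 < g₂ → (10 + k) * (4 * (g₁ * g₂)) ≤ (18 + (k + k)) * ((p₁ + g₁) * (p₂ + g₂)) →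
        Wt P p₁ g₁ → Wt Q p₂ g₂ → Wt t 10 8) →
      Wt t (8 + k) (2 + (8 + k)) → Wt t 4 5 → Fork t

  -- Two single edges at the other vertices of an edge make 4/9 its share, so 5/9 = 10/18 is the
  -- critical share at the third vertex. Traced back along the `k` edges of the run, this demands
  -- (10 + k) / (18 + 2 k) at the fork.
  run-fork : ∀ {v x y z k i e} {t : Arms v} {P : Arms y} {Q : Arms z} →
             Run t (arm {x} i y z e P Q []) k → NonEmpty P → NonEmpty Q → Fork t
  run-fork {k = k} {i} {e} {t} {P} {Q} r p q = fork-at k (run-seg r) i e p q
    (λ h → thins (run-thin r h)) cover
    (trans (run-size r) (cong (λ m → k + suc m) (trans (length-++ (edges P)) (cong (size P +_) (cong length (++-identityʳ (edges Q)))))))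
    (λ {p₁} {g₁} {p₂} {g₂} g₁>0 g₂>0 h w₁ w₂ → run-half r (wt-arm 1 1 g₁>0 g₂>0
      (subst (_≤ 2 * ((p₁ + g₁) * (p₂ + g₂))) (sym (*-identityˡ (4 * (g₁ * g₂)))) h) w₁ w₂))
    (λ {p₁} {g₁} {p₂} {g₂} g₁>0 g₂>0 h w₁ w₂ → run-above 8 r (wt-arm (2 + (k + 8)) (k + 8) g₁>0 g₂>0
      (subst₂ (λ a b → a * (4 * (g₁ * g₂)) ≤ b * ((p₁ + g₁) * (p₂ + g₂))) (e₁ k) (e₂ k) h) w₁ w₂))
    (subst (λ m → Wt t m (2 + m)) (+-comm k 8) (run-below 8 r (wt-fork p q)))
    (wt-forked r p q)
    where
    e₁ : ∀ k → 10 + k ≡ 2 + (k + 8)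
    e₁ = solve-∀
    e₂ : ∀ k → 18 + (k + k) ≡ 2 + (k + 8) + (k + 8)
    e₂ = solve-∀
    thins : Thin (arm i _ _ e P Q []) → Thin P × Thin Q
    thins (thin h₁ h₂) = h₁ , h₂
    cover : ∀ {h} → h ∈ edges t → _
    cover m with run-edges r m
    ... | inj₁ m₁          = inj₁ m₁
    ... | inj₂ (here refl) = inj₂ (inj₁ refl)
    ... | inj₂ (there m₁) with ∈-++⁻ (edges P) m₁
    ...   | inj₁ m₂ = inj₂ (inj₂ (inj₁ m₂))
    ...   | inj₂ m₂ = inj₂ (inj₂ (inj₂ (subst (_ ∈_) (++-identityʳ (edges Q)) m₂)))

  PathArm : ∀ {v} → Arms v → Set
  PathArm t = ∃[ x ] ∃[ j ] (0 < j × Run t ([] {x}) j)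

  kind : ∀ {v} {t : Arms v} → NonEmpty t → PathArm t ⊎ Fork t ⊎ Wt t 1 1
  kind {t = t} p with shape t
  ... | path r     = inj₁ (_ , _ , run-nonEmpty r p , r)
  ... | fork r q s = inj₂ (inj₁ (run-fork r q s))
  ... | bush r q   = inj₂ (inj₂ (run-half r (wt-bush q)))

  thin-kind : ∀ {v} {t : Arms v} → NonEmpty t → Thin t → PathArm t ⊎ Fork t
  thin-kind {t = t} p h with shape t
  ... | path r     = inj₁ (_ , _ , run-nonEmpty r p , r)
  ... | fork r q s = inj₂ (run-fork r q s)
  ... | bush r q   with run-thin r h
  thin-kind p h | bush r () | thin _ _

  path-edges : ∀ {v x j h} {t : Arms v} (r : Run t ([] {x}) j) → h ∈ edges t → h ∈ segE (run-seg r)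
  path-edges r m with run-edges r m
  ... | inj₁ m₁ = m₁

  path-size : ∀ {v x j} {t : Arms v} → Run t ([] {x}) j → size t ≡ j
  path-size {j = j} r = trans (run-size r) (+-identityʳ j)

  -- Three groups of edges at one vertex. The inequality refuted by `light` is w₁ + w₂ + w₃ ≥ 1 with
  -- denominators cleared.
  record Tripod {v} (X Y Z : Arms v) : Set where
    field
      neX : NonEmpty X
      neY : NonEmpty Y
      neZ : NonEmpty Z
      light : ∀ {p₁ g₁ p₂ g₂ p₃ g₃} → 0 < p₁ → 0 < p₂ → 0 < p₃ → Wt X p₁ g₁ → Wt Y p₂ g₂ → Wt Z p₃ g₃ →
        ¬ ((p₁ + g₁) * ((p₂ + g₂) * (p₃ + g₃)) ≤
           p₁ * ((p₂ + g₂) * (p₃ + g₃)) + (p₂ * ((p₁ + g₁) * (p₃ + g₃)) + p₃ * ((p₁ + g₁) * (p₂ + g₂))))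
      cover : ∀ h → h ∈ edges X ⊎ h ∈ edges Y ⊎ h ∈ edges Z
      count : n H ≡ 1 + 2 * (size X + size Y + size Z)

  swap-head : ∀ {P Q R : Set} → P ⊎ Q ⊎ R → Q ⊎ P ⊎ R
  swap-head (inj₁ p)        = inj₂ (inj₁ p)
  swap-head (inj₂ (inj₁ q)) = inj₁ q
  swap-head (inj₂ (inj₂ r)) = inj₂ (inj₂ r)

  swap-tail : ∀ {P Q R : Set} → P ⊎ Q ⊎ R → P ⊎ R ⊎ Q
  swap-tail (inj₁ p)        = inj₁ p
  swap-tail (inj₂ (inj₁ q)) = inj₂ (inj₂ q)
  swap-tail (inj₂ (inj₂ r)) = inj₂ (inj₁ r)

  private
    rhs₁₂ : ∀ p₁ p₂ p₃ d₁ d₂ d₃ → p₂ * (d₁ * d₃) + (p₁ * (d₂ * d₃) + p₃ * (d₂ * d₁)) ≡ p₁ * (d₂ * d₃) + (p₂ * (d₁ * d₃) + p₃ * (d₁ * d₂))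
    rhs₁₂ = solve-∀
    rhs₂₃ : ∀ p₁ p₂ p₃ d₁ d₂ d₃ → p₁ * (d₃ * d₂) + (p₃ * (d₁ * d₂) + p₂ * (d₁ * d₃)) ≡ p₁ * (d₂ * d₃) + (p₂ * (d₁ * d₃) + p₃ * (d₁ * d₂))
    rhs₂₃ = solve-∀
    lhs₁₂ : ∀ d₁ d₂ d₃ → d₂ * (d₁ * d₃) ≡ d₁ * (d₂ * d₃)
    lhs₁₂ = solve-∀
    lhs₂₃ : ∀ d₁ d₂ d₃ → d₁ * (d₃ * d₂) ≡ d₁ * (d₂ * d₃)
    lhs₂₃ = solve-∀
    sum₁₂ : ∀ x y z → 1 + 2 * (x + y + z) ≡ 1 + 2 * (y + x + z)
    sum₁₂ = solve-∀
    sum₂₃ : ∀ x y z → 1 + 2 * (x + y + z) ≡ 1 + 2 * (x + z + y)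
    sum₂₃ = solve-∀

  star₁₂ : ∀ {v} {X Y Z : Arms v} → Tripod X Y Z → Tripod Y X Z
  star₁₂ {X = X} {Y} {Z} S = record
    { neX = neY ; neY = neX ; neZ = neZ
    ; light = λ {p₁} {g₁} {p₂} {g₂} {p₃} {g₃} a b c x y z h → light b a c y x z
        (subst₂ _≤_ (lhs₁₂ (p₂ + g₂) (p₁ + g₁) (p₃ + g₃)) (rhs₁₂ p₂ p₁ p₃ (p₂ + g₂) (p₁ + g₁) (p₃ + g₃)) h)
    ; cover = swap-head ∘ cover ; count = trans count (sum₁₂ (size X) (size Y) (size Z)) }
    where open Tripod S

  star₂₃ : ∀ {v} {X Y Z : Arms v} → Tripod X Y Z → Tripod X Z Y
  star₂₃ {X = X} {Y} {Z} S = record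
    { neX = neX ; neY = neZ ; neZ = neY
    ; light = λ {p₁} {g₁} {p₂} {g₂} {p₃} {g₃} a b c x y z h → light a c b x z y
        (subst₂ _≤_ (lhs₂₃ (p₁ + g₁) (p₃ + g₃) (p₂ + g₂)) (rhs₂₃ p₁ p₃ p₂ (p₁ + g₁) (p₃ + g₃) (p₂ + g₂)) h)
    ; cover = swap-tail ∘ cover ; count = trans count (sum₂₃ (size X) (size Y) (size Z)) }
    where open Tripod S

  record StarOfPaths (i j k : ℕ) : Set where
    field
      {v x y z} : V
      p : Seg v x i
      q : Seg v y j
      r : Seg v z k
      0<i : 0 < i
      0<j : 0 < j
      0<k : 0 < k
      light : ¬ VertexHeavy i j k
      cover : ∀ h → h ∈ segE p ⊎ h ∈ segE q ⊎ h ∈ segE r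
      count : n H ≡ 1 + 2 * (i + j + k)

  star-of-paths : ∀ {i j k} → StarOfPaths i j k → Listed H
  star-of-paths = sort₃ StarOfPaths
    (λ {i} {j} {k} S → let open StarOfPaths S in record
      { p = q ; q = p ; r = r ; 0<i = 0<j ; 0<j = 0<i ; 0<k = 0<k
      ; light = λ h → light (subst₂ _≤_ (lhs₁₂ (i + (2 + i)) (j + (2 + j)) (k + (2 + k))) (rhs₁₂ i j k (i + (2 + i)) (j + (2 + j)) (k + (2 + k))) h)
      ; cover = swap-head ∘ cover ; count = trans count (sum₁₂ i j k) })
    (λ {i} {j} {k} S → let open StarOfPaths S in record
      { p = p ; q = r ; r = q ; 0<i = 0<i ; 0<j = 0<k ; 0<k = 0<j
      ; light = λ h → light (subst₂ _≤_ (lhs₂₃ (i + (2 + i)) (j + (2 + j)) (k + (2 + k))) (rhs₂₃ i j k (i + (2 + i)) (j + (2 + j)) (k + (2 + k))) h)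
      ; cover = swap-tail ∘ cover ; count = trans count (sum₂₃ i j k) })
    (λ i≤j j≤k S → let open StarOfPaths S in
      listed-E {H} _ _ _ 0<i i≤j j≤k light (≅-E p q r count cover))

  -- The sum 1/2 + 1/4 + 1/4 is already 1.
  star-half : ∀ {v} {X Y Z : Arms v} → Tripod X Y Z → ¬ Wt X 1 1
  star-half S w = light (s≤s z≤n) (s≤s z≤n) (s≤s z≤n) w (wt-quarter neY) (wt-quarter neZ) ≤-refl
    where open Tripod S

  private
    arrange : ∀ {h i e₀ e₂ e₃ e₄ : I} {xs ss} → h ∈ xs ⊎ h ∈ e₀ ∷ [] ⊎ h ∈ e₃ ∷ [] →
              (h ∈ xs → h ∈ ss ⊎ h ≡ i ⊎ h ∈ e₄ ∷ [] ⊎ h ∈ e₂ ∷ []) →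
              h ≡ e₀ ⊎ h ∈ ss ⊎ h ≡ i ⊎ h ≡ e₂ ⊎ h ≡ e₃ ⊎ h ≡ e₄
    arrange (inj₂ (inj₁ (here p))) f = inj₁ p
    arrange (inj₂ (inj₂ (here p))) f = inj₂ (inj₂ (inj₂ (inj₂ (inj₁ p))))
    arrange (inj₁ m) f with f m
    ... | inj₁ m₁                     = inj₂ (inj₁ m₁)
    ... | inj₂ (inj₁ p)               = inj₂ (inj₂ (inj₁ p))
    ... | inj₂ (inj₂ (inj₁ (here p))) = inj₂ (inj₂ (inj₂ (inj₂ (inj₂ p))))
    ... | inj₂ (inj₂ (inj₂ (here p))) = inj₂ (inj₂ (inj₂ (inj₁ p)))

  -- If P or Q is more than a single edge, the fork has share 1 / (4 * 2/3 * 3/4) = 1/2, which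
  -- `star-half` forbids. If Y or Z is, then 4/9 + 1/3 + 1/4 = 37/36. So all four are single edges,
  -- and this is BD: one of Y, Z starts the long path and one of P, Q ends it.
  star-fork : ∀ {v} {X Y Z : Arms v} → Tripod X Y Z → Fork X → Listed H
  star-fork S (fork-at k s i e neP neQ _ coverX sizeX half _ _ w₄₉) with single? neP | single? neQ
  ... | inj₂ w | _      = ⊥-elim (star-half S (half (s≤s z≤n) (s≤s z≤n) ≤-refl w (wt-quarter neQ)))
  ... | inj₁ _ | inj₂ w = ⊥-elim (star-half S (half (s≤s z≤n) (s≤s z≤n) ≤-refl (wt-quarter neP) w))
  ... | inj₁ (single {e = e₄}) | inj₁ (single {e = e₂}) with single? (Tripod.neY S) | single? (Tripod.neZ S)
  ...   | inj₂ w | _      = ⊥-elim (Tripod.light S (s≤s z≤n) (s≤s z≤n) (s≤s z≤n) w₄₉ w (wt-quarter (Tripod.neZ S)) (≤-slack 3 refl))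
  ...   | inj₁ _ | inj₂ w = ⊥-elim (Tripod.light S (s≤s z≤n) (s≤s z≤n) (s≤s z≤n) w₄₉ (wt-quarter (Tripod.neY S)) w (≤-slack 3 refl))
  ...   | inj₁ (single {e = e₀}) | inj₁ (single {e = e₃}) =
    inj₂ (inj₂ (inj₂ (inj₂ (inj₂ (inj₂ (inj₁ (5 + k , m≤m+n 5 k ,
      ≅-BD (SameSet-swap₂₃ (SameSet-swap₁₂ e₀)) s e e₂ e₃ e₄
        (trans (Tripod.count S) (trans (cong (λ m → 1 + 2 * (m + 1 + 1)) sizeX) (arith k))) (λ h → arrange (Tripod.cover S h) coverX))))))))
    where
    arith : ∀ k → 1 + 2 * (k + 3 + 1 + 1) ≡ 1 + 2 * (5 + k)
    arith = solve-∀

  star : ∀ {v} {X Y Z : Arms v} → Tripod X Y Z → Listed H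
  star {v} {X} {Y} {Z} S with kind (Tripod.neX S) | kind (Tripod.neY S) | kind (Tripod.neZ S)
  ... | inj₂ (inj₁ f) | _ | _ = star-fork S f
  ... | inj₂ (inj₂ w) | _ | _ = ⊥-elim (star-half S w)
  ... | _ | inj₂ (inj₁ f) | _ = star-fork (star₁₂ S) f
  ... | _ | inj₂ (inj₂ w) | _ = ⊥-elim (star-half (star₁₂ S) w)
  ... | _ | _ | inj₂ (inj₁ f) = star-fork (star₁₂ (star₂₃ S)) f
  ... | _ | _ | inj₂ (inj₂ w) = ⊥-elim (star-half (star₁₂ (star₂₃ S)) w)
  ... | inj₁ (_ , i , i>0 , r₁) | inj₁ (_ , j , j>0 , r₂) | inj₁ (_ , k , k>0 , r₃) = star-of-paths record
    { p = run-seg r₁ ; q = run-seg r₂ ; r = run-seg r₃ ; 0<i = i>0 ; 0<j = j>0 ; 0<k = k>0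
    ; light = Tripod.light S i>0 j>0 k>0 (wt-path r₁) (wt-path r₂) (wt-path r₃)
    ; cover = Sum.map (path-edges r₁) (Sum.map (path-edges r₂) (path-edges r₃)) ∘ Tripod.cover S
    ; count = trans (Tripod.count S) (cong₂ (λ l m → 1 + 2 * (l + m)) (cong₂ _+_ (path-size r₁) (path-size r₂)) (path-size r₃)) }

  -- Three arms at the vertices of one edge. The inequality refuted by `light` is 4 (1 - w₁) (1 -
  -- w₂) (1 - w₃) ≤ 1 with denominators cleared.
  record Tri {a b c} (e : I) (X : Arms a) (Y : Arms b) (Z : Arms c) : Set where
    field
      inc : Inc e a b c
      neX : NonEmpty X
      neY : NonEmpty Y
      neZ : NonEmpty Z
      thinX : Thin X
      thinY : Thin Y
      thinZ : Thin Z
      light : ∀ {p₁ g₁ p₂ g₂ p₃ g₃} → 0 < p₁ → 0 < p₂ → 0 < p₃ → 0 < g₁ → 0 < g₂ → 0 < g₃ →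
        Wt X p₁ g₁ → Wt Y p₂ g₂ → Wt Z p₃ g₃ →
        ¬ (4 * (g₁ * (g₂ * g₃)) ≤ (p₁ + g₁) * ((p₂ + g₂) * (p₃ + g₃)))
      cover : ∀ h → h ≡ e ⊎ h ∈ edges X ⊎ h ∈ edges Y ⊎ h ∈ edges Z
      count : n H ≡ 1 + 2 * (1 + (size X + size Y + size Z))

  private
    sum₁₂′ : ∀ x y z → 1 + 2 * (1 + (x + y + z)) ≡ 1 + 2 * (1 + (y + x + z))
    sum₁₂′ = solve-∀
    sum₂₃′ : ∀ x y z → 1 + 2 * (1 + (x + y + z)) ≡ 1 + 2 * (1 + (x + z + y))
    sum₂₃′ = solve-∀

  under : ∀ {P Q R : Set} → (Q → R) → P ⊎ Q → P ⊎ R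
  under f (inj₁ p) = inj₁ p
  under f (inj₂ q) = inj₂ (f q)

  tri₁₂ : ∀ {a b c e} {X : Arms a} {Y : Arms b} {Z : Arms c} → Tri e X Y Z → Tri e Y X Z
  tri₁₂ {X = X} {Y} {Z} T = record
    { inc = SameSet-swap₁₂ inc ; neX = neY ; neY = neX ; neZ = neZ ; thinX = thinY ; thinY = thinX ; thinZ = thinZ
    ; light = λ {p₁} {g₁} {p₂} {g₂} {p₃} {g₃} a b c a′ b′ c′ x y z h → light b a c b′ a′ c′ y x z
        (subst₂ _≤_ (cong (4 *_) (lhs₁₂ g₂ g₁ g₃)) (lhs₁₂ (p₂ + g₂) (p₁ + g₁) (p₃ + g₃)) h)
    ; cover = under swap-head ∘ cover ; count = trans count (sum₁₂′ (size X) (size Y) (size Z)) }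
    where open Tri T

  tri₂₃ : ∀ {a b c e} {X : Arms a} {Y : Arms b} {Z : Arms c} → Tri e X Y Z → Tri e X Z Y
  tri₂₃ {X = X} {Y} {Z} T = record
    { inc = SameSet-swap₂₃ inc ; neX = neX ; neY = neZ ; neZ = neY ; thinX = thinX ; thinY = thinZ ; thinZ = thinY
    ; light = λ {p₁} {g₁} {p₂} {g₂} {p₃} {g₃} a b c a′ b′ c′ x y z h → light a c b a′ c′ b′ x z y
        (subst₂ _≤_ (cong (4 *_) (lhs₂₃ g₁ g₃ g₂)) (lhs₂₃ (p₁ + g₁) (p₃ + g₃) (p₂ + g₂)) h)
    ; cover = under swap-tail ∘ cover ; count = trans count (sum₂₃′ (size X) (size Y) (size Z)) }
    where open Tri T

  record TriOfPaths (i j k : ℕ) : Set where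
    field
      {a b c x y z} : V
      {e} : I
      inc : Inc e a b c
      p : Seg a x i
      q : Seg b y j
      r : Seg c z k
      0<i : 0 < i
      0<j : 0 < j
      0<k : 0 < k
      light : ¬ EdgeHeavy i j k
      cover : ∀ h → h ≡ e ⊎ h ∈ segE p ⊎ h ∈ segE q ⊎ h ∈ segE r
      count : n H ≡ 1 + 2 * (1 + (i + j + k))

  tri-of-paths : ∀ {i j k} → TriOfPaths i j k → Listed H
  tri-of-paths = sort₃ TriOfPaths
    (λ {i} {j} {k} S → let open TriOfPaths S in record
      { inc = SameSet-swap₁₂ inc ; p = q ; q = p ; r = r ; 0<i = 0<j ; 0<j = 0<i ; 0<k = 0<k
      ; light = λ h → light (subst₂ _≤_ (cong (4 *_) (lhs₁₂ (2 + i) (2 + j) (2 + k))) (lhs₁₂ (i + (2 + i)) (j + (2 + j)) (k + (2 + k))) h)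
      ; cover = under swap-head ∘ cover ; count = trans count (sum₁₂′ i j k) })
    (λ {i} {j} {k} S → let open TriOfPaths S in record
      { inc = SameSet-swap₂₃ inc ; p = p ; q = r ; r = q ; 0<i = 0<i ; 0<j = 0<k ; 0<k = 0<j
      ; light = λ h → light (subst₂ _≤_ (cong (4 *_) (lhs₂₃ (2 + i) (2 + j) (2 + k))) (lhs₂₃ (i + (2 + i)) (j + (2 + j)) (k + (2 + k))) h)
      ; cover = under swap-tail ∘ cover ; count = trans count (sum₂₃′ i j k) })
    (λ i≤j j≤k S → let open TriOfPaths S in
      listed-F {H} _ _ _ 0<i i≤j j≤k light (≅-F inc p q r count cover))

  reverse : ∀ {v x k} (s : Seg v x k) → Σ (Seg x v k) λ r → ∀ {h} → h ∈ segE s → h ∈ segE r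
  reverse {v} {x} {k} s with reverse-onto s end
  ... | r , sub = subst (λ m → Σ (Seg x v m) λ r → ∀ {h} → h ∈ segE s → h ∈ segE r) (+-identityʳ k) (r , sub ∘ inj₁)

  private
    arrange₁ : ∀ {h i e e₁ e₂ : I} {xs ys zs ss rs xs′ ys′} → h ≡ e ⊎ h ∈ xs ⊎ h ∈ ys ⊎ h ∈ zs →
               (h ∈ zs → h ∈ ss ⊎ h ≡ i ⊎ h ∈ e₁ ∷ [] ⊎ h ∈ e₂ ∷ []) → (h ∈ ss → h ∈ rs) → (h ∈ xs → h ∈ xs′) → (h ∈ ys → h ∈ ys′) →
               h ≡ i ⊎ h ∈ rs ⊎ h ≡ e ⊎ h ∈ e₁ ∷ [] ⊎ h ∈ e₂ ∷ [] ⊎ h ∈ xs′ ⊎ h ∈ ys′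
    arrange₁ (inj₁ p) f g k l                = inj₂ (inj₂ (inj₁ p))
    arrange₁ (inj₂ (inj₁ m)) f g k l         = inj₂ (inj₂ (inj₂ (inj₂ (inj₂ (inj₁ (k m))))))
    arrange₁ (inj₂ (inj₂ (inj₁ m))) f g k l  = inj₂ (inj₂ (inj₂ (inj₂ (inj₂ (inj₂ (l m))))))
    arrange₁ (inj₂ (inj₂ (inj₂ m))) f g k l with f m
    ... | inj₁ m₁               = inj₂ (inj₁ (g m₁))
    ... | inj₂ (inj₁ p)         = inj₁ p
    ... | inj₂ (inj₂ (inj₁ m₁)) = inj₂ (inj₂ (inj₂ (inj₁ m₁)))
    ... | inj₂ (inj₂ (inj₂ m₁)) = inj₂ (inj₂ (inj₂ (inj₂ (inj₁ m₁))))

    arrange₂ : ∀ {h i e e₁ e₂ e₃ : I} {zs ss qs rs} → h ≡ e ⊎ h ∈ e₁ ∷ [] ⊎ h ∈ e₂ ∷ [] ⊎ h ∈ zs →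
               (h ∈ zs → h ∈ ss ⊎ h ≡ i ⊎ h ∈ e₃ ∷ [] ⊎ h ∈ qs) → (h ∈ qs → h ∈ rs) →
               h ≡ e ⊎ h ∈ ss ⊎ h ≡ i ⊎ h ∈ e₁ ∷ [] ⊎ h ∈ e₂ ∷ [] ⊎ h ∈ e₃ ∷ [] ⊎ h ∈ rs
    arrange₂ (inj₁ p) f g               = inj₁ p
    arrange₂ (inj₂ (inj₁ m)) f g        = inj₂ (inj₂ (inj₂ (inj₁ m)))
    arrange₂ (inj₂ (inj₂ (inj₁ m))) f g = inj₂ (inj₂ (inj₂ (inj₂ (inj₁ m))))
    arrange₂ (inj₂ (inj₂ (inj₂ m))) f g with f m
    ... | inj₁ m₁               = inj₂ (inj₁ m₁)
    ... | inj₂ (inj₁ p)         = inj₂ (inj₂ (inj₁ p))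
    ... | inj₂ (inj₂ (inj₁ m₁)) = inj₂ (inj₂ (inj₂ (inj₂ (inj₂ (inj₁ m₁)))))
    ... | inj₂ (inj₂ (inj₂ m₁)) = inj₂ (inj₂ (inj₂ (inj₂ (inj₂ (inj₂ (g m₁))))))

    1≤ : ∀ {m} → 0 < suc m
    1≤ = s≤s z≤n

  -- If neither P nor Q is single, the fork edge has share 1 / (4 * 2/3 * 2/3) = 9/16, above the
  -- critical 5/9. If both are single, X and Y must be paths, since a second fork would give 4 * 3/4
  -- * 5/9 * 5/9 = 25/27 < 1.
  tri-fork : ∀ {a b c e} {X : Arms a} {Y : Arms b} {Z : Arms c} → Tri e X Y Z → Fork Z → Listed H
  -- Two pendant edges beyond i, so Z weighs like a path of length 8 + k.
  tri-fork-narrow : ∀ {a b c d e i k y z e₁ e₂ c₁ c₂ c₃ c₄} {X : Arms a} {Y : Arms b} {Z : Arms c} → Tri e X Y Z →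
    (h₁ : PathArm X) (h₂ : PathArm Y) → proj₁ (proj₂ h₁) ≤ proj₁ (proj₂ h₂) →
    (s : Seg c d k) → Inc i d y z → (q₁ : Inc e₁ y c₁ c₂) (q₂ : Inc e₂ z c₃ c₄) →
    (∀ {h} → h ∈ edges Z → h ∈ segE s ⊎ h ≡ i ⊎ h ∈ e₁ ∷ [] ⊎ h ∈ e₂ ∷ []) → size Z ≡ k + 3 →
    Wt Z (8 + k) (2 + (8 + k)) → Listed H
  -- A pendant edge and a longer arm Q beyond i, so X and Y must be single edges.
  tri-fork-wide : ∀ {a b c d e k i y z e₃ c₅ c₆} {X : Arms a} {Y : Arms b} {Z : Arms c} {Q : Arms z} → Tri e X Y Z →
    (s : Seg c d k) → Inc i d y z → (q₃ : Inc e₃ y c₅ c₆) → NonEmpty Q → Thin Q →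
    (∀ {h} → h ∈ edges Z → h ∈ segE s ⊎ h ≡ i ⊎ h ∈ e₃ ∷ [] ⊎ h ∈ edges Q) → size Z ≡ k + (1 + (1 + size Q)) →
    Wt Z 1 1 →
    (∀ {p g} → 0 < g → (10 + k) * (4 * (3 * g)) ≤ (18 + (k + k)) * (4 * (p + g)) → Wt Q p g → Wt Z 10 8) → Listed H

  tri-fork-narrow {k = k} T (_ , i , 0<i , r₁) (_ , j , 0<j , r₂) i≤j s inc q₁ q₂ coverZ sizeZ eight =
    listed-G {H} k i j 0<i i≤j (Tri.light T 0<i 0<j 1≤ 1≤ 1≤ 1≤ (wt-path r₁) (wt-path r₂) eight)
    -- `listed-G` expects the two single pendant edges at the front, so the spine is read from the
    -- fork back to `e` and `s` is reversed.
    (≅-G (SameSet-swap₂₃ (SameSet-swap₁₂ inc)) (proj₁ (reverse s)) (SameSet-swap₁₂ (SameSet-swap₂₃ (Tri.inc T)))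
      (step _ _ _ q₁ end) (step _ _ _ q₂ end) (run-seg r₁) (run-seg r₂)
      (trans (Tri.count T) (trans (cong₂ (λ l m → 1 + 2 * (1 + (l + m))) (cong₂ _+_ (path-size r₁) (path-size r₂)) sizeZ) (arith i j k)))
      (λ h → arrange₁ (Tri.cover T h) coverZ (proj₂ (reverse s)) (path-edges r₁) (path-edges r₂)))
    where
    arith : ∀ i j k → 1 + 2 * (1 + (i + j + (k + 3))) ≡ 1 + 2 * (2 + k + (1 + 1 + i + j))
    arith = solve-∀

  tri-fork-wide {k = k} {Z = Z} T s inc q₃ neQ thinQ coverZ sizeZ half above with single? (Tri.neX T) | single? (Tri.neY T) | thin-kind neQ thinQ
  -- Shares 1/3, 1/4 and 1/2 meet the bound exactly: 4 * 2/3 * 3/4 * 1/2 = 1.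
  ... | inj₂ w | _ | _ = ⊥-elim (Tri.light T 1≤ 1≤ 1≤ 1≤ 1≤ 1≤ w (wt-quarter (Tri.neY T)) half ≤-refl)
  ... | _ | inj₂ w | _ = ⊥-elim (Tri.light T 1≤ 1≤ 1≤ 1≤ 1≤ 1≤ (wt-quarter (Tri.neX T)) w half ≤-refl)
  -- Were Q forked as well, its 4/9 beside the pendant edge would give edge `i` the share 1 / (4 *
  -- 3/4 * 5/9) = 3/5, above what `above` demands.
  ... | _ | _ | inj₂ (fork-at _ _ _ _ _ _ _ _ _ _ _ _ w) =
    ⊥-elim (Tri.light T 1≤ 1≤ 1≤ 1≤ 1≤ 1≤ (wt-quarter (Tri.neX T)) (wt-quarter (Tri.neY T))
      (above 1≤ (≤-slack (48 + 12 * k) (arith k)) w) ≤-refl)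
    where
    arith : ∀ k → (18 + (k + k)) * 36 ≡ (10 + k) * 60 + (48 + 12 * k)
    arith = solve-∀
  ... | inj₁ (single {e = e₁}) | inj₁ (single {e = e₂}) | inj₁ (_ , q , 0<q , r) = listed-fork {H} k q 0<q
    (λ h → Tri.light T 1≤ 1≤ 1≤ 1≤ 1≤ 1≤ (wt-quarter (Tri.neX T)) (wt-quarter (Tri.neY T)) (above 1≤ h (wt-path r)) ≤-refl)
    (≅-G (Tri.inc T) s inc (step _ _ _ e₁ end) (step _ _ _ e₂ end) (step _ _ _ q₃ end) (run-seg r)
      (trans (Tri.count T) (trans (cong (λ m → 1 + 2 * (1 + (1 + 1 + m))) (trans sizeZ (cong (λ m → k + (1 + (1 + m))) (path-size r)))) (arith k q)))
      (λ h → arrange₂ (Tri.cover T h) coverZ (path-edges r)))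
    where
    arith : ∀ k q → 1 + 2 * (1 + (1 + 1 + (k + (1 + (1 + q))))) ≡ 1 + 2 * (2 + k + (1 + 1 + 1 + q))
    arith = solve-∀

  tri-fork T (fork-at k s i inc neP neQ thins coverZ sizeZ half above eight low) with single? neP | single? neQ
  ... | inj₂ w₁ | inj₂ w₂ = ⊥-elim (Tri.light T 1≤ 1≤ 1≤ 1≤ 1≤ 1≤ (wt-quarter (Tri.neX T)) (wt-quarter (Tri.neY T))
      (above 1≤ 1≤ (≤-slack (2 + 2 * k) (arith k)) w₁ w₂) ≤-refl)
    where
    arith : ∀ k → (18 + (k + k)) * 9 ≡ (10 + k) * 16 + (2 + 2 * k)
    arith = solve-∀
  ... | inj₁ (single {e = e₃}) | inj₂ w = tri-fork-wide T s inc e₃ neQ (proj₂ (thins (Tri.thinZ T))) coverZ sizeZ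
    (half 1≤ 1≤ ≤-refl (wt-quarter neP) w) (λ 0<g h w₂ → above 1≤ 0<g h (wt-quarter neP) w₂)
  tri-fork T (fork-at k s i inc neP neQ thins coverZ sizeZ half above eight low) | inj₂ w | inj₁ (single {e = e₃}) =
    tri-fork-wide T s (SameSet-swap₂₃ inc) e₃ neP (proj₁ (thins (Tri.thinZ T))) (under swap-tail ∘ coverZ)
      (trans sizeZ (cong (λ m → k + suc m) (+-comm _ 1)))
      (half 1≤ 1≤ ≤-refl w (wt-quarter neQ))
      (λ {p} {g} 0<g h w₂ → above 0<g 1≤
        (subst₂ _≤_ (cong (λ m → (10 + k) * (4 * m)) (*-comm 3 g)) (cong ((18 + (k + k)) *_) (*-comm 4 (p + g))) h) w₂ (wt-quarter neQ))
  tri-fork T (fork-at k s i inc neP neQ thins coverZ sizeZ half above eight low) | inj₁ (single {e = e₁}) | inj₁ (single {e = e₂})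
    with thin-kind (Tri.neX T) (Tri.thinX T) | thin-kind (Tri.neY T) (Tri.thinY T)
  ... | inj₂ (fork-at _ _ _ _ _ _ _ _ _ _ _ _ w) | _ =
    ⊥-elim (Tri.light T 1≤ 1≤ 1≤ 1≤ 1≤ 1≤ w (wt-quarter (Tri.neY T)) low (≤-slack 24 refl))
  ... | _ | inj₂ (fork-at _ _ _ _ _ _ _ _ _ _ _ _ w) =
    ⊥-elim (Tri.light T 1≤ 1≤ 1≤ 1≤ 1≤ 1≤ (wt-quarter (Tri.neX T)) w low (≤-slack 24 refl))
  ... | inj₁ h₁ | inj₁ h₂ with ≤-total (proj₁ (proj₂ h₁)) (proj₁ (proj₂ h₂))
  ...   | inj₁ i≤j = tri-fork-narrow T h₁ h₂ i≤j s inc e₁ e₂ coverZ sizeZ eight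
  ...   | inj₂ j≤i = tri-fork-narrow (tri₁₂ T) h₂ h₁ j≤i s inc e₁ e₂ coverZ sizeZ eight

  tri : ∀ {a b c e} {X : Arms a} {Y : Arms b} {Z : Arms c} → Tri e X Y Z → Listed H
  tri T with thin-kind (Tri.neX T) (Tri.thinX T) | thin-kind (Tri.neY T) (Tri.thinY T) | thin-kind (Tri.neZ T) (Tri.thinZ T)
  ... | _ | _ | inj₂ F = tri-fork T F
  ... | _ | inj₂ F | _ = tri-fork (tri₂₃ T) F
  ... | inj₂ F | _ | _ = tri-fork (tri₂₃ (tri₁₂ T)) F
  ... | inj₁ (_ , i , i>0 , r₁) | inj₁ (_ , j , j>0 , r₂) | inj₁ (_ , k , k>0 , r₃) = tri-of-paths record
    { inc = Tri.inc T ; p = run-seg r₁ ; q = run-seg r₂ ; r = run-seg r₃ ; 0<i = i>0 ; 0<j = j>0 ; 0<k = k>0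
    ; light = Tri.light T i>0 j>0 k>0 1≤ 1≤ 1≤ (wt-path r₁) (wt-path r₂) (wt-path r₃)
    ; cover = under (Sum.map (path-edges r₁) (Sum.map (path-edges r₂) (path-edges r₃))) ∘ Tri.cover T
    ; count = trans (Tri.count T) (cong₂ (λ l m → 1 + 2 * (1 + (l + m))) (cong₂ _+_ (path-size r₁) (path-size r₂)) (path-size r₃)) }

  -- Lightness of a rooted tree, read at a vertex and at an edge.

  -- If w₂ + w₃ ≥ 1, the last two groups already pay for the root. Otherwise w₂ + w₃ is a proper
  -- fraction, `d ∸ s` is a genuine difference, and the sum can be formed in two steps.
  tripod-light : ∀ {v i₁ a₁ b₁ e₁ i₂ a₂ b₂ e₂} {X₁ : Arms a₁} {Y₁ : Arms b₁} {X₂ : Arms a₂} {Y₂ : Arms b₂} {Z : Arms v}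
    {p₁ g₁ p₂ g₂ p₃ g₃} → Light (arm i₁ a₁ b₁ e₁ X₁ Y₁ (arm i₂ a₂ b₂ e₂ X₂ Y₂ Z)) →
    0 < p₁ → 0 < p₂ → 0 < p₃ →
    Wt (arm {v} i₁ a₁ b₁ e₁ X₁ Y₁ []) p₁ g₁ → Wt (arm i₂ a₂ b₂ e₂ X₂ Y₂ []) p₂ g₂ → Wt Z p₃ g₃ →
    ¬ ((p₁ + g₁) * ((p₂ + g₂) * (p₃ + g₃)) ≤
       p₁ * ((p₂ + g₂) * (p₃ + g₃)) + (p₂ * ((p₁ + g₁) * (p₃ + g₃)) + p₃ * ((p₁ + g₁) * (p₂ + g₂))))
  tripod-light {p₁ = p₁} {g₁} {p₂} {g₂} {p₃} {g₃} light 0<p₁ 0<p₂ 0<p₃ w₁ w₂ w₃ h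
    with ≤-total ((p₂ + g₂) * (p₃ + g₃)) (p₂ * (p₃ + g₃) + p₃ * (p₂ + g₂))
  ... | inj₁ full = light (s≤s z≤n) (wt-sum 1 0 (pos 0<p₁) (s≤s z≤n) (≤-slack p₁ (e (p₁ + g₁) p₁)) w₁
          (wt-sum 1 0 (pos 0<p₂) (pos 0<p₃) (subst₂ _≤_ (sym (*-identityˡ _)) (sym (*-identityˡ _)) full) w₂ w₃))
    where
    pos : ∀ {p g} → 0 < p → 0 < p + g
    pos {p} {g} h = ≤-trans h (m≤m+n p g)
    e : ∀ d p → 1 * (p * 1 + 1 * d) ≡ 1 * (d * 1) + p
    e = solve-∀
  ... | inj₂ part = light (s≤s z≤n) (wt-sum 1 0 (pos 0<p₁) (subst (0 <_) (sym s+≡d) (0<* (pos 0<p₂) (pos 0<p₃)))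
          (subst₂ _≤_ e₁ e₂ h) w₁ (wt-sum s (d ∸ s) (pos 0<p₂) (pos 0<p₃) (≤-reflexive (trans (*-comm s d) (cong (_* s) (sym s+≡d)))) w₂ w₃))
    where
    d = (p₂ + g₂) * (p₃ + g₃)
    s = p₂ * (p₃ + g₃) + p₃ * (p₂ + g₂)
    s+≡d : s + (d ∸ s) ≡ d
    s+≡d = m+[n∸m]≡n part
    pos : ∀ {p g} → 0 < p → 0 < p + g
    pos {p} {g} h = ≤-trans h (m≤m+n p g)
    e₁ : (p₁ + g₁) * d ≡ 1 * ((p₁ + g₁) * (s + (d ∸ s)))
    e₁ = trans (cong ((p₁ + g₁) *_) (sym s+≡d)) (sym (*-identityˡ _))
    f : ∀ p₁ d₁ p₂ d₂ p₃ d₃ → p₁ * (d₂ * d₃) + (p₂ * (d₁ * d₃) + p₃ * (d₁ * d₂)) ≡ 1 * (p₁ * (d₂ * d₃) + (p₂ * d₃ + p₃ * d₂) * d₁)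
    f = solve-∀
    e₂ : p₁ * d + (p₂ * ((p₁ + g₁) * (p₃ + g₃)) + p₃ * ((p₁ + g₁) * (p₂ + g₂))) ≡ 1 * (p₁ * (s + (d ∸ s)) + s * (p₁ + g₁))
    e₂ = trans (f p₁ (p₁ + g₁) p₂ (p₂ + g₂) p₃ (p₃ + g₃)) (cong (λ m → 1 * (p₁ * m + s * (p₁ + g₁))) (sym s+≡d))

  -- Rooted at `a`, the edge has share 1 / (4 (1 - w₂) (1 - w₃)); together with w₁ this reaches 1
  -- exactly when 4 (1 - w₁) (1 - w₂) (1 - w₃) ≤ 1. The case distinction again keeps the subtraction
  -- genuine.
  edge-light : ∀ {a b c i} {e : Inc i a b c} {X : Arms a} {Y : Arms b} {Z : Arms c} {p₁ g₁ p₂ g₂ p₃ g₃} →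
    Light (arm i b c e Y Z X) → 0 < p₁ → 0 < p₂ → 0 < p₃ → 0 < g₁ → 0 < g₂ → 0 < g₃ →
    Wt X p₁ g₁ → Wt Y p₂ g₂ → Wt Z p₃ g₃ →
    ¬ (4 * (g₁ * (g₂ * g₃)) ≤ (p₁ + g₁) * ((p₂ + g₂) * (p₃ + g₃)))
  edge-light {p₁ = p₁} {g₁} {p₂} {g₂} {p₃} {g₃} light 0<p₁ 0<p₂ 0<p₃ 0<g₁ 0<g₂ 0<g₃ w₁ w₂ w₃ h
    with ≤-total (4 * (g₂ * g₃)) ((p₂ + g₂) * (p₃ + g₃))
  ... | inj₁ full = light (s≤s z≤n) (wt-prefix (s≤s z≤n)
          (wt-arm 1 0 0<g₂ 0<g₃ (subst₂ _≤_ (sym (*-identityˡ _)) (sym (*-identityˡ _)) full) w₂ w₃))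
  ... | inj₂ part = light (s≤s z≤n) (wt-sum 1 0 (subst (0 <_) (sym s+≡d) (0<* {4} (s≤s z≤n) (0<* 0<g₂ 0<g₃))) (≤-trans 0<p₁ (m≤m+n p₁ g₁)) ineq
          (wt-arm s (d ∸ s) 0<g₂ 0<g₃ (≤-reflexive (trans (*-comm s d) (cong (_* s) (sym s+≡d)))) w₂ w₃) w₁)
    where
    d = 4 * (g₂ * g₃)
    s = (p₂ + g₂) * (p₃ + g₃)
    s+≡d : s + (d ∸ s) ≡ d
    s+≡d = m+[n∸m]≡n part
    open ≤-Reasoning
    e₁ : ∀ p g x → 1 * ((4 * x) * (p + g)) ≡ 4 * (g * x) + p * (4 * x)
    e₁ = solve-∀
    e₂ : ∀ d s p x → d * s + p * x ≡ 1 * (s * d + p * x)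
    e₂ = solve-∀
    ineq : 1 * ((s + (d ∸ s)) * (p₁ + g₁)) ≤ 1 * (s * (p₁ + g₁) + p₁ * (s + (d ∸ s)))
    ineq = begin
      1 * ((s + (d ∸ s)) * (p₁ + g₁))              ≡⟨ cong (λ m → 1 * (m * (p₁ + g₁))) s+≡d ⟩
      1 * (d * (p₁ + g₁))                          ≡⟨ e₁ p₁ g₁ (g₂ * g₃) ⟩
      4 * (g₁ * (g₂ * g₃)) + p₁ * d                ≤⟨ +-monoˡ-≤ (p₁ * d) h ⟩
      (p₁ + g₁) * s + p₁ * d                       ≡⟨ e₂ (p₁ + g₁) s p₁ d ⟩
      1 * (s * (p₁ + g₁) + p₁ * d)                 ≡⟨ cong (λ m → 1 * (s * (p₁ + g₁) + p₁ * m)) s+≡d ⟨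
      1 * (s * (p₁ + g₁) + p₁ * (s + (d ∸ s)))     ∎

  -- Case analysis on the spanning hypertree.

  private
    ∈-3 : ∀ {h : I} xs ys {zs} → h ∈ xs ++ (ys ++ zs) → h ∈ xs ⊎ h ∈ ys ⊎ h ∈ zs
    ∈-3 xs ys m with ∈-++⁻ xs m
    ... | inj₁ m₁ = inj₁ m₁
    ... | inj₂ m₁ = inj₂ (∈-++⁻ ys m₁)

    length-3 : ∀ (xs ys zs : List I) → length (xs ++ (ys ++ zs)) ≡ length xs + length ys + length zs
    length-3 xs ys zs = trans (length-++ xs) (trans (cong (length xs +_) (length-++ ys)) (sym (+-assoc (length xs) _ _)))

  three : Three → Listed H
  three (v , i₁ , a₁ , b₁ , e₁ , X₁ , Y₁ , i₂ , a₂ , b₂ , e₂ , X₂ , Y₂ , Z@(arm i a b e X Y R) , _ , sp@(un , cov , cnt)) = go R refl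
    where
    S₁ S₂ : Arms v
    S₁ = arm i₁ a₁ b₁ e₁ X₁ Y₁ []
    S₂ = arm i₂ a₂ b₂ e₂ X₂ Y₂ []
    light : Light (S₁ ⊕ S₂ ⊕ Z)
    light = unique-light small un
    regroup : edges (S₁ ⊕ S₂ ⊕ Z) ↭ edges S₁ ++ (edges S₂ ++ edges Z)
    regroup = ↭-trans (edges-⊕ S₁ (S₂ ⊕ Z)) (++⁺ˡ (edges S₁) (edges-⊕ S₂ Z))
    go : ∀ R′ → R ≡ R′ → Listed H
    go [] _ = star {X = S₁} {S₂} {Z} record
      { neX = nonEmpty ; neY = nonEmpty ; neZ = nonEmpty
      ; light = tripod-light light
      ; cover = λ h → ∈-3 (edges S₁) (edges S₂) (∈-resp-↭ regroup (cov h))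
      ; count = trans cnt (cong (λ m → 1 + 2 * m) (trans (↭-length regroup) (length-3 (edges S₁) (edges S₂) (edges Z)))) }
    -- Degree 4 or more is impossible: the third group then has share 1/2, and 1/4 + 1/4 + 1/2 = 1.
    go (arm _ _ _ _ _ _ _) refl = ⊥-elim (tripod-light {Z = Z} light (s≤s z≤n) (s≤s z≤n) (s≤s z≤n)
      (wt-quarter nonEmpty) (wt-quarter nonEmpty) (wt-bush nonEmpty) ≤-refl)

  tri-of-tree : ∀ {a b c i} {e : Inc i a b c} {X : Arms a} {Y : Arms b} {Z : Arms c} → NonEmpty X → NonEmpty Y → NonEmpty Z →
                Thin X → Thin Y → Thin Z → Spans (arm i b c e Y Z X) → Tri i X Y Z
  tri-of-tree {i = i} {e} {X} {Y} {Z} neX neY neZ tX tY tZ (un , cov , cnt) = record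
    { inc = e ; neX = neX ; neY = neY ; neZ = neZ ; thinX = tX ; thinY = tY ; thinZ = tZ
    ; light = edge-light {e = e} (unique-light small un)
    ; cover = cover ∘ cov
    ; count = trans cnt (cong (λ m → 1 + 2 * (1 + m)) (trans (length-3 (edges Y) (edges Z) (edges X)) (rotate (size Y) (size Z) (size X)))) }
    where
    rotate : ∀ y z x → y + z + x ≡ x + y + z
    rotate = solve-∀
    cover : ∀ {h} → h ∈ i ∷ edges Y ++ (edges Z ++ edges X) → h ≡ i ⊎ h ∈ edges X ⊎ h ∈ edges Y ⊎ h ∈ edges Z
    cover (here p)  = inj₁ p
    cover (there m) with ∈-3 (edges Y) (edges Z) m
    ... | inj₁ m₁        = inj₂ (inj₂ (inj₁ m₁))
    ... | inj₂ (inj₁ m₁) = inj₂ (inj₂ (inj₂ m₁))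
    ... | inj₂ (inj₂ m₁) = inj₂ (inj₁ m₁)

  fork-at-root : ∀ {v x y z i e k} {t u : Arms v} {Y : Arms y} {Z : Arms z} → Run t (arm {x} i y z e Y Z []) k →
                 NonEmpty Y → NonEmpty Z → NonEmpty u → Thin t → Thin u → Spans (t ⊕ u) → Listed H
  fork-at-root {i = i} {e} {t = t} {u} {Y} {Z} r neY neZ neU tT tU sp with run-reroot r u tU neU | run-thin r tT
  ... | u′ , tU′ , neU′ , h | thin tY tZ = tri (tri-of-tree {e = e} neU′ neY neZ tU′ tY tZ
    (Spans-resp-↭ {t = t ⊕ u} {t′ = arm i _ _ e Y Z u′}
      (↭-trans (edges-⊕ t u) (↭-trans (↭-sym h) (↭-sym (edges-⊕ (arm i _ _ e Y Z []) u′)))) sp))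

  -- All degrees are at most 2 here. A fork on either side is an edge whose three vertices all have
  -- degree 2, and the root moves to it; without one, both sides are paths and join at the root.
  two : ∀ {v} {t u : Arms v} → NonEmpty t → NonEmpty u → Thin t → Thin u → Spans (t ⊕ u) → Listed H
  two {t = t} {u} neT neU tT tU sp with shape t | shape u
  ... | fork r p q | _ = fork-at-root r p q neU tT tU sp
  ... | _ | fork r p q = fork-at-root r p q neT tU tT
    (Spans-resp-↭ {t = t ⊕ u} {t′ = u ⊕ t} (↭-trans (edges-⊕ t u) (↭-trans (++-comm (edges t) (edges u)) (↭-sym (edges-⊕ u t)))) sp)
  ... | path {j = i} r | path {j = j} s with reverse-onto (run-seg r) (run-seg s) | run-nonEmpty r neT
  ...   | p , sub | 0<i = inj₁ (i + j , ≤-trans 0<i (m≤m+n i j) , ≅-A p count cover)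
    where
    count : n H ≡ 1 + 2 * (i + j)
    count = trans (proj₂ (proj₂ sp)) (cong (λ m → 1 + 2 * m) (trans (↭-length (edges-⊕ t u))
      (trans (length-++ (edges t)) (cong₂ _+_ (path-size r) (path-size s)))))
    cover : ∀ h → h ∈ segE p
    cover h with ∈-++⁻ (edges t) (∈-resp-↭ (edges-⊕ t u) (proj₁ (proj₂ sp) h))
    ... | inj₁ m = sub (inj₁ (path-edges r m))
    ... | inj₂ m = sub (inj₂ (path-edges s m))
  two neT neU tT tU sp | bush r q | _ with run-thin r tT
  two neT neU tT tU sp | bush r () | _ | thin _ _
  two neT neU tT tU sp | path _ | bush r q with run-thin r tU
  two neT neU tT tU sp | path _ | bush r () | thin _ _

  -- A root of degree 1 moves to a neighbour with a further edge, which has two sides as `two`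
  -- requires; if there is none, H is a single edge.
  one : ∀ {v i a b e} {X : Arms a} {Y : Arms b} → Thin X → Thin Y → Spans (arm {v} i a b e X Y []) → Listed H
  one {v} {i} {a} {b} {e} {[]} {[]} _ _ (un , cov , cnt) = inj₁ (1 , ≤-refl , ≅-A (step i a b e end) cnt cov)
  one {v} {i} {a} {b} {e} {X@(arm _ _ _ _ _ _ _)} {Y} tX tY sp =
    two {t = arm i v b (SameSet-swap₁₂ e) [] Y []} {X} nonEmpty nonEmpty (thin [] tY) tX
      (Spans-resp-↭ {t = arm i a b e X Y []} {t′ = arm i v b (SameSet-swap₁₂ e) [] Y X}
        (SI.solve 3 (λ i x y → i SI.⊕ (x SI.⊕ (y SI.⊕ SI.id)) SI.⊜ i SI.⊕ (y SI.⊕ x)) ↭-refl (i ∷ []) (edges X) (edges Y)) sp)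
  one {v} {i} {a} {b} {e} {[]} {Y@(arm _ _ _ _ _ _ _)} tX tY sp =
    two {t = arm i v a (SameSet-swap₁₂ (SameSet-swap₂₃ e)) [] [] []} {Y} nonEmpty nonEmpty (thin [] []) tY
      (Spans-resp-↭ {t = arm i a b e [] Y []} {t′ = arm i v a (SameSet-swap₁₂ (SameSet-swap₂₃ e)) [] [] Y}
        (SI.solve 2 (λ i y → i SI.⊕ (y SI.⊕ SI.id) SI.⊜ i SI.⊕ y) ↭-refl (i ∷ []) (edges Y)) sp)

  -- `thin-or-three` needs something on the other side of its root. With several edges at the root,
  -- the first edge and the rest serve each other; with a single edge, the search starts from its
  -- two far vertices.
  classify : ∀ {v} (t : Arms v) → NonEmpty t → Spans t → Listed H
  classify {v} (arm i a b e X Y []) _ sp = Sum.[ id , three ]′ (both (λ p q → one {e = e} p q sp)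
    (thin-or-three (arm i v b (SameSet-swap₁₂ e) [] Y []) nonEmpty X
      (Spans-resp-↭ {t = arm i a b e X Y []} {t′ = X ⊕ arm i v b (SameSet-swap₁₂ e) [] Y []} (↭-sym (↭-trans (edges-⊕ X _)
        (SI.solve 3 (λ i x y → x SI.⊕ (i SI.⊕ (y SI.⊕ SI.id)) SI.⊜ i SI.⊕ (x SI.⊕ (y SI.⊕ SI.id))) ↭-refl
          (i ∷ []) (edges X) (edges Y)))) sp))
    (thin-or-three (arm i v a (SameSet-swap₁₂ (SameSet-swap₂₃ e)) [] X []) nonEmpty Y
      (Spans-resp-↭ {t = arm i a b e X Y []} {t′ = Y ⊕ arm i v a (SameSet-swap₁₂ (SameSet-swap₂₃ e)) [] X []} (↭-sym (↭-trans (edges-⊕ Y _)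
        (SI.solve 3 (λ i x y → y SI.⊕ (i SI.⊕ (x SI.⊕ SI.id)) SI.⊜ i SI.⊕ (x SI.⊕ (y SI.⊕ SI.id))) ↭-refl
          (i ∷ []) (edges X) (edges Y)))) sp)))
  classify (arm i a b e X Y R@(arm _ _ _ _ _ _ _)) _ sp = Sum.[ id , three ]′ (both (λ p q → two {t = arm i a b e X Y []} {R} nonEmpty nonEmpty p q sp)
    (thin-or-three R nonEmpty (arm i a b e X Y []) sp)
    (thin-or-three (arm i a b e X Y []) nonEmpty R
      (Spans-resp-↭ {t = arm i a b e X Y R} {t′ = R ⊕ arm i a b e X Y []} (↭-sym (↭-trans (edges-⊕ R _)
        (SI.solve 4 (λ i x y r → r SI.⊕ (i SI.⊕ (x SI.⊕ (y SI.⊕ SI.id))) SI.⊜ i SI.⊕ (x SI.⊕ (y SI.⊕ r))) ↭-refl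
          (i ∷ []) (edges X) (edges Y) (edges R)))) sp)))

  listed : E H ≢ [] → Connected H → Listed H
  listed E≢[] conn = from-tree (spanning-tree E≢[] conn)
    where
    from-tree : ∃[ v ] Σ (Arms v) Spans → Listed H
    from-tree (v , [] , _ , cov , _) with cov (proj₁ (covered v))
    ... | ()
    from-tree (v , t@(arm _ _ _ _ _ _ _) , sp) = classify t nonEmpty sp

-- A walk from v to a vertex of some edge either is trivial, so that v lies in that edge, or begins
-- with an edge at v.
every-vertex-covered : (H : Hypergraph3) → E H ≢ [] → Connected H → ∀ v → ∃[ i ] (v ∈₃ lookup (E H) i)
every-vertex-covered H E≢[] conn v with some-edge (E H) E≢[]
  where
  some-edge : ∀ (es : List (Triple (Fin (n H)))) → es ≢ [] → ∃[ i ] ∃[ w ] (w ∈₃ lookup es i)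
  some-edge []       h = ⊥-elim (h refl)
  some-edge (e ∷ es) h = zero , proj₁ e , inj₁ refl
... | i , w , w∈ with conn v w
...   | ε       = i , w∈
...   | adj ◅ _ = Any.index adj , proj₁ (Any.lookup-index adj)

theorem2 : (H : Hypergraph3) → E H ≢ [] → Connected H → SpectralRadius<ρ₃ H →
    (∃[ k ] (1 ≤ k × H ≅ A k))
    ⊎ (∃[ k ] (3 ≤ k × H ≅ D k))
    ⊎ (∃[ k ] (4 ≤ k × H ≅ D′ k))
    ⊎ (∃[ k ] (5 ≤ k × H ≅ B k))
    ⊎ (∃[ k ] (6 ≤ k × H ≅ B′ k))
    ⊎ (∃[ k ] (7 ≤ k × H ≅ B̄ k))
    ⊎ (∃[ k ] (5 ≤ k × H ≅ BD k))
    ⊎ H ≅ E₆ ⊎ H ≅ E₇ ⊎ H ≅ E₈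
    ⊎ H ≅ Fhg 2 3 3
    ⊎ (∃[ k ] (2 ≤ k × k ≤ 6 × H ≅ Fhg 2 2 k))
    ⊎ (∃[ k ] (3 ≤ k × k ≤ 13 × H ≅ Fhg 1 3 k))
    ⊎ (∃[ k ] (4 ≤ k × k ≤ 7 × H ≅ Fhg 1 4 k))
    ⊎ H ≅ Fhg 1 5 5
    ⊎ (∃[ k ] (k ≤ 5 × H ≅ Ghg 1 1 k 1 3))
theorem2 H E≢[] conn small = Classification.listed H small (every-vertex-covered H E≢[] conn) E≢[] conn
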